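{- For every $h\in\mathbb{N}$ and for $q\in\{1,2\}$, the critical protection rate of $G_q$ equals $\frac32 qh$, i.e. $C(G_q)=\frac{3}{2}qh$.
   Context: For $h\in\mathbb{N}$ let $[h]=\{1,\dots,h\}$, viewed as a path graph. Let $G_1=(\mathbb{Z}\,\Box\,\mathbb{Z})\,\Box\,[h]$ and $G_2=(\mathbb{Z}\boxtimes\mathbb{Z})\,\Box\,[h]$, where $\Box$ is the Cartesian product and $\boxtimes$ the strong product of graphs. Both have vertex set $\mathbb{Z}\times\mathbb{Z}\times[h]$; in $G_1$ a vertex is adjacent to its 4 horizontal nearest neighbours and the vertices directly above and below it; in $G_2$ to its 8 horizontal (king-move) neighbours and the vertices directly above and below it. The firefighter game on an infinite graph $G=(V,E)$ with protection function $\mathsf f:\mathbb{N}\to\mathbb{R}_{\ge0}$: a finite set $B(0)\subset V$ of burning vertices is given. At each turn $t\in\mathbb{N}$ the player first protects (permanently) some finite collection of non-burning vertices, subject to the constraint that in total at most $\mathsf f(t)$ vertices are protected by time $t$; then every unprotected neighbour of a burning vertex becomes burning. The player contains the fire if eventually no new burning vertices are created. The critical protection rate $C(G)$ is the number such that for $\mathsf f(t)=C(G)\,t$ there exists a finite starting set $B(0)$ for which no strategy contains the fire, while for every $\varepsilon>0$ and $\mathsf f(t)=(C(G)+\varepsilon)t$, for every finite $B(0)\subset V$ there is a strategy containing the fire. -}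

module Defs where

open import Level using (0ℓ)
open import Data.Nat as ℕ using (ℕ; zero; suc; NonZero)
open import Data.Integer as ℤ using (ℤ; +_; ∣_∣)
open import Data.Fin using (Fin; toℕ)
open import Data.Product using (Σ; ∃; _×_; _,_)
open import Data.Sum using (_⊎_)
open import Data.List using (List; length)
open import Data.List.Membership.Propositional using (_∈_)
open import Data.Rational as ℚ using (ℚ)
open import Relation.Nullary using (¬_)
open import Relation.Binary.PropositionalEquality using (_≡_)

record Graph : Set₁ where
  field
    V   : Set
    Adj : V → V → Set

-- Vertices of (Z x Z) x [h] : the layer index i : Fin h stands for i+1 ∈ [h].
Vtx : ℕ → Set
Vtx h = ℤ × ℤ × Fin h

PathAdj : ∀ {h} → Fin h → Fin h → Set
PathAdj i j = suc (toℕ i) ≡ toℕ j ⊎ suc (toℕ j) ≡ toℕ i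

-- G₁ = (Z □ Z) □ [h]
G₁ : ℕ → Graph
G₁ h = record
  { V = Vtx h
  ; Adj = λ { (x , y , i) (x' , y' , j) →
        (i ≡ j × ∣ x ℤ.- x' ∣ ℕ.+ ∣ y ℤ.- y' ∣ ≡ 1)
      ⊎ (x ≡ x' × y ≡ y' × PathAdj i j) } }

-- G₂ = (Z ⊠ Z) □ [h]  (king moves horizontally)
G₂ : ℕ → Graph
G₂ h = record
  { V = Vtx h
  ; Adj = λ { (x , y , i) (x' , y' , j) →
        (i ≡ j × ℕ._⊔_ ∣ x ℤ.- x' ∣ ∣ y ℤ.- y' ∣ ≡ 1)
      ⊎ (x ≡ x' × y ≡ y' × PathAdj i j) } }

module Game (G : Graph) where
  open Graph G

  -- A strategy: P (suc t) is the finite list of vertices protected at turn suc t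
  -- (turns are 1,2,3,...; P 0 is ignored).  Since the game is deterministic,
  -- a sequence of moves is the same as an adaptive strategy.
  Strategy : Set
  Strategy = ℕ → List V

  ProtectedBy : Strategy → ℕ → V → Set
  ProtectedBy P t v = Σ ℕ λ s → (1 ℕ.≤ s) × (s ℕ.≤ t) × (v ∈ P s)

  data Burning (B0 : List V) (P : Strategy) : ℕ → V → Set where
    init   : ∀ {v} → v ∈ B0 → Burning B0 P 0 v
    stay   : ∀ {t v} → Burning B0 P t v → Burning B0 P (suc t) v
    spread : ∀ {t u v} → Burning B0 P t u → Adj u v →
             ¬ ProtectedBy P (suc t) v → Burning B0 P (suc t) v

  count : Strategy → ℕ → ℕ
  count P zero    = 0
  count P (suc t) = count P t ℕ.+ length (P (suc t))

  Legal : (ℕ → ℚ) → List V → Strategy → Set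
  Legal f B0 P =
      (∀ t v → v ∈ P (suc t) → ¬ Burning B0 P t v)
    × (∀ t → (ℤ.+ count P t) ℚ./ 1 ℚ.≤ f t)

  Contains : List V → Strategy → Set
  Contains B0 P = Σ ℕ λ T → ∀ t → T ℕ.≤ t → ∀ v →
    Burning B0 P (suc t) v → Burning B0 P t v

  linear : ℚ → ℕ → ℚ
  linear c t = c ℚ.* ((ℤ.+ t) ℚ./ 1)

  IsCriticalRate : ℚ → Set
  IsCriticalRate c =
      (Σ (List V) λ B0 → ¬ (Σ Strategy λ P → Legal (linear c) B0 P × Contains B0 P))
    × (∀ (ε : ℚ) → ℚ.0ℚ ℚ.< ε → ∀ (B0 : List V) →
         Σ Strategy λ P → Legal (linear (c ℚ.+ ε)) B0 P × Contains B0 P)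

Gq : (q : ℕ) → ℕ → Graph
Gq 1 h = G₁ h
Gq _ h = G₂ h

{-# OPTIONS --safe #-}

-- In suitable coordinates the horizontal graph is the grid ℤ² with diagonal moves (for king moves, with two half steps per
-- turn), so that balls are squares and each of the four sides of a square of fire moves outwards at unit speed.
--
-- Enough fighters: protect the boundary of a rectangle, each point at the last moment. If the distances of the four sides from
-- the fire are of rapidly increasing order, then at radius ρ about 3 ρ of the boundary has to be in place, up to lower order.
--
-- Too few fighters: follow the four sides of a growing box. For each side keep
-- (covered cells) + (fighters met) ≥ h · (width of the side). A side on which every layer burns advances: the burning cells
-- spread by one cell beyond each end, which pays for the growth of the width. A side with an empty layer is either overtaken
-- soon by the fire of another layer, with a profit that outweighs the delay, or it is dead: facing as many fighters as it has
-- burning cells. While it is dead, its growth is paid by the surplus of the two sides next to it, which it does not let grow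
-- at their common corner. As long as three sides advance, the widths of two adjacent sides together grow by 3 h per step, which
-- exceeds the supply; so two adjacent sides never die together. For opposite sides the fighters that once stopped one of the
-- other two sides make up the difference. Hence three sides advance at all times and the fire is unbounded.
module Submission where

open import Defs
open import Data.Bool.Base as Bool using (Bool; true; false; _∨_; _∧_; not; if_then_else_)
open import Data.Bool.Properties using (not-involutive)
open import Data.Empty using (⊥; ⊥-elim)
open import Data.Fin.Base using (Fin; toℕ; fromℕ<)
import Data.Fin.Properties as Fin
open import Data.Integer.Base as ℤ using (ℤ; +_; -[1+_]; ∣_∣)
import Data.Integer.Properties as ℤ
import Data.Integer.Tactic.RingSolver as ℤ-Solver
open import Data.List.Base using (List; []; _∷_; _++_; length; map; upTo; cartesianProduct; allFin)
open import Data.List.Membership.Propositional using (_∈_)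
open import Data.List.Membership.Propositional.Properties
  using (∈-++⁺ˡ; ∈-++⁺ʳ; ∈-++⁻; ∈-map⁺; ∈-map⁻; ∈-upTo⁺; ∈-cartesianProduct⁺; ∈-allFin)
open import Data.List.Properties using (length-++; length-map; length-tabulate)
open import Data.List.Relation.Unary.Any as Any using (here; there)
open import Data.Nat.Base hiding (_/_)
open import Data.Nat.Properties
open import Data.Nat.Tactic.RingSolver using (solve)
open import Data.Product using (∃; Σ; _×_; _,_; proj₁; proj₂)
import Data.Product.Properties as Product
open import Data.Rational as ℚ using (ℚ; mkℚ; _/_; toℚᵘ)
import Data.Rational.Properties as ℚ
open import Data.Rational.Unnormalised as ℚᵘ using (mkℚᵘ)
import Data.Rational.Unnormalised.Properties as ℚᵘ
open import Data.Sum using (_⊎_; inj₁; inj₂; map₁; [_,_]′)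
open import Relation.Binary.PropositionalEquality
open import Relation.Nullary using (¬_; Dec; yes; no; does)
open import Relation.Nullary.Decidable using (map′; _×-dec_; _⊎-dec_; ¬?)

-- Sums over intervals

-- At the critical rate demand and supply balance exactly: counted twice, fighters arrive at 3 h per
-- step, and three advancing sides add 3 h cells per step to two adjacent sides. What decides is the
-- head start of the initial box alone, so no loss may recur. Yet a side may have to wait
-- arbitrarily often. Hence each wait must be repaid by a profit `G` that refills the reserves `B₁`
-- and `B₂`; where no layer yields such a profit, comparing the layers one by one shows the side to
-- be dead up to a constant `H`, which enters comparisons only and never accumulates.
--
-- The memory of a walled-off axis weighs fighters by `K` but lengths and reserves by `1 + K`. So
-- what is moved from the remembered fighters to the reserve is worth more there, and the reserve
-- can make up for its own withdrawal. When the memory is renewed, the fighters leave a share of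
-- weight 1 of the length uncovered; it is covered by the distances along the axis itself, which
-- grow at a small but positive speed, since a wait of `K` steps gains at least two lines.

farkas : ∀ {A B X Y} s → X ≤ Y → A + Y + s ≡ B + X → A ≤ B
-- Certificates for linear arithmetic: `X ≤ Y` is a sum of hypotheses with nonnegative multipliers,
-- `s` is the slack, and the remaining identity `e` is left to the ring solver.
farkas {A} {B} {X} {Y} s p e = +-cancelʳ-≤ Y A B (≤-trans (m≤m+n (A + Y) s) (≤-trans (≤-reflexive e) (+-monoʳ-≤ B p)))

scale : ∀ k {a b} → a ≤ b → k * a ≤ k * b
scale k = *-monoʳ-≤ k

⟦_⟧ : Bool → ℕ
⟦ true ⟧ = 1
⟦ false ⟧ = 0

¬⟦_⟧ : Bool → ℕ
¬⟦ b ⟧ = ⟦ not b ⟧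

isZero : ℕ → Bool
isZero zero = true
isZero (suc _) = false

Sum : ℕ → (ℕ → ℕ) → ℕ
Sum zero f = 0
Sum (suc k) f = Sum k f + f k

Sum-mono : ∀ n {f g} → (∀ k → k < n → f k ≤ g k) → Sum n f ≤ Sum n g
Sum-mono zero p = z≤n
Sum-mono (suc n) p = +-mono-≤ (Sum-mono n λ k q → p k (m≤n⇒m≤1+n q)) (p n ≤-refl)

Sum-cong : ∀ n {f g} → (∀ k → f k ≡ g k) → Sum n f ≡ Sum n g
Sum-cong zero p = refl
Sum-cong (suc n) p = cong₂ _+_ (Sum-cong n p) (p n)

interchange : ∀ a b c d → a + b + (c + d) ≡ a + c + (b + d)
interchange a b c d = solve (a ∷ b ∷ c ∷ d ∷ [])

Sum-+ : ∀ n f g → Sum n (λ k → f k + g k) ≡ Sum n f + Sum n g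
Sum-+ zero f g = refl
Sum-+ (suc n) f g = trans (cong (_+ (f n + g n)) (Sum-+ n f g)) (interchange (Sum n f) (Sum n g) (f n) (g n))

Sum-const : ∀ n c → Sum n (λ _ → c) ≡ n * c
Sum-const zero c = refl
Sum-const (suc n) c = trans (cong (_+ c) (Sum-const n c)) (+-comm (n * c) c)

Sum-zero : ∀ n → Sum n (λ _ → 0) ≡ 0
Sum-zero n = trans (Sum-const n 0) (*-zeroʳ n)

Sum-swap : ∀ m n (f : ℕ → ℕ → ℕ) → Sum m (λ i → Sum n (f i)) ≡ Sum n (λ k → Sum m (λ i → f i k))
Sum-swap zero n f = sym (Sum-zero n)
Sum-swap (suc m) n f = trans (cong (_+ Sum n (f m)) (Sum-swap m n f)) (sym (Sum-+ n _ _))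

Sum-front : ∀ n f → Sum (suc n) f ≡ f 0 + Sum n (λ k → f (suc k))
Sum-front zero f = +-comm 0 (f 0)
Sum-front (suc n) f = trans (cong (_+ f (suc n)) (Sum-front n f)) (+-assoc (f 0) _ _)

Sum-term : ∀ n f k → k < n → f k ≤ Sum n f
Sum-term (suc n) f k k<n with m≤n⇒m<n∨m≡n (s≤s⁻¹ k<n)
... | inj₁ q = ≤-trans (Sum-term n f k q) (m≤m+n _ _)
... | inj₂ refl = m≤n+m _ _

Sum-≤-mono : ∀ {m n} f → m ≤ n → Sum m f ≤ Sum n f
Sum-≤-mono {n = zero} f z≤n = ≤-refl
Sum-≤-mono {m} {suc n} f m≤n with m≤n⇒m<n∨m≡n m≤n
... | inj₁ q = ≤-trans (Sum-≤-mono f (s≤s⁻¹ q)) (m≤m+n _ _)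
... | inj₂ refl = ≤-refl

Sum-pos : ∀ n f → 1 ≤ Sum n f → ∃ λ k → k < n × 1 ≤ f k
Sum-pos (suc n) f p with f n in eq
... | suc x = n , ≤-refl , ≤-trans (s≤s z≤n) (≤-reflexive (sym eq))
... | zero with Sum-pos n f (≤-trans p (≤-reflexive (+-identityʳ _)))
...   | k , k<n , q = k , m≤n⇒m≤1+n k<n , q

sc : ℤ → ℤ
sc (+ n) = + suc n
sc -[1+ zero ] = + zero
sc -[1+ suc n ] = -[1+ n ]

pd : ℤ → ℤ
pd (+ zero) = -[1+ zero ]
pd (+ suc n) = + n
pd -[1+ n ] = -[1+ suc n ]

pd-sc : ∀ z → pd (sc z) ≡ z
pd-sc (+ n) = refl
pd-sc -[1+ zero ] = refl
pd-sc -[1+ suc n ] = refl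

sc-pd : ∀ z → sc (pd z) ≡ z
sc-pd (+ zero) = refl
sc-pd (+ suc n) = refl
sc-pd -[1+ n ] = refl

neg : ℕ → ℤ
neg zero = + zero
neg (suc n) = -[1+ n ]

sc-neg : ∀ n → sc -[1+ n ] ≡ neg n
sc-neg zero = refl
sc-neg (suc n) = refl

pd-neg : ∀ n → pd (neg n) ≡ neg (suc n)
pd-neg zero = refl
pd-neg (suc n) = refl

opaque
  -- rng L R f sums f over -L ≤ c < R; the two halves follow the constructors of ℤ, so both ends can be extended by computation.
  rng : ℕ → ℕ → (ℤ → ℕ) → ℕ
  rng L R f = Sum R (λ k → f (+ k)) + Sum L (λ k → f -[1+ k ])
In : ℕ → ℕ → ℤ → Set
In L R (+ k) = k < R
In L R -[1+ k ] = k < L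

opaque
  unfolding rng

  rng-mono : ∀ L R {f g} → (∀ c → In L R c → f c ≤ g c) → rng L R f ≤ rng L R g
  rng-mono L R p = +-mono-≤ (Sum-mono R λ k → p (+ k)) (Sum-mono L λ k → p -[1+ k ])

  rng-mono′ : ∀ L R {f g} → (∀ c → f c ≤ g c) → rng L R f ≤ rng L R g
  rng-mono′ L R p = rng-mono L R (λ c _ → p c)

  rng-cong : ∀ L R {f g} → (∀ c → f c ≡ g c) → rng L R f ≡ rng L R g
  rng-cong L R p = cong₂ _+_ (Sum-cong R λ k → p (+ k)) (Sum-cong L λ k → p -[1+ k ])

  rng-+ : ∀ L R f g → rng L R (λ c → f c + g c) ≡ rng L R f + rng L R g
  rng-+ L R f g = trans (cong₂ _+_ (Sum-+ R _ _) (Sum-+ L _ _))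
    (interchange (Sum R λ k → f (+ k)) (Sum R λ k → g (+ k)) (Sum L λ k → f -[1+ k ]) (Sum L λ k → g -[1+ k ]))

  rng-const : ∀ L R c → rng L R (λ _ → c) ≡ (L + R) * c
  rng-const L R c = trans (cong₂ _+_ (Sum-const R c) (Sum-const L c)) (solve (L ∷ R ∷ c ∷ []))

  rng-zero : ∀ L R → rng L R (λ _ → 0) ≡ 0
  rng-zero L R = trans (rng-const L R 0) (*-zeroʳ (L + R))

  rng-Sum : ∀ h L R (f : ℕ → ℤ → ℕ) → Sum h (λ i → rng L R (f i)) ≡ rng L R (λ c → Sum h (λ i → f i c))
  rng-Sum h L R f = trans (Sum-+ h _ _) (cong₂ _+_ (Sum-swap h R _) (Sum-swap h L _))

  rng-≤-mono : ∀ {L R L′ R′} f → L ≤ L′ → R ≤ R′ → rng L R f ≤ rng L′ R′ f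
  rng-≤-mono f p q = +-mono-≤ (Sum-≤-mono _ q) (Sum-≤-mono _ p)

  rng-pos : ∀ L R f → 1 ≤ rng L R f → ∃ λ c → In L R c × 1 ≤ f c
  rng-pos L R f p with Sum R (λ k → f (+ k)) in eq
  ... | suc x with Sum-pos R _ (≤-trans (s≤s z≤n) (≤-reflexive (sym eq)))
  ...   | k , k<R , q = + k , k<R , q
  rng-pos L R f p | zero with Sum-pos L _ p
  ...   | k , k<L , q = -[1+ k ] , k<L , q

  addR : ∀ L R f → rng L (suc R) f ≡ rng L R f + f (+ R)
  addR L R f = swap-last (Sum R (λ k → f (+ k))) (f (+ R)) (Sum L (λ k → f -[1+ k ]))
    where
    swap-last : ∀ a b c → a + b + c ≡ a + c + b
    swap-last a b c = solve (a ∷ b ∷ c ∷ [])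

  addL : ∀ L R f → rng (suc L) R f ≡ rng L R f + f -[1+ L ]
  addL L R f = sym (+-assoc (Sum R (λ k → f (+ k))) _ _)

-- c stands for the unit cell [c , c + 1]. An inner point lies in two cells, which is why fighters are counted twice below.
cells : (ℤ → ℕ) → ℤ → ℕ
cells p c = p c + p (sc c)

opaque
  unfolding rng

  cells-sum : ∀ L R p → rng L R (cells p) + p (+ R) + p (neg L) ≡ rng L (suc R) p + rng L (suc R) p
  cells-sum zero zero p = solve-it (p (+ 0))
    where solve-it : ∀ x → 0 + x + x ≡ (0 + x + 0) + (0 + x + 0)
          solve-it x = solve (x ∷ [])
  cells-sum zero (suc R) p = step (rng 0 R (cells p)) (p (+ R)) (p (+ suc R)) (p (+ 0)) (rng 0 (suc R) p)
      (rng 0 (suc R) (cells p)) (rng 0 (suc (suc R)) p) (cells-sum zero R p) (addR 0 R (cells p)) (addR 0 (suc R) p)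
    where step : ∀ x a b n y x′ y′ → x + a + n ≡ y + y → x′ ≡ x + (a + b) → y′ ≡ y + b → x′ + b + n ≡ y′ + y′
          step x a b n y .(x + (a + b)) .(y + b) e refl refl =
            trans (r x a b n) (trans (cong (_+ (b + b)) e) (interchange y y b b))
            where r : ∀ x a b n → x + (a + b) + b + n ≡ x + a + n + (b + b)
                  r x a b n = solve (x ∷ a ∷ b ∷ n ∷ [])
  cells-sum (suc L) R p = step (rng L R (cells p)) (p (+ R)) (p -[1+ L ]) (p (neg L)) (rng L (suc R) p)
      (rng (suc L) R (cells p)) (rng (suc L) (suc R) p) (cells-sum L R p)
      (trans (addL L R (cells p)) (cong (λ z → rng L R (cells p) + (p -[1+ L ] + p z)) (sc-neg L))) (addL L (suc R) p)
    where step : ∀ x a b n y x′ y′ → x + a + n ≡ y + y → x′ ≡ x + (b + n) → y′ ≡ y + b → x′ + a + b ≡ y′ + y′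
          step x a b n y .(x + (b + n)) .(y + b) e refl refl =
            trans (r x a b n) (trans (cong (_+ (b + b)) e) (interchange y y b b))
            where r : ∀ x a b n → x + (b + n) + a + b ≡ x + a + n + (b + b)
                  r x a b n = solve (x ∷ a ∷ b ∷ n ∷ [])

shift : ℕ → ℕ → ℤ
shift zero k = + k
shift (suc L) zero = -[1+ L ]
shift (suc L) (suc k) = shift L k

sc-shift : ∀ L k → sc (shift L k) ≡ shift L (suc k)
sc-shift zero k = refl
sc-shift (suc zero) zero = refl
sc-shift (suc (suc L)) zero = refl
sc-shift (suc L) (suc k) = sc-shift L k

shift-top : ∀ L R → shift L (L + R) ≡ + R
shift-top zero R = refl
shift-top (suc L) R = shift-top L R

opaque
  unfolding rng

  rng-shift : ∀ L R f → rng L R f ≡ Sum (L + R) (λ k → f (shift L k))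
  rng-shift zero R f = +-identityʳ _
  rng-shift (suc L) R f = trans (addL L R f) (trans (cong (_+ f -[1+ L ]) (rng-shift L R f))
    (trans (+-comm _ (f -[1+ L ])) (sym (Sum-front (L + R) _))))

some-or-none : ∀ n (b : ℕ → Bool) → (∃ λ k → k < n × b k ≡ true) ⊎ (∀ k → k < n → b k ≡ false)
some-or-none zero b = inj₂ λ k ()
some-or-none (suc n) b with some-or-none n b
... | inj₁ (k , p , q) = inj₁ (k , m≤n⇒m≤1+n p , q)
... | inj₂ none = last (b n) refl
  where
  last : ∀ x → b n ≡ x → (∃ λ k → k < suc n × b k ≡ true) ⊎ (∀ k → k < suc n → b k ≡ false)
  last true e = inj₁ (n , ≤-refl , e)
  last false e = inj₂ λ k p → below k (m≤n⇒m<n∨m≡n (s≤s⁻¹ p))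
    where below : ∀ k → k < n ⊎ k ≡ n → b k ≡ false
          below k (inj₁ q) = none k q
          below .n (inj₂ refl) = e

module _ (b : ℕ → Bool) (g : ℕ → ℕ)
  (g₀ : ∀ k → b k ≡ true → 1 ≤ g k) (g₊ : ∀ k → b k ≡ true → 1 ≤ g (suc k))
  (g₋ : ∀ k → b (suc k) ≡ true → 1 ≤ g k) where

  -- A nonempty set grows past its outermost point on either side unless it already touches that end
  -- of the segment. In the induction an uncovered last point means one unit to spare, which is kept
  -- or spent on a newly covered point.
  line-growth : ∀ n → (∃ λ k → k < suc n × b k ≡ true) →
    Sum (suc n) (λ k → ⟦ b k ⟧) + ¬⟦ b 0 ⟧ + ¬⟦ b n ⟧ ≤ Sum (suc n) g
  line-growth zero (zero , _ , e) rewrite e = g₀ 0 e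
  line-growth zero (suc k , s≤s () , e)
  line-growth (suc n) (k , k<n , e) with some-or-none (suc n) b
  ... | inj₁ s = combine (Sum (suc n) (λ k → ⟦ b k ⟧)) ¬⟦ b 0 ⟧ (Sum (suc n) g) (line-growth n s)
    where
    combine : ∀ S x G → S + x + ¬⟦ b n ⟧ ≤ G → S + ⟦ b (suc n) ⟧ + x + ¬⟦ b (suc n) ⟧ ≤ G + g (suc n)
    combine S x G ih with b n in en | b (suc n) in esn
    ... | true | true = farkas {X = S + x + 0 + 1} 0 (+-mono-≤ ih (g₊ n en)) (r (g (suc n)))
      where r : ∀ y → S + 1 + x + 0 + (G + y) + 0 ≡ G + y + (S + x + 0 + 1)
            r y = solve (S ∷ x ∷ G ∷ y ∷ [])
    ... | true | false = farkas {X = S + x + 0 + 1} 0 (+-mono-≤ ih (g₊ n en)) (r (g (suc n)))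
      where r : ∀ y → S + 0 + x + 1 + (G + y) + 0 ≡ G + y + (S + x + 0 + 1)
            r y = solve (S ∷ x ∷ G ∷ y ∷ [])
    ... | false | true = farkas {X = S + x + 1} (g (suc n)) ih (r (g (suc n)))
      where r : ∀ y → S + 1 + x + 0 + G + y ≡ G + y + (S + x + 1)
            r y = solve (S ∷ x ∷ G ∷ y ∷ [])
    ... | false | false = farkas {X = S + x + 1} (g (suc n)) ih (r (g (suc n)))
      where r : ∀ y → S + 0 + x + 1 + G + y ≡ G + y + (S + x + 1)
            r y = solve (S ∷ x ∷ G ∷ y ∷ [])
  ... | inj₂ none with m≤n⇒m<n∨m≡n (s≤s⁻¹ k<n)
  ...   | inj₁ q = ⊥-elim (true≢false (trans (sym e) (none k q)))
    where true≢false : true ≢ false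
          true≢false ()
  ...   | inj₂ refl rewrite e | none 0 (s≤s z≤n) | none n ≤-refl =
    ≤-trans (≤-reflexive lhs) (+-mono-≤ (≤-trans (g₋ n e) (Sum-term (suc n) g n ≤-refl)) (g₀ (suc n) e))
    where
    zeros : Sum n (λ k → ⟦ b k ⟧) ≡ 0
    zeros = n≤0⇒n≡0 (≤-trans (Sum-mono n λ k k<n → ≤-reflexive (cong ⟦_⟧ (none k (m≤n⇒m≤1+n k<n)))) (≤-reflexive (Sum-zero n)))
    lhs : Sum n (λ k → ⟦ b k ⟧) + 0 + 1 + 1 + 0 ≡ 2
    lhs rewrite zeros = refl

dilate : (ℤ → Bool) → ℤ → Bool
dilate β c = β (pd c) ∨ (β c ∨ β (sc c))

dilate-self : ∀ β c → β c ≡ true → dilate β c ≡ true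
dilate-self β c e with β (pd c)
... | true = refl
... | false rewrite e = refl

dilate-sc : ∀ β c → β c ≡ true → dilate β (sc c) ≡ true
dilate-sc β c e rewrite pd-sc c | e = refl

dilate-pd : ∀ β c → β (sc c) ≡ true → dilate β c ≡ true
dilate-pd β c e with β (pd c) | β c
... | true | _ = refl
... | false | true = refl
... | false | false = e

⟦⟧-true : ∀ {b} → b ≡ true → 1 ≤ ⟦ b ⟧
⟦⟧-true refl = ≤-refl

true-⟦⟧ : ∀ {b} → 1 ≤ ⟦ b ⟧ → b ≡ true
true-⟦⟧ {true} p = refl

range-growth : ∀ L R β → 1 ≤ rng (suc L) (suc R) (λ c → ⟦ β c ⟧) →
  rng (suc L) (suc R) (λ c → ⟦ β c ⟧) + ¬⟦ β -[1+ L ] ⟧ + ¬⟦ β (+ R) ⟧ ≤ rng (suc L) (suc R) (λ c → ⟦ dilate β c ⟧)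
range-growth L R β p
  rewrite rng-shift (suc L) (suc R) (λ c → ⟦ β c ⟧) | rng-shift (suc L) (suc R) (λ c → ⟦ dilate β c ⟧)
        | +-suc L R | sym (shift-top L R) =
  line-growth (λ k → β (shift (suc L) k)) (λ k → ⟦ dilate β (shift (suc L) k) ⟧)
    (λ k e → ⟦⟧-true (dilate-self β (shift (suc L) k) e))
    (λ k e → ⟦⟧-true (subst (λ z → dilate β z ≡ true) (sc-shift (suc L) k) (dilate-sc β _ e)))
    (λ k e → ⟦⟧-true (dilate-pd β (shift (suc L) k) (trans (cong β (sc-shift (suc L) k)) e)))
    (suc (L + R)) (let (k , k< , q) = Sum-pos (suc (suc (L + R))) _ p in k , k< , true-⟦⟧ q)

-- The box of fire and its four sides

data Dir : Set where
  N E S W : Dir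

-- The sides of the box met at the two ends of side d, in the direction of decreasing and of increasing coordinate.
lf rt : Dir → Dir
lf N = W
lf S = W
lf E = S
lf W = S
rt N = E
rt S = E
rt E = N
rt W = N

at : ∀ {ℓ} {A : Set ℓ} → Dir → ℕ → ℤ → (ℤ → ℤ → A) → A
at N a c f = f c (+ a)
at S a c f = f c (neg a)
at E a c f = f (+ a) c
at W a c f = f (neg a) c

ΣD : (Dir → ℕ) → ℕ
ΣD f = f N + f E + f S + f W

on : Bool → ℕ → ℕ
on true x = x
on false x = 0

off : Bool → ℕ → ℕ
off true x = 0
off false x = x

bump : Bool → ℕ → ℕ
bump true x = suc x
bump false x = x

line : (ℤ → ℤ → ℕ) → Dir → ℕ → ℤ → ℕ
line q d a c = at d a c q

span : (Dir → ℕ) → Dir → (ℤ → ℕ) → ℕ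
span pos d = rng (pos (lf d)) (pos (rt d))

module Area (q : ℤ → ℤ → ℕ) where

  area : ℕ → ℕ → ℕ → ℕ → ℕ
  area w e s n = rng s (suc n) (λ v → rng w (suc e) (λ u → q u v))

  box : (Dir → ℕ) → ℕ
  box pos = area (pos W) (pos E) (pos S) (pos N)

  private
    double : ∀ L R p x y → y ≡ x + rng L (suc R) p →
      x + x + (rng L R (cells p) + p (+ R) + p (neg L)) ≤ y + y
    double L R p x .(x + rng L (suc R) p) refl =
      ≤-reflexive (trans (cong (λ z → x + x + z) (cells-sum L R p)) (interchange x x _ _))

    stepE : ∀ m w e s n → let p = line q E (suc e) in
      area w e s n + area w e s n + (on m (rng s n (cells p)) + on m (p (+ n)) + on m (p (neg s)))
        ≤ area w (bump m e) s n + area w (bump m e) s n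
    stepE false w e s n = ≤-reflexive (+-identityʳ _)
    stepE true w e s n = double s n _ _ _
      (trans (rng-cong s (suc n) (λ v → addR w (suc e) (λ u → q u v))) (rng-+ s (suc n) _ _))

    stepW : ∀ m w e s n → let p = line q W (suc w) in
      area w e s n + area w e s n + (on m (rng s n (cells p)) + on m (p (+ n)) + on m (p (neg s)))
        ≤ area (bump m w) e s n + area (bump m w) e s n
    stepW false w e s n = ≤-reflexive (+-identityʳ _)
    stepW true w e s n = double s n _ _ _
      (trans (rng-cong s (suc n) (λ v → addL w (suc e) (λ u → q u v))) (rng-+ s (suc n) _ _))

    stepN : ∀ m w e s n → let p = line q N (suc n) in
      area w e s n + area w e s n + (on m (rng w e (cells p)) + on m (p (+ e)) + on m (p (neg w)))
        ≤ area w e s (bump m n) + area w e s (bump m n)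
    stepN false w e s n = ≤-reflexive (+-identityʳ _)
    stepN true w e s n = double w e _ _ _ (addR s (suc n) _)

    stepS : ∀ m w e s n → let p = line q S (suc s) in
      area w e s n + area w e s n + (on m (rng w e (cells p)) + on m (p (+ e)) + on m (p (neg w)))
        ≤ area w e (bump m s) n + area w e (bump m s) n
    stepS false w e s n = ≤-reflexive (+-identityʳ _)
    stepS true w e s n = double w e _ _ _ (addL s (suc n) _)

    grow : ∀ m mL mR L R p →
      on m (rng (bump mL L) (bump mR R) (cells p))
        ≤ on m (rng L R (cells p)) + on m (on mR (p (+ R) + p (+ suc R))) + on m (on mL (p -[1+ L ] + p (neg L)))
    grow false mL mR L R p = z≤n
    grow true false false L R p = ≤-reflexive (sym (trans (+-identityʳ _) (+-identityʳ _)))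
    grow true false true L R p = ≤-reflexive (trans (addR L R _) (sym (+-identityʳ _)))
    grow true true false L R p = ≤-reflexive (trans (addL L R _)
      (cong₂ _+_ (sym (+-identityʳ (rng L R (cells p)))) (cong (λ z → p -[1+ L ] + p z) (sc-neg L))))
    grow true true true L R p = ≤-reflexive (trans (addL L (suc R) _)
      (cong₂ _+_ (addR L R _) (cong (λ z → p -[1+ L ] + p z) (sc-neg L))))

  assemble : ∀ b0 b1 b2 b3 b4 cE cW cN cS fE fW enE esE enW esW kE1 kE2 kW1 kW2 tNe tNw tSe tSw r1 r2 r3 r4 →
    b0 + (cE + enE + esE) ≤ b1 → b1 + (cW + enW + esW) ≤ b2 → b2 + (cN + tNe + tNw) ≤ b3 →
    b3 + (cS + tSe + tSw) ≤ b4 → fE ≤ cE + kE1 + kE2 → fW ≤ cW + kW1 + kW2 → kE1 + r1 ≤ enE + tNe →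
    kW1 + r2 ≤ enW + tNw → kE2 + r3 ≤ esE + tSe → kW2 + r4 ≤ esW + tSw →
    b0 + (cN + fE + cS + fW) + (r1 + r2 + r3 + r4) ≤ b4
  assemble b0 b1 b2 b3 b4 cE cW cN cS fE fW enE esE enW esW kE1 kE2 kW1 kW2 tNe tNw tSe tSw r1 r2 r3 r4 p0 p1 p2 p3
    p4 p5 p6 p7 p8 p9 = farkas 0 (+-mono-≤ p0 (+-mono-≤ p1 (+-mono-≤ p2 (+-mono-≤ p3 (+-mono-≤ p4 (+-mono-≤ p5
    (+-mono-≤ p6 (+-mono-≤ p7 (+-mono-≤ p8 p9))))))))) (solve (b0 ∷ b1 ∷ b2 ∷ b3 ∷ b4 ∷ cE ∷ cW ∷ cN ∷ cS ∷ fE ∷ fW ∷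
    enE ∷ esE ∷ enW ∷ esW ∷ kE1 ∷ kE2 ∷ kW1 ∷ kW2 ∷ tNe ∷ tNw ∷ tSe ∷ tSw ∷ r1 ∷ r2 ∷ r3 ∷ r4 ∷ []))

  module _ (pos : Dir → ℕ) (m : Dir → Bool) where

    pos⁺ : Dir → ℕ
    pos⁺ d = bump (m d) (pos d)

    met : Dir → ℕ
    met d = on (m d) (span pos⁺ d (cells (line q d (suc (pos d)))))

    -- A fighter on the corner next to a resting side is worth one unit more than its cell in met; the resting side takes it.
    tipR tipL : Dir → ℕ
    tipR d = on (m d) (off (m (rt d)) (at d (suc (pos d)) (+ pos (rt d)) q))
    tipL d = on (m d) (off (m (lf d)) (at d (suc (pos d)) (neg (pos (lf d))) q))

    box-grows : box pos + box pos + ΣD met + ΣD (λ d → tipR d + tipL d) ≤ box pos⁺ + box pos⁺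
    box-grows = ≤-trans (≤-reflexive (cong (_+_ (box pos + box pos + ΣD met)) (regroup (tipR N) (tipL N) (tipR E) (tipL E) (tipR S) (tipL S) (tipR W) (tipL W))))
      -- The sides move in the order E, W, N, S, so the rows of N and S have their new length but
      -- the columns of E and W the old one. At a corner where both sides move the column lacks one
      -- cell; its two ends are the end points that `cells-sum` leaves over, one on the column and
      -- one on the row.
      (assemble
        (box pos + box pos) (area w e′ s n + area w e′ s n) (area w′ e′ s n + area w′ e′ s n)
        (area w′ e′ s n′ + area w′ e′ s n′) (box pos⁺ + box pos⁺)
        (on (m E) (rng s n (cells (line q E (suc e))))) (on (m W) (rng s n (cells (line q W (suc w))))) (met N) (met S)
        (met E) (met W)
        (on (m E) (q (+ suc e) (+ n))) (on (m E) (q (+ suc e) (neg s)))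
        (on (m W) (q -[1+ w ] (+ n))) (on (m W) (q -[1+ w ] (neg s)))
        (on (m E) (on (m N) (q (+ suc e) (+ n) + q (+ suc e) (+ suc n))))
        (on (m E) (on (m S) (q (+ suc e) -[1+ s ] + q (+ suc e) (neg s))))
        (on (m W) (on (m N) (q -[1+ w ] (+ n) + q -[1+ w ] (+ suc n))))
        (on (m W) (on (m S) (q -[1+ w ] -[1+ s ] + q -[1+ w ] (neg s))))
        (on (m N) (q (+ e′) (+ suc n))) (on (m N) (q (neg w′) (+ suc n)))
        (on (m S) (q (+ e′) -[1+ s ])) (on (m S) (q (neg w′) -[1+ s ]))
        (tipR E + tipR N) (tipR W + tipL N) (tipL E + tipR S) (tipL W + tipL S)
        (stepE (m E) w e s n) (stepW (m W) w (pos⁺ E) s n)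
        (stepN (m N) (pos⁺ W) (pos⁺ E) s n) (stepS (m S) (pos⁺ W) (pos⁺ E) s (pos⁺ N))
        (grow (m E) (m S) (m N) s n (line q E (suc e))) (grow (m W) (m S) (m N) s n (line q W (suc w)))
        cNE cNW cSE cSW)
      where
      w = pos W
      e = pos E
      s = pos S
      n = pos N
      w′ = pos⁺ W
      e′ = pos⁺ E
      n′ = pos⁺ N
      regroup : ∀ a b c d e f g k → (a + b) + (c + d) + (e + f) + (g + k) ≡ (c + a) + (g + b) + (d + e) + (k + f)
      regroup a b c d e f g k = solve (a ∷ b ∷ c ∷ d ∷ e ∷ f ∷ g ∷ k ∷ [])
      cNE : on (m E) (on (m N) (q (+ suc e) (+ n) + q (+ suc e) (+ suc n))) + (tipR E + tipR N)
              ≤ on (m E) (q (+ suc e) (+ n)) + on (m N) (q (+ pos⁺ E) (+ suc n))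
      cNE with m E | m N
      ... | true | true = ≤-reflexive (+-identityʳ _)
      ... | true | false = ≤-refl
      ... | false | true = ≤-refl
      ... | false | false = z≤n
      cNW : on (m W) (on (m N) (q -[1+ w ] (+ n) + q -[1+ w ] (+ suc n))) + (tipR W + tipL N)
              ≤ on (m W) (q -[1+ w ] (+ n)) + on (m N) (q (neg (pos⁺ W)) (+ suc n))
      cNW with m W | m N
      ... | true | true = ≤-reflexive (+-identityʳ _)
      ... | true | false = ≤-refl
      ... | false | true = ≤-refl
      ... | false | false = z≤n
      cSE : on (m E) (on (m S) (q (+ suc e) -[1+ s ] + q (+ suc e) (neg s))) + (tipL E + tipR S)
              ≤ on (m E) (q (+ suc e) (neg s)) + on (m S) (q (+ pos⁺ E) -[1+ s ])
      cSE with m E | m S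
      ... | true | true = ≤-reflexive (trans (+-identityʳ _) (+-comm _ (q (+ suc e) (neg s))))
      ... | true | false = ≤-refl
      ... | false | true = ≤-refl
      ... | false | false = z≤n
      cSW : on (m W) (on (m S) (q -[1+ w ] -[1+ s ] + q -[1+ w ] (neg s))) + (tipL W + tipL S)
              ≤ on (m W) (q -[1+ w ] (neg s)) + on (m S) (q (neg (pos⁺ W)) -[1+ s ])
      cSW with m W | m S
      ... | true | true = ≤-reflexive (trans (+-identityʳ _) (+-comm _ (q -[1+ w ] (neg s))))
      ... | true | false = ≤-refl
      ... | false | true = ≤-refl
      ... | false | false = z≤n

-- Fire on the diagonal grid

even : ℕ → Bool
even zero = true
even (suc n) = not (even n)

data Near (u : ℤ) : ℤ → Set where
  up : Near u (sc u)
  dn : Near u (pd u)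

-- A fire on h layers of the diagonal grid: a step changes both coordinates by one. B τ u v i means that the point (u , v) of
-- layer i burns at time τ, and p τ u v i is the number of fighters placed there by then.
record Model (h R₀ : ℕ) : Set₁ where
  field
    B : ℕ → ℤ → ℤ → ℕ → Set
    p : ℕ → ℤ → ℤ → ℕ → ℕ
    B-mono : ∀ {τ u v i} → B τ u v i → B (suc τ) u v i
    p-mono : ∀ {τ u v i} → p τ u v i ≤ p (suc τ) u v i
    diag : ∀ {τ u v u′ v′ i} → i < h → Near u u′ → Near v v′ → B τ u v i → B (suc τ) u′ v′ i ⊎ 1 ≤ p (suc τ) u′ v′ i
    -- For king moves the half steps pass through points with two odd coordinates, which have no
    -- vertical edges, and a vertical edge takes a whole turn of two steps. A line at even distance
    -- contains no such points.
    vert : ∀ {τ u v i j} → even ∣ u ∣ ≡ true ⊎ even ∣ v ∣ ≡ true → j < h → suc i ≡ j ⊎ suc j ≡ i →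
      B τ u v i → B (2 + τ) u v j ⊎ 1 ≤ p (2 + τ) u v j
    -- Only every other point of a line is a vertex, so the most to be asked for is one burning end
    -- of each cell.
    startH : ∀ {u v i} → ∣ u ∣ ≤ R₀ → ∣ v ∣ ≡ R₀ → i < h → B 0 u v i ⊎ B 0 (sc u) v i
    startV : ∀ {u v i} → ∣ u ∣ ≡ R₀ → ∣ v ∣ ≤ R₀ → i < h → B 0 u v i ⊎ B 0 u (sc v) i
    -- Twice the fighters: 3 h per step for both graphs, since a turn is one step with 3 h / 2
    -- fighters or two half steps with 3 h fighters.
    budget : ∀ τ pos → let open Area (λ u v → Sum h (p τ u v)) in box pos + box pos ≤ 3 * h * τ

op : Dir → Dir
op N = S
op S = N
op E = W
op W = E

_==_ : Dir → Dir → Bool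
N == N = true
E == E = true
S == S = true
W == W = true
_ == _ = false

adv : Dir → ℕ → (Dir → ℕ) → Dir → ℕ
adv d k pos x = on (d == x) k + pos x

adv-≥ : ∀ d k pos x → pos x ≤ adv d k pos x
adv-≥ d k pos x = m≤n+m (pos x) (on (d == x) k)

module AreaMore (q : ℤ → ℤ → ℕ) where
  open Area q

  box-mono : ∀ pos pos′ → (∀ d → pos d ≤ pos′ d) → box pos ≤ box pos′
  box-mono pos pos′ le = ≤-trans (rng-≤-mono _ (le S) (s≤s (le N)))
    (rng-mono′ (pos′ S) (suc (pos′ N)) λ v → rng-≤-mono _ (le W) (s≤s (le E)))

  strip : (Dir → ℕ) → ℕ → Dir → ℕ
  strip pos δ d = Sum δ (λ k → span pos d (cells (line q d (suc k + pos d))))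

  box-strip : ∀ d δ pos → box pos + box pos + strip pos δ d ≤ box (adv d δ pos) + box (adv d δ pos)
  box-strip d zero pos = ≤-trans (≤-reflexive (+-identityʳ _)) (≤-reflexive (cong (λ z → z + z) (same d)))
    where same : ∀ d → box pos ≡ box (adv d 0 pos)
          same N = refl
          same E = refl
          same S = refl
          same W = refl
  box-strip d (suc δ) pos =
    ≤-trans (≤-reflexive (sym (+-assoc (box pos + box pos) (strip pos δ d) _)))
    (≤-trans (+-monoˡ-≤ _ (box-strip d δ pos))
    (≤-trans (+-monoʳ-≤ (b + b) (last d)) (≤-trans (≤-trans (m≤m+n _ _) (box-grows (adv d δ pos) (d ==_)))
      (+-mono-≤ final final))))
    where
    b = box (adv d δ pos)
    last : ∀ d → span pos d (cells (line q d (suc δ + pos d))) ≤ ΣD (met (adv d δ pos) (d ==_))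
    last N = ≤-trans (m≤m+n _ _) (≤-trans (m≤m+n _ _) (m≤m+n _ _))
    last E = ≤-trans (m≤m+n _ _) (m≤m+n _ _)
    last S = m≤m+n _ _
    last W = ≤-refl
    final : box (pos⁺ (adv d δ pos) (d ==_)) ≤ box (adv d (suc δ) pos)
    final = box-mono _ _ (λ x → step (d == x) x)
      where step : ∀ t x → bump t (on t δ + pos x) ≤ on t (suc δ) + pos x
            step true x = ≤-refl
            step false x = ≤-refl

  -- The strips are adjoined one after the other; sides reached later are already longer than their
  -- strips require, and the surplus at the corners is given away. Thus the fighters ahead of all
  -- four sides fit into a single budget.
  box-strips : ∀ δ pos → box pos + box pos + ΣD (strip pos δ) ≤ box (λ d → δ + pos d) + box (λ d → δ + pos d)
  box-strips δ pos = chain (box pos + box pos) (strip pos δ N) (strip pos δ E) (strip pos δ S) (strip pos δ W)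
      _ _ _ (box-strip N δ pos)
      (≤-trans (+-monoʳ-≤ (box p₁ + box p₁) (wider E p₁ (adv-≥ N δ pos) refl)) (box-strip E δ p₁))
      (≤-trans (+-monoʳ-≤ (box p₂ + box p₂) (wider S p₂ (λ x → ≤-trans (adv-≥ N δ pos x) (adv-≥ E δ p₁ x)) refl)) (box-strip S δ p₂))
      (≤-trans (+-monoʳ-≤ (box p₃ + box p₃) (wider W p₃ (λ x → ≤-trans (≤-trans (adv-≥ N δ pos x) (adv-≥ E δ p₁ x)) (adv-≥ S δ p₂ x)) refl)) (box-strip W δ p₃))
      (+-mono-≤ final final)
    where
    p₁ = adv N δ pos
    p₂ = adv E δ p₁
    p₃ = adv S δ p₂
    p₄ = adv W δ p₃
    wider : ∀ d pos′ → (∀ x → pos x ≤ pos′ x) → pos′ d ≡ pos d → strip pos δ d ≤ strip pos′ δ d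
    wider d pos′ le e = Sum-mono δ λ k _ → ≤-trans (rng-≤-mono _ (le (lf d)) (le (rt d)))
      (≤-reflexive (cong (λ z → span pos′ d (cells (line q d (suc k + z)))) (sym e)))
    final : box p₄ ≤ box (λ d → δ + pos d)
    final = box-mono p₄ (λ d → δ + pos d) λ { N → ≤-refl ; E → ≤-refl ; S → ≤-refl ; W → ≤-refl }
    chain : ∀ a n e s w {x₄} x₁ x₂ x₃ → a + n ≤ x₁ → x₁ + e ≤ x₂ → x₂ + s ≤ x₃ → ∀ {y} → x₃ + w ≤ y → y ≤ x₄ → a + (n + e + s + w) ≤ x₄
    chain a n e s w x₁ x₂ x₃ h₁ h₂ h₃ h₄ h₅ = ≤-trans (≤-reflexive (r a n e s w))
      (≤-trans (+-monoˡ-≤ w (≤-trans (+-monoˡ-≤ s (≤-trans (+-monoˡ-≤ e h₁) h₂)) h₃)) (≤-trans h₄ h₅))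
      where r : ∀ a n e s w → a + (n + e + s + w) ≡ a + n + e + s + w
            r a n e s w = solve (a ∷ n ∷ e ∷ s ∷ w ∷ [])

gain : Bool → Bool → ℕ
gain true b = 1
gain false b = ¬⟦ b ⟧

⟦⟧-split : ∀ b → 1 ≤ ⟦ b ⟧ + ¬⟦ b ⟧
⟦⟧-split true = ≤-refl
⟦⟧-split false = ≤-refl

⟦⟧-mono : ∀ {b b′} → (b ≡ true → b′ ≡ true) → ⟦ b ⟧ ≤ ⟦ b′ ⟧
⟦⟧-mono {true} f = ⟦⟧-true (f refl)
⟦⟧-mono {false} f = z≤n

-- Where the adjacent side moves, the line is extended by a cell, which is covered if the old end
-- cell was; if it was not, the set grows inside the old line. So the gain is certain there, while
-- at a resting side it requires an uncovered end cell.
layer-growth : ∀ mL mR L R β → 1 ≤ rng (suc L) (suc R) (λ c → ⟦ β c ⟧) →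
  rng (suc L) (suc R) (λ c → ⟦ β c ⟧) + gain mL (β -[1+ L ]) + gain mR (β (+ R))
    ≤ rng (bump mL (suc L)) (bump mR (suc R)) (λ c → ⟦ dilate β c ⟧)
layer-growth mL mR L R β ne = ≤-trans (adjust mL mR) (grown mL mR)
  where
  g = λ c → ⟦ dilate β c ⟧
  r = rng (suc L) (suc R) (λ c → ⟦ β c ⟧)
  r′ = rng (suc L) (suc R) g
  base : r + ¬⟦ β -[1+ L ] ⟧ + ¬⟦ β (+ R) ⟧ ≤ r′
  base = range-growth L R β ne
  endL : ⟦ β -[1+ L ] ⟧ ≤ g -[1+ suc L ]
  endL = ⟦⟧-mono (dilate-pd β -[1+ suc L ])
  endR : ⟦ β (+ R) ⟧ ≤ g (+ suc R)
  endR = ⟦⟧-mono (dilate-sc β (+ R))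
  adjust : ∀ mL mR → r + gain mL (β -[1+ L ]) + gain mR (β (+ R)) ≤ r′ + on mL (g -[1+ suc L ]) + on mR (g (+ suc R))
  adjust mL mR = combine r (gain mL (β -[1+ L ])) (gain mR (β (+ R))) ¬⟦ β -[1+ L ] ⟧ ¬⟦ β (+ R) ⟧ r′ _ _
      base (one mL (β -[1+ L ]) endL) (one mR (β (+ R)) endR)
    where
    one : ∀ m b {x} → ⟦ b ⟧ ≤ x → gain m b ≤ on m x + ¬⟦ b ⟧
    one true b le = ≤-trans (⟦⟧-split b) (+-monoˡ-≤ _ le)
    one false b le = ≤-refl
    combine : ∀ r a b x y r′ c d → r + x + y ≤ r′ → a ≤ c + x → b ≤ d + y → r + a + b ≤ r′ + c + d
    combine r a b x y r′ c d p0 p1 p2 = farkas 0 (+-mono-≤ p0 (+-mono-≤ p1 p2)) (solve (r ∷ a ∷ b ∷ x ∷ y ∷ r′ ∷ c ∷ d ∷ []))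
  grown : ∀ mL mR → r′ + on mL (g -[1+ suc L ]) + on mR (g (+ suc R)) ≤ rng (bump mL (suc L)) (bump mR (suc R)) g
  grown false false = ≤-reflexive (trans (+-identityʳ _) (+-identityʳ _))
  grown false true = ≤-reflexive (trans (cong (_+ g (+ suc R)) (+-identityʳ _)) (sym (addR (suc L) (suc R) g)))
  grown true false = ≤-reflexive (trans (+-identityʳ _) (sym (addL (suc L) (suc R) g)))
  grown true true = ≤-reflexive (trans (cong (_+ g (+ suc R)) (sym (addL (suc L) (suc R) g))) (sym (addR (suc (suc L)) (suc R) g)))

module Burning {h R₀} (M : Model h R₀) where
  open Model M public

  P : ℕ → ℤ → ℤ → ℕ
  P τ u v = Sum h (p τ u v)

  layer : ℕ → ℕ → ℤ → ℤ → ℕ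
  layer τ i u v = p τ u v i

  record Bat (τ : ℕ) (d : Dir) (a : ℕ) (c : ℤ) (i : ℕ) : Set where
    constructor bat
    field unBat : at d a c (λ u v → B τ u v i)

  -- The cell [c , c + 1] of the line at distance a in direction d is covered when one of its endpoints burns.
  CB : ℕ → Dir → ℕ → ℤ → ℕ → Set
  CB τ d a c i = Bat τ d a c i ⊎ Bat τ d a (sc c) i

  Bat-mono : ∀ d {τ a c i} → Bat τ d a c i → Bat (suc τ) d a c i
  Bat-mono N (bat b) = bat (B-mono b)
  Bat-mono E (bat b) = bat (B-mono b)
  Bat-mono S (bat b) = bat (B-mono b)
  Bat-mono W (bat b) = bat (B-mono b)

  CB-mono : ∀ d {τ a c i} → CB τ d a c i → CB (suc τ) d a c i
  CB-mono d = [ (λ x → inj₁ (Bat-mono d x)) , (λ x → inj₂ (Bat-mono d x)) ]′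

  CB-mono+ : ∀ d k {τ a c i} → CB τ d a c i → CB (k + τ) d a c i
  CB-mono+ d zero x = x
  CB-mono+ d (suc k) x = CB-mono d (CB-mono+ d k x)

  P-mono : ∀ τ u v → P τ u v ≤ P (suc τ) u v
  P-mono τ u v = Sum-mono h λ i _ → p-mono

  P-mono+ : ∀ k τ u v → P τ u v ≤ P (k + τ) u v
  P-mono+ zero τ u v = ≤-refl
  P-mono+ (suc k) τ u v = ≤-trans (P-mono+ k τ u v) (P-mono (k + τ) u v)

  line-mono : ∀ {q q′ : ℤ → ℤ → ℕ} → (∀ u v → q u v ≤ q′ u v) → ∀ d a c → line q d a c ≤ line q′ d a c
  line-mono le N a c = le _ _
  line-mono le E a c = le _ _
  line-mono le S a c = le _ _
  line-mono le W a c = le _ _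

  cells-mono : ∀ {q q′ : ℤ → ℤ → ℕ} → (∀ u v → q u v ≤ q′ u v) → ∀ d a c → cells (line q d a) c ≤ cells (line q′ d a) c
  cells-mono le d a c = +-mono-≤ (line-mono le d a c) (line-mono le d a (sc c))

  Bat-step : ∀ d {τ a c c′ i} → i < h → Near c c′ → Bat τ d a c i → Bat (suc τ) d (suc a) c′ i ⊎ 1 ≤ line (layer (suc τ) i) d (suc a) c′
  Bat-step N i< nr (bat b) = map₁ bat (diag i< nr up b)
  Bat-step E i< nr (bat b) = map₁ bat (diag i< up nr b)
  Bat-step S {τ} {a} {c} {c′} {i} i< nr (bat b) =
    map₁ bat (subst (λ z → B (suc τ) c′ z i ⊎ 1 ≤ p (suc τ) c′ z i) (pd-neg a) (diag i< nr dn b))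
  Bat-step W {τ} {a} {c} {c′} {i} i< nr (bat b) =
    map₁ bat (subst (λ z → B (suc τ) z c′ i ⊎ 1 ≤ p (suc τ) z c′ i) (pd-neg a) (diag i< dn nr b))

  Next : ℕ → Dir → ℕ → ℤ → ℕ → Set
  Next τ d a c i = CB τ d a c i ⊎ 1 ≤ cells (line (layer τ i) d a) c

  next₁ : ∀ {τ d a c i} → Bat τ d a c i ⊎ 1 ≤ line (layer τ i) d a c → Next τ d a c i
  next₁ (inj₁ b) = inj₁ (inj₁ b)
  next₁ (inj₂ q) = inj₂ (≤-trans q (m≤m+n _ _))

  next₂ : ∀ {τ d a c c′ i} → sc c ≡ c′ → Bat τ d a c′ i ⊎ 1 ≤ line (layer τ i) d a c′ → Next τ d a c i
  next₂ refl (inj₁ b) = inj₁ (inj₂ b)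
  next₂ refl (inj₂ q) = inj₂ (≤-trans q (m≤n+m _ _))

  CB-self : ∀ {τ d a c i} → i < h → CB τ d a c i → Next (suc τ) d (suc a) c i
  CB-self {d = d} {c = c} i< (inj₁ b) = next₂ refl (Bat-step d i< up b)
  CB-self {d = d} {c = c} i< (inj₂ b) = next₁ (subst (λ z → Bat _ d _ z _ ⊎ 1 ≤ line _ d _ z) (pd-sc c) (Bat-step d i< dn b))

  CB-up : ∀ {τ d a c i} → i < h → CB τ d a c i → Next (suc τ) d (suc a) (sc c) i
  CB-up {d = d} i< (inj₁ b) = next₁ (Bat-step d i< up b)
  CB-up {d = d} i< (inj₂ b) = next₂ refl (Bat-step d i< up b)

  CB-dn : ∀ {τ d a c i} → i < h → CB τ d a (sc c) i → Next (suc τ) d (suc a) c i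
  CB-dn {d = d} {c = c} i< (inj₁ b) = next₁ (subst (λ z → Bat _ d _ z _ ⊎ 1 ≤ line _ d _ z) (pd-sc c) (Bat-step d i< dn b))
  CB-dn {d = d} {c = c} i< (inj₂ b) = next₂ refl (subst (λ z → Bat _ d _ z _ ⊎ 1 ≤ line _ d _ z) (pd-sc (sc c)) (Bat-step d i< dn b))

  -- Whichever end of a covered cell burns, its two diagonal moves to the next line reach an end of
  -- the cell itself and of both its neighbours. Working with cells thus makes the parity of the
  -- points disappear.
  CB-dilate : ∀ {τ d a i} β → i < h → (∀ c → β c ≡ true → CB τ d a c i) → ∀ c → dilate β c ≡ true → Next (suc τ) d (suc a) c i
  CB-dilate {τ} {d} {a} {i} β i< bt c e with β (pd c) in e₁ | β c in e₂
  ... | true | _ = subst (λ z → Next (suc τ) d (suc a) z i) (sc-pd c) (CB-up {τ} {d} {a} {pd c} {i} i< (bt (pd c) e₁))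
  ... | false | true = CB-self {τ} {d} {a} {c} {i} i< (bt c e₂)
  ... | false | false = CB-dn {τ} {d} {a} {c} {i} i< (bt (sc c) e)

  _free_ : (ℤ → Bool) → (ℤ → ℕ) → ℤ → Bool
  (γ free w) c = γ c ∧ isZero (w c)

  free-count : ∀ γ w c → ⟦ γ c ⟧ ≤ ⟦ (γ free w) c ⟧ + w c
  free-count γ w c with γ c | w c
  ... | true | zero = ≤-refl
  ... | true | suc x = s≤s z≤n
  ... | false | _ = z≤n

  free-burnt : ∀ {A : Set} γ w c → (γ c ≡ true → A ⊎ 1 ≤ w c) → (γ free w) c ≡ true → A
  free-burnt γ w c f e with γ c | w c
  free-burnt γ w c f e | true | zero with f refl
  ... | inj₁ a = a

  -- The cell that the line of a side gains when the side x , at distance a , advances.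
  beyond : Dir → ℕ → ℤ
  beyond N a = + a
  beyond E a = + a
  beyond S a = -[1+ a ]
  beyond W a = -[1+ a ]

  -- The outer end of the last cell is the corner of the box. If it burns, it already lies on the
  -- adjacent line; if the inner end burns, its diagonal move leads to the other end of the new
  -- cell, so a single point decides whether a fighter prevents this.
  endR : ∀ x {τ a R i} → i < h → CB τ x a (+ R) i →
    CB (suc τ) (rt x) (suc R) (beyond x a) i ⊎ 1 ≤ at x (suc a) (+ suc R) (layer (suc τ) i)
  endR N i< (inj₂ (bat b)) = inj₁ (inj₁ (bat (B-mono b)))
  endR N i< (inj₁ (bat b)) = map₁ (λ z → inj₂ (bat z)) (diag i< up up b)
  endR E i< (inj₂ (bat b)) = inj₁ (inj₁ (bat (B-mono b)))
  endR E i< (inj₁ (bat b)) = map₁ (λ z → inj₂ (bat z)) (diag i< up up b)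
  endR S {τ} {a} {R} {i} i< (inj₂ (bat b)) = inj₁ (inj₂ (bat (subst (λ z → B (suc τ) (+ suc R) z i) (sym (sc-neg a)) (B-mono b))))
  endR S {τ} {a} {R} {i} i< (inj₁ (bat b)) = map₁ (λ z → inj₁ (bat z))
    (subst (λ z → B (suc τ) (+ suc R) z i ⊎ 1 ≤ p (suc τ) (+ suc R) z i) (pd-neg a) (diag i< up dn b))
  endR W {τ} {a} {R} {i} i< (inj₂ (bat b)) = inj₁ (inj₂ (bat (subst (λ z → B (suc τ) z (+ suc R) i) (sym (sc-neg a)) (B-mono b))))
  endR W {τ} {a} {R} {i} i< (inj₁ (bat b)) = map₁ (λ z → inj₁ (bat z))
    (subst (λ z → B (suc τ) z (+ suc R) i ⊎ 1 ≤ p (suc τ) z (+ suc R) i) (pd-neg a) (diag i< dn up b))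

  endL : ∀ x {τ a L i} → i < h → CB τ x a -[1+ L ] i →
    CB (suc τ) (lf x) (suc L) (beyond x a) i ⊎ 1 ≤ at x (suc a) -[1+ L ] (layer (suc τ) i)
  endL N i< (inj₁ (bat b)) = inj₁ (inj₁ (bat (B-mono b)))
  endL N {L = L} i< (inj₂ (bat b)) = map₁ (λ z → inj₂ (bat z)) (subst (λ z → B _ z _ _ ⊎ 1 ≤ p _ z _ _) (pd-sc -[1+ L ]) (diag i< dn up b))
  endL E i< (inj₁ (bat b)) = inj₁ (inj₁ (bat (B-mono b)))
  endL E {L = L} i< (inj₂ (bat b)) = map₁ (λ z → inj₂ (bat z)) (subst (λ z → B _ _ z _ ⊎ 1 ≤ p _ _ z _) (pd-sc -[1+ L ]) (diag i< up dn b))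
  endL S {τ} {a} {L} {i} i< (inj₁ (bat b)) = inj₁ (inj₂ (bat (subst (λ z → B (suc τ) -[1+ L ] z i) (sym (sc-neg a)) (B-mono b))))
  endL S {τ} {a} {L} {i} i< (inj₂ (bat b)) = map₁ (λ z → inj₁ (bat z))
    (subst₂ (λ y z → B (suc τ) y z i ⊎ 1 ≤ p (suc τ) y z i) (pd-sc -[1+ L ]) (pd-neg a) (diag i< dn dn b))
  endL W {τ} {a} {L} {i} i< (inj₁ (bat b)) = inj₁ (inj₂ (bat (subst (λ z → B (suc τ) z -[1+ L ] i) (sym (sc-neg a)) (B-mono b))))
  endL W {τ} {a} {L} {i} i< (inj₂ (bat b)) = map₁ (λ z → inj₁ (bat z))
    (subst₂ (λ z y → B (suc τ) z y i ⊎ 1 ≤ p (suc τ) z y i) (pd-neg a) (pd-sc -[1+ L ]) (diag i< dn dn b))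

-- Looking ahead across the layers

Sum-bump : ∀ n f g i G → i < n → (∀ k → k < n → k ≢ i → f k ≤ g k) → f i + G ≤ g i → Sum n f + G ≤ Sum n g
Sum-bump (suc n) f g i G i<n le big with i ≟ n
... | yes refl = ≤-trans (≤-reflexive (+-assoc (Sum n f) (f n) G))
    (+-mono-≤ (Sum-mono n λ k k<n → le k (m≤n⇒m≤1+n k<n) (<⇒≢ k<n)) big)
... | no i≢n = ≤-trans (≤-reflexive (swap (Sum n f) (f n) G))
    (+-mono-≤ (Sum-bump n f g i G (≤∧≢⇒< (s≤s⁻¹ i<n) i≢n) (λ k k<n → le k (m≤n⇒m≤1+n k<n)) big)
      (le n ≤-refl (λ e → i≢n (sym e))))
  where swap : ∀ a b c → a + b + c ≡ a + c + b
        swap a b c = solve (a ∷ b ∷ c ∷ [])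

Sum-line : ∀ n (f : ℕ → ℤ → ℤ → ℕ) d a c → Sum n (λ i → line (f i) d a c) ≡ line (λ u v → Sum n (λ i → f i u v)) d a c
Sum-line n f N a c = refl
Sum-line n f E a c = refl
Sum-line n f S a c = refl
Sum-line n f W a c = refl

Sum-cell : ∀ n (f : ℕ → ℤ → ℤ → ℕ) d a c →
  Sum n (λ i → cells (line (f i) d a) c) ≡ cells (line (λ u v → Sum n (λ i → f i u v)) d a) c
Sum-cell n f d a c = trans (Sum-+ n _ _) (cong₂ _+_ (Sum-line n f d a c) (Sum-line n f d a (sc c)))

dist-step : ∀ j k → suc ∣ j - k ∣ ≡ ∣ j - suc k ∣ ⊎ suc ∣ j - suc k ∣ ≡ ∣ j - k ∣
dist-step zero k = inj₁ refl
dist-step (suc j) zero = inj₂ (cong suc (∣-∣-identityʳ j))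
dist-step (suc j) (suc k) = dist-step j k

dist-bound : ∀ j k h → j < h → k < j + h → ∣ j - k ∣ < h
dist-bound j k h j<h k< with ≤-total j k
... | inj₁ j≤k = ≤-trans (≤-reflexive (cong suc (m≤n⇒∣m-n∣≡n∸m j≤k)))
  (+-cancelˡ-≤ j _ _ (≤-trans (≤-reflexive (trans (+-suc j (k ∸ j)) (cong suc (m+[n∸m]≡n j≤k)))) k<))
... | inj₂ k≤j = ≤-trans (s≤s (≤-trans (≤-reflexive (m≤n⇒∣n-m∣≡n∸m k≤j)) (m∸n≤m j k))) j<h

oddness : ℕ → ℕ
oddness a = if even a then 0 else 1

even-oddness : ∀ a → even (oddness a + a) ≡ true
even-oddness a with even a in e
... | true = e
... | false = cong not e

even-double : ∀ k n → even (k + k + n) ≡ even n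
even-double zero n = refl
even-double (suc k) n rewrite +-suc k k = trans (not-involutive _) (even-double k n)

∣neg∣ : ∀ n → ∣ neg n ∣ ≡ n
∣neg∣ zero = refl
∣neg∣ (suc n) = refl

≡ᵇ-refl : ∀ n → (n ≡ᵇ n) ≡ true
≡ᵇ-refl zero = refl
≡ᵇ-refl (suc n) = ≡ᵇ-refl n

≡ᵇ-true : ∀ m n → (m ≡ᵇ n) ≡ true → m ≡ n
≡ᵇ-true zero zero e = refl
≡ᵇ-true (suc m) (suc n) e = cong suc (≡ᵇ-true m n e)

≡ᵇ-false : ∀ m n → m ≢ n → (m ≡ᵇ n) ≡ false
≡ᵇ-false zero zero ne = ⊥-elim (ne refl)
≡ᵇ-false zero (suc n) ne = refl
≡ᵇ-false (suc m) zero ne = refl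
≡ᵇ-false (suc m) (suc n) ne = ≡ᵇ-false m n (λ e → ne (cong suc e))

copy-sum : ∀ mj G c bj p s mi bi → s ≤ c + p → mi ≤ s + bi → mj + bi + G ≤ mi + bj → mj + G ≤ c + (bj + p)
copy-sum mj G c bj p s mi bi p0 p1 p2 = farkas 0 (+-mono-≤ p0 (+-mono-≤ p1 p2)) (solve (mj ∷ G ∷ c ∷ bj ∷ p ∷ s ∷
  mi ∷ bi ∷ []))

reach-bound : ∀ h n x → x ≤ 1 → 1 + (1 + n) ≤ h + h → 1 + (n + (1 + n) + x) ≤ 4 * h
reach-bound h n x p0 p1 = farkas 1 (+-mono-≤ p0 (scale 2 p1)) (solve (h ∷ n ∷ x ∷ []))

within-bound : ∀ h k x → x ≤ 1 → 1 + k ≤ h + h → k + k + x ≤ 4 * h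
within-bound h k x p0 p1 = farkas 1 (+-mono-≤ p0 (scale 2 p1)) (solve (h ∷ k ∷ x ∷ []))

walk-step : ∀ m1 m0 b0′ b1 b0 G n → 1 + (m1 + b0′) ≤ m0 + b1 + G → m0 ≤ b0 + n * G → b0 ≤ b0′ →
  m1 ≤ b1 + (1 + n) * G
walk-step m1 m0 b0′ b1 b0 G n p0 p1 p2 = farkas 1 (+-mono-≤ p0 (+-mono-≤ p1 p2)) (solve (m1 ∷ m0 ∷ b0′ ∷ b1 ∷ b0 ∷
  G ∷ n ∷ []))

module Constants (h : ℕ) where

  opaque
    -- D bounds the number of lines looked ahead and K the time this takes; Pay is the price of such a delay, G the profit
    -- asked for in return, and H what is lost when all layers are compared with an empty one.
    D K C₁ C₂ Pay G H κ R₀ : ℕ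
    -- The walk over the layers takes fewer than 2 h steps of two lines each, and one more line may
    -- be needed to make the distance even. The final vertical move adds two to the time.
    D = 4 * h
    K = 2 + D
    -- `C₁` restores the progress lost in a jump and `C₂` the potential; 2 h D pays for the new
    -- cells on the two adjacent sides. `G` also provides for the line growing by two cells per
    -- layer in each of the `K` steps of the wait.
    C₁ = h * K
    C₂ = (1 + K) * (h * K + 2 * (h * D) + C₁)
    Pay = 2 * (h * D) + C₁ + C₂
    G = Pay + 2 * (h * K)
    H = h * (2 * h * G)
    -- `κ` absorbs the constants of `axis-refresh`, and `R₀` makes the head start exceed those of
    -- the two clashes. `R₀` is even because on the doubled grid lines at odd distance contain no
    -- vertices.
    κ = h * (2 * K + 2) + H + 4 * (h * K)
    R₀ = 2 * (9 * K + κ + 2 * H + 1)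

    4h≤D : 4 * h ≤ D
    4h≤D = ≤-refl

    2+D≤K : 2 + D ≤ K
    2+D≤K = ≤-refl

    C₁-def : C₁ ≡ h * K
    C₁-def = refl

    C₂-def : C₂ ≡ (1 + K) * (h * K + 2 * (h * D) + C₁)
    C₂-def = refl

    Pay-def : Pay ≡ 2 * (h * D) + C₁ + C₂
    Pay-def = refl

    G-def : G ≡ Pay + 2 * (h * K)
    G-def = refl

    H-def : H ≡ h * (2 * h * G)
    H-def = refl

    κ-def : κ ≡ h * (2 * K + 2) + H + 4 * (h * K)
    κ-def = refl

    R₀-def : R₀ ≡ 2 * (9 * K + κ + 2 * H + 1)
    R₀-def = refl

  D≤K : D ≤ K
  D≤K = ≤-trans (m≤n+m D 2) 2+D≤K

module Ahead (h : ℕ) (M : Model h (Constants.R₀ h)) where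
  open Constants h
  open Burning M

  ahead : ℕ → Dir → ℕ → ℕ → ℕ → ℕ → ℕ
  ahead τ d a L R δ = Sum δ (λ k → rng L R (cells (line (P τ) d (suc k + a))))

  record Breakthrough (τ : ℕ) (d : Dir) (a L R m : ℕ) : Set where
    field
      δ : ℕ
      2≤δ : 2 ≤ δ
      δ≤D : δ ≤ D
      β′ : ℕ → ℤ → Bool
      burnt′ : ∀ i → i < h → ∀ c → β′ i c ≡ true → CB τ d (δ + a) c i
      profit : m + G ≤ Sum h (λ i → rng L R (λ c → ⟦ β′ i c ⟧)) + ahead τ d a L R δ

  CB-vert : ∀ d {τ a c i j} → even a ≡ true → j < h → suc i ≡ j ⊎ suc j ≡ i → CB τ d a c i → Next (2 + τ) d a c j
  CB-vert d {τ} {a} {c} {i} {j} ev j<h adj = [ (λ b → next₁ (vertical d b)) , (λ b → next₂ refl (vertical d b)) ]′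
    where
    ev′ : even ∣ neg a ∣ ≡ true
    ev′ = trans (cong even (∣neg∣ a)) ev
    vertical : ∀ d {c} → Bat τ d a c i → Bat (2 + τ) d a c j ⊎ 1 ≤ line (layer (2 + τ) j) d a c
    vertical N (bat b) = map₁ bat (vert (inj₂ ev) j<h adj b)
    vertical E (bat b) = map₁ bat (vert (inj₁ ev) j<h adj b)
    vertical S (bat b) = map₁ bat (vert (inj₂ ev′) j<h adj b)
    vertical W (bat b) = map₁ bat (vert (inj₁ ev′) j<h adj b)

  module _ (τ : ℕ) (d : Dir) (a L R : ℕ) (β : ℕ → ℤ → Bool)
    (burnt : ∀ i → i < h → ∀ c → β i c ≡ true → CB τ d a c i) where

    private
      m : ℕ → ℕ
      m i = rng L R (λ c → ⟦ β i c ⟧)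

      π : ℕ → ℕ → ℤ → ℕ
      π k i = cells (line (layer (K + τ) i) d (suc k + a))

      blk : ℕ → ℕ → ℕ
      blk i δ = Sum δ (λ k → rng L R (π k i))

      blk-total : ∀ δ → Sum h (λ i → blk i δ) ≡ ahead (K + τ) d a L R δ
      blk-total δ = trans (Sum-swap h δ (λ i k → rng L R (π k i))) (Sum-cong δ λ k →
        trans (rng-Sum h L R (π k)) (rng-cong L R λ c → Sum-cell h (λ i → layer (K + τ) i) d (suc k + a) c))

      layer-mono : ∀ {j} → j ≤ K → ∀ i u v → layer (j + τ) i u v ≤ layer (K + τ) i u v
      layer-mono {j} j≤K i u v = subst (λ z → layer (j + τ) i u v ≤ layer (z + τ) i u v) (m∸n+n≡m j≤K)
        (subst (λ z → layer (j + τ) i u v ≤ layer z i u v) (sym (+-assoc (K ∸ j) j τ)) (go (K ∸ j)))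
        where go : ∀ k → layer (j + τ) i u v ≤ layer (k + (j + τ)) i u v
              go zero = ≤-refl
              go (suc k) = ≤-trans (go k) p-mono

      later : ∀ {j e c i} → j ≤ K → CB (j + τ) d e c i → CB (K + τ) d e c i
      later {j} {e} {c} {i} j≤K b = subst (λ z → CB (z + τ) d e c i) (m∸n+n≡m j≤K)
        (subst (λ z → CB z d e c i) (sym (+-assoc (K ∸ j) j τ)) (CB-mono+ d (K ∸ j) b))

      straight : ∀ δ → δ ≤ K → ∀ i → i < h → ∀ c → β i c ≡ true → CB (δ + τ) d (δ + a) c i ⊎ 1 ≤ Sum δ (λ k → π k i c)
      straight zero _ i i<h c e = inj₁ (burnt i i<h c e)
      straight (suc δ) δ<K i i<h c e with straight δ (<⇒≤ δ<K) i i<h c e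
      ... | inj₂ q = inj₂ (≤-trans q (m≤m+n _ _))
      ... | inj₁ b with CB-self i<h b
      ...   | inj₁ b′ = inj₁ b′
      ...   | inj₂ q = inj₂ (≤-trans (≤-trans q (cells-mono (layer-mono δ<K i) d (suc δ + a) c)) (m≤n+m (π δ i c) (Sum δ (λ k → π k i c))))

      ahead-of : ℕ → ℕ → ℤ → ℕ
      ahead-of δ i c = Sum δ (λ k → π k i c)

      survivors : ℕ → ℕ → ℤ → Bool
      survivors δ i = β i free ahead-of δ i

      survivors-burnt : ∀ δ → δ ≤ K → ∀ i → i < h → ∀ c → survivors δ i c ≡ true → CB (δ + τ) d (δ + a) c i
      survivors-burnt δ δ≤K i i<h c = free-burnt (β i) (ahead-of δ i) c (straight δ δ≤K i i<h c)

      survivors-count : ∀ δ i → m i ≤ rng L R (λ c → ⟦ survivors δ i c ⟧) + blk i δ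
      survivors-count δ i = ≤-trans (rng-mono′ L R (free-count (β i) (ahead-of δ i)))
        (≤-reflexive (trans (rng-+ L R _ _) (cong (_+_ _) (sym (rng-Sum δ L R (λ k c → π k i c))))))

      -- The fire of layer `j` is given up for a copy of what survives in layer `i`. Only fighters
      -- of `j` on the last line obstruct the copy, and they are counted among the fighters ahead
      -- anyway; so the fighters of `j` on the earlier lines are pure profit.
      breakthrough : ∀ i j δ → i < h → j < h → suc i ≡ j ⊎ suc j ≡ i → 2 ≤ suc δ → suc δ ≤ D → even (suc δ + a) ≡ true →
        m j + blk i (suc δ) + G ≤ m i + blk j δ → Breakthrough (K + τ) d a L R (Sum h m)
      breakthrough i j δ i<h j<h adj 2≤δ δ≤D ev big = record
        { δ = suc δ ; 2≤δ = 2≤δ ; δ≤D = δ≤D ; β′ = β′ ; burnt′ = burnt′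
        ; profit = ≤-trans (Sum-bump h m _ j G j<h (λ k _ k≢j → other k k≢j) copied)
            (≤-reflexive (trans (Sum-+ h _ _) (cong (_+_ _) (blk-total (suc δ))))) }
        where
        δ≤K : suc δ ≤ K
        δ≤K = ≤-trans δ≤D D≤K
        copy : ℤ → Bool
        copy = survivors (suc δ) i free π δ j
        β′ : ℕ → ℤ → Bool
        β′ x = if x ≡ᵇ j then copy else survivors (suc δ) x
        burnt′ : ∀ x → x < h → ∀ c → β′ x c ≡ true → CB (K + τ) d (suc δ + a) c x
        burnt′ x x<h c e with x ≡ᵇ j in eq
        ... | false = later δ≤K (survivors-burnt (suc δ) δ≤K x x<h c e)
        ... | true = subst (CB (K + τ) d (suc δ + a) c) (sym (≡ᵇ-true x j eq))
          (free-burnt (survivors (suc δ) i) (π δ j) c vertical e)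
          where
          vertical : survivors (suc δ) i c ≡ true → CB (K + τ) d (suc δ + a) c j ⊎ 1 ≤ π δ j c
          vertical s with CB-vert d ev j<h adj (survivors-burnt (suc δ) δ≤K i i<h c s)
          ... | inj₁ b = inj₁ (later (≤-trans (+-monoʳ-≤ 2 δ≤D) 2+D≤K) b)
          ... | inj₂ q = inj₂ (≤-trans q (cells-mono (layer-mono (≤-trans (+-monoʳ-≤ 2 δ≤D) 2+D≤K) j) d (suc δ + a) c))
        other : ∀ k → k ≢ j → m k ≤ rng L R (λ c → ⟦ β′ k c ⟧) + blk k (suc δ)
        other k k≢j rewrite ≡ᵇ-false k j k≢j = survivors-count (suc δ) k
        copied : m j + G ≤ rng L R (λ c → ⟦ β′ j c ⟧) + blk j (suc δ)
        copied rewrite ≡ᵇ-refl j = copy-sum (m j) G (rng L R (λ c → ⟦ copy c ⟧)) (blk j δ) (rng L R (π δ j))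
          (rng L R (λ c → ⟦ survivors (suc δ) i c ⟧)) (m i) (blk i (suc δ))
          (≤-trans (rng-mono′ L R (free-count (survivors (suc δ) i) (π δ j))) (≤-reflexive (rng-+ L R _ _)))
          (survivors-count (suc δ) i) big

      -- The walk j₀ , j₀ - 1 , … , 0 , 1 , … , h - 1 starts at an empty layer. At its k-th layer compare the burning cells with the
      -- fighters in the next 2 k lines: where the difference jumps by G, the fire passes the previous layer and spreads into it.
      walk : ∀ j₀ → j₀ < h → m j₀ ≡ 0 → ∀ n → n < j₀ + h →
        Breakthrough (K + τ) d a L R (Sum h m) ⊎ (∀ k → k ≤ n → m ∣ j₀ - k ∣ ≤ blk ∣ j₀ - k ∣ (k + k + oddness a) + k * G)
      walk j₀ j₀<h e₀ zero _ = inj₂ λ { .zero z≤n → ≤-trans (≤-reflexive (trans (cong m (∣-∣-identityʳ j₀)) e₀)) z≤n }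
      walk j₀ j₀<h e₀ (suc n) n< with walk j₀ j₀<h e₀ n (<⇒≤ n<)
      ... | inj₁ b = inj₁ b
      ... | inj₂ ih with m ∣ j₀ - n ∣ + blk ∣ j₀ - suc n ∣ (suc (n + suc n + oddness a)) + G ≤? m ∣ j₀ - suc n ∣ + blk ∣ j₀ - n ∣ (n + suc n + oddness a)
      ...   | yes big = inj₁ (breakthrough ∣ j₀ - suc n ∣ ∣ j₀ - n ∣ (n + suc n + oddness a)
                (dist-bound j₀ (suc n) h j₀<h n<) (dist-bound j₀ n h j₀<h (<⇒≤ n<))
                ([ inj₂ , inj₁ ]′ (dist-step j₀ n))
                (s≤s (≤-trans (s≤s z≤n) (≤-trans (m≤n+m (suc n) n) (m≤m+n _ _))))
                (reach n (oddness a) (oddness≤1 a) (<-trans n< (+-monoˡ-< h j₀<h)))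
                (trans (cong even (+-assoc (suc n + suc n) (oddness a) a)) (trans (even-double (suc n) (oddness a + a)) (even-oddness a)))
                big)
        where
        oddness≤1 : ∀ a → oddness a ≤ 1
        oddness≤1 a with even a
        ... | true = z≤n
        ... | false = ≤-refl
        reach : ∀ n x → x ≤ 1 → suc n < h + h → suc (n + suc n + x) ≤ D
        reach n x x≤1 lt = ≤-trans (reach-bound h n x x≤1 lt) 4h≤D
      ...   | no ¬big = inj₂ new
        where
        new : ∀ k → k ≤ suc n → m ∣ j₀ - k ∣ ≤ blk ∣ j₀ - k ∣ (k + k + oddness a) + k * G
        new k k≤ with m≤n⇒m<n∨m≡n k≤
        ... | inj₁ lt = ih k (s≤s⁻¹ lt)
        ... | inj₂ refl = walk-step (m ∣ j₀ - suc n ∣) (m ∣ j₀ - n ∣) (blk ∣ j₀ - n ∣ (n + suc n + oddness a))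
              (blk ∣ j₀ - suc n ∣ (suc n + suc n + oddness a)) (blk ∣ j₀ - n ∣ (n + n + oddness a)) G n
              (≰⇒> ¬big) (ih n ≤-refl) (Sum-≤-mono _ (+-monoˡ-≤ (oddness a) (+-monoʳ-≤ n (n≤1+n n))))

    -- Without a breakthrough the excess of burning cells over fighters ahead starts at 0 in the
    -- empty layer and its bound rises by `G` per step of the walk, that is fewer than 2 h times.
    lookahead : (∃ λ j → j < h × m j ≡ 0) →
      Breakthrough (K + τ) d a L R (Sum h m) ⊎ Sum h m ≤ ahead (K + τ) d a L R D + H
    lookahead (j₀ , j₀<h , e₀) with walk j₀ j₀<h e₀ (pred (j₀ + h)) (≤-reflexive (suc-pred (j₀ + h) {{>-nonZero (≤-trans (≤-trans (s≤s z≤n) j₀<h) (m≤n+m h j₀))}}))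
    ... | inj₁ b = inj₁ b
    ... | inj₂ small = inj₂ (≤-trans (Sum-mono h each) (≤-reflexive (trans (Sum-+ h _ _) (cong₂ _+_ (blk-total D) (trans (Sum-const h (2 * h * G)) (sym H-def))))))
      where
      each : ∀ i → i < h → m i ≤ blk i D + 2 * h * G
      each i i<h = ≤-trans (subst (λ z → m z ≤ blk z (k + k + oddness a) + k * G) (∣m-m+n∣≡n j₀ i) (small k k≤))
          (+-mono-≤ (Sum-≤-mono _ within) (*-monoˡ-≤ G (≤-trans (<⇒≤ k<2h) (≤-reflexive (cong (_+_ h) (sym (+-identityʳ h)))))))
        where
        -- The walk is at layer `i` on its way up from layer 0, so every layer is compared, whether
        -- it lies below `j₀` or not.
        k = j₀ + i
        k≤ : k ≤ pred (j₀ + h)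
        k≤ = <⇒≤pred (+-monoʳ-< j₀ i<h)
        k<2h : k < h + h
        k<2h = +-mono-< j₀<h i<h
        within : k + k + oddness a ≤ D
        within = ≤-trans (within-bound h k (oddness a) (par a) k<2h) 4h≤D
          where par : ∀ a → oddness a ≤ 1
                par a with even a
                ... | true = z≤n
                ... | false = ≤-refl

-- The accounts of the four sides

active-mono : ∀ a a′ t t′ c c′ → a ≤ c + t → a′ + t ≤ a + t′ → c ≤ c′ → a′ ≤ c′ + t′
active-mono a a′ t t′ c c′ p0 p1 p2 = farkas 0 (+-mono-≤ p0 (+-mono-≤ p1 p2)) (solve (a ∷ a′ ∷ t ∷ t′ ∷ c ∷ c′ ∷
  []))

waiting-mono : ∀ a a′ t t′ c c′ x f f′ → a + x ≤ c + f + t → a′ + t ≤ a + t′ → c ≤ c′ → f ≤ f′ →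
  a′ + x ≤ c′ + f′ + t′
waiting-mono a a′ t t′ c c′ x f f′ p0 p1 p2 p3 = farkas 0 (+-mono-≤ p0 (+-mono-≤ p1 (+-mono-≤ p2 p3))) (solve (a ∷
  a′ ∷ t ∷ t′ ∷ c ∷ c′ ∷ x ∷ f ∷ f′ ∷ []))

lateral-num : ∀ h L R L′ R′ T y → L′ + R′ ≤ L + R + y → h * (L′ + R′) + T ≤ h * (L + R) + (h * y + T)
lateral-num h L R L′ R′ T y p0 = farkas 0 (scale h p0) (solve (h ∷ L ∷ R ∷ L′ ∷ R′ ∷ T ∷ y ∷ []))

jump-led : ∀ A h s B1 s′ K → A ≤ h * s + B1 → s ≤ s′ + K → A ≤ h * s′ + (B1 + h * K)
jump-led A h s B1 s′ K p0 p1 = farkas 0 (+-mono-≤ p0 (scale h p1)) (solve (A ∷ h ∷ s ∷ B1 ∷ s′ ∷ K ∷ []))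

-- A jump costs at most `K` in position and `Pay` in fighters, and `Pay` contains `C₂` itself. The
-- inequality for `C₂` is solvable only because the fighters weigh `K` and the reserve `1 + K`.
jump-J : ∀ h K l l′ x x′ t t′ b c D C1 C2 → C2 ≡ (1 + K) * (h * K + 2 * (h * D) + C1) →
  (1 + K) * (h * l) ≤ (1 + K) * (h * x + b + c) + K * t → l′ ≤ l → x ≤ x′ + K → t ≤ t′ + (2 * (h * D) + C1 + C2) →
  (1 + K) * (h * l′) ≤ (1 + K) * (h * x′ + (b + C2) + c) + K * t′
jump-J h K l l′ x x′ t t′ b c D C1 C2 p0 p1 p2 p3 p4 = farkas (C1 + 2 * D * h) (+-mono-≤ (≤-reflexive (sym p0))
  (+-mono-≤ p1 (+-mono-≤ (scale ((1 + K) * h) p2) (+-mono-≤ (scale ((1 + K) * h) p3) (scale K p4))))) (solve (h ∷ K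
  ∷ l ∷ l′ ∷ x ∷ x′ ∷ t ∷ t′ ∷ b ∷ c ∷ D ∷ C1 ∷ C2 ∷ []))

jump-pay : ∀ h D δ Pay C1 C2 td td′ tl tr to pr B1 B2 box box′ → Pay ≡ 2 * (h * D) + C1 + C2 →
  td′ + Pay ≤ td + pr → δ ≤ D → td + tl + tr + to + B1 + B2 ≤ box → box + pr ≤ box′ →
  td′ + (h * δ + tl) + (h * δ + tr) + to + (B1 + C1) + (B2 + C2) ≤ box′
jump-pay h D δ Pay C1 C2 td td′ tl tr to pr B1 B2 box box′ p0 p1 p2 p3 p4 = farkas 0 (+-mono-≤ (≤-reflexive (sym
  p0)) (+-mono-≤ p1 (+-mono-≤ (scale (2 * h) p2) (+-mono-≤ p3 p4)))) (solve (h ∷ D ∷ δ ∷ Pay ∷ C1 ∷ C2 ∷ td ∷ td′ ∷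
  tl ∷ tr ∷ to ∷ pr ∷ B1 ∷ B2 ∷ box ∷ box′ ∷ []))

pay-afford : ∀ a c t f pay x → a + pay + x ≤ c + f + t → c ≤ a → pay ≤ t + f
pay-afford a c t f pay x p0 p1 = farkas x (+-mono-≤ p0 p1) (solve (a ∷ c ∷ t ∷ f ∷ pay ∷ x ∷ []))

jump-num : ∀ a c t f pay x t′ → a + pay + x ≤ c + f + t → t′ + pay ≡ t + f → a ≤ c + t′
jump-num a c t f pay x t′ p0 p1 = farkas x (+-mono-≤ p0 (≤-reflexive (sym p1))) (solve (a ∷ c ∷ t ∷ f ∷ pay ∷ x ∷
  t′ ∷ []))

bal-jump : ∀ Q A a b a′ b′ ea eb ea′ eb′ → A ≤ Q * (a + b) + 2 * (ea + eb) → Q * a + 2 * ea ≤ Q * a′ + 2 * ea′ →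
  Q * b + 2 * eb ≤ Q * b′ + 2 * eb′ → A ≤ Q * (a′ + b′) + 2 * (ea′ + eb′)
bal-jump Q A a b a′ b′ ea eb ea′ eb′ p0 p1 p2 = farkas 0 (+-mono-≤ p0 (+-mono-≤ p1 p2)) (solve (Q ∷ A ∷ a ∷ b ∷ a′
  ∷ b′ ∷ ea ∷ eb ∷ ea′ ∷ eb′ ∷ []))

-- This is what `2 ≤ δ` is for: the jump cancels a credit of 2 K and earns at least 2 (1 + K).
bal-each : ∀ K a e δ → e ≡ K → 2 ≤ δ → (1 + K) * a + 2 * e ≤ (1 + K) * (δ + a) + 2 * 0
bal-each K a e δ p0 p1 = farkas 2 (+-mono-≤ (scale 2 (≤-reflexive p0)) (scale (1 + K) p1)) (solve (K ∷ a ∷ e ∷ δ ∷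
  []))

hold-sum : ∀ t t′ p f F F′ → t + f ≤ t′ + p → F ≤ f + F′ → t + F ≤ t′ + F′ + p
hold-sum t t′ p f F F′ p0 p1 = farkas 0 (+-mono-≤ p0 p1) (solve (t ∷ t′ ∷ p ∷ f ∷ F ∷ F′ ∷ []))

==-refl : ∀ d → (d == d) ≡ true
==-refl N = refl
==-refl E = refl
==-refl S = refl
==-refl W = refl

same? : ∀ d x → d ≡ x ⊎ (d == x) ≡ false
same? N N = inj₁ refl
same? N E = inj₂ refl
same? N S = inj₂ refl
same? N W = inj₂ refl
same? E N = inj₂ refl
same? E E = inj₁ refl
same? E S = inj₂ refl
same? E W = inj₂ refl
same? S N = inj₂ refl
same? S E = inj₂ refl
same? S S = inj₁ refl
same? S W = inj₂ refl
same? W N = inj₂ refl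
same? W E = inj₂ refl
same? W S = inj₂ refl
same? W W = inj₁ refl

ΣD-mono : ∀ {f g} → (∀ d → f d ≤ g d) → ΣD f ≤ ΣD g
ΣD-mono le = +-mono-≤ (+-mono-≤ (+-mono-≤ (le N) (le E)) (le S)) (le W)

ΣD-cong : ∀ {f g} → (∀ d → f d ≡ g d) → ΣD f ≡ ΣD g
ΣD-cong e = cong₂ _+_ (cong₂ _+_ (cong₂ _+_ (e N) (e E)) (e S)) (e W)

beside : Dir → Dir → Bool
beside d x = (lf d == x) ∨ (rt d == x)

beside-≥ : ∀ d x k → (d == x) ≡ false → on (d == lf x) k + on (d == rt x) k ≤ on (beside d x) k
beside-≥ N N k ()
beside-≥ N E k _ = ≤-refl
beside-≥ N S k _ = ≤-refl
beside-≥ N W k _ = ≤-refl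
beside-≥ E N k _ = ≤-refl
beside-≥ E E k ()
beside-≥ E S k _ = ≤-refl
beside-≥ E W k _ = ≤-refl
beside-≥ S N k _ = ≤-refl
beside-≥ S E k _ = ≤-reflexive (+-identityʳ k)
beside-≥ S S k ()
beside-≥ S W k _ = ≤-reflexive (+-identityʳ k)
beside-≥ W N k _ = ≤-reflexive (+-identityʳ k)
beside-≥ W E k _ = ≤-refl
beside-≥ W S k _ = ≤-reflexive (+-identityʳ k)
beside-≥ W W k ()

axis-≤ : ∀ d x k → on (d == x) k + on (d == op x) k ≤ k
axis-≤ N N k = ≤-reflexive (+-identityʳ k)
axis-≤ N E k = z≤n
axis-≤ N S k = ≤-refl
axis-≤ N W k = z≤n
axis-≤ E N k = z≤n
axis-≤ E E k = ≤-reflexive (+-identityʳ k)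
axis-≤ E S k = z≤n
axis-≤ E W k = ≤-refl
axis-≤ S N k = ≤-refl
axis-≤ S E k = z≤n
axis-≤ S S k = ≤-reflexive (+-identityʳ k)
axis-≤ S W k = z≤n
axis-≤ W N k = z≤n
axis-≤ W E k = ≤-refl
axis-≤ W S k = z≤n
axis-≤ W W k = ≤-reflexive (+-identityʳ k)

Sum-split : ∀ m n f → Sum (m + n) f ≡ Sum m f + Sum n (λ k → f (m + k))
Sum-split m zero f = trans (cong (λ z → Sum z f) (+-identityʳ m)) (sym (+-identityʳ _))
Sum-split m (suc n) f = trans (cong (λ z → Sum z f) (+-suc m n))
  (trans (cong (_+ f (m + n)) (Sum-split m n f)) (+-assoc (Sum m f) _ _))

ΣD-on : ∀ d k → ΣD (λ x → on (d == x) k) ≡ k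
ΣD-on N k = trans (+-identityʳ _) (trans (+-identityʳ _) (+-identityʳ _))
ΣD-on E k = trans (+-identityʳ _) (+-identityʳ _)
ΣD-on S k = +-identityʳ k
ΣD-on W k = refl

ΣD-+ : ∀ f g → ΣD (λ x → f x + g x) ≡ ΣD f + ΣD g
ΣD-+ f g = regroup (f N) (g N) (f E) (g E) (f S) (g S) (f W) (g W)
  where
  regroup : ∀ a a′ b b′ c c′ d d′ → a + a′ + (b + b′) + (c + c′) + (d + d′) ≡ a + b + c + d + (a′ + b′ + c′ + d′)
  regroup a a′ b b′ c c′ d d′ = solve (a ∷ a′ ∷ b ∷ b′ ∷ c ∷ c′ ∷ d ∷ d′ ∷ [])

module Chase (h : ℕ) (M : Model h (Constants.R₀ h)) where
  open Constants h
  open Ahead h M public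
  open Burning M public

  count : (Dir → ℕ) → (ℕ → ℤ → Bool) → Dir → ℕ
  count pos β d = Sum h (λ i → span pos d (λ c → ⟦ β i c ⟧))

  aheadOf : ℕ → (Dir → ℕ) → Dir → ℕ → ℕ
  aheadOf τ pos d δ = ahead τ d (pos d) (pos (lf d)) (pos (rt d)) δ

  width : (Dir → ℕ) → Dir → ℕ
  width pos d = pos (lf d) + pos (rt d)

  count-≤ : ∀ pos β d → count pos β d ≤ h * width pos d
  count-≤ pos β d = ≤-trans (Sum-mono h λ i _ → ≤-trans (rng-mono′ _ _ λ c → bit (β i c))
      (≤-reflexive (trans (rng-const _ _ 1) (*-identityʳ _)))) (≤-reflexive (Sum-const h _))
    where bit : ∀ b → ⟦ b ⟧ ≤ 1
          bit true = ≤-refl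
          bit false = z≤n

  count-mono : ∀ {pos pos′} β d → (∀ x → pos x ≤ pos′ x) → count pos β d ≤ count pos′ β d
  count-mono β d le = Sum-mono h λ i _ → rng-≤-mono _ (le (lf d)) (le (rt d))

  ahead-mono : ∀ {L R L′ R′} τ d a δ → L ≤ L′ → R ≤ R′ → ahead τ d a L R δ ≤ ahead τ d a L′ R′ δ
  ahead-mono τ d a δ le le′ = Sum-mono δ λ k _ → rng-≤-mono _ le le′

  ahead-later : ∀ τ d a L R δ → ahead τ d a L R δ ≤ ahead (K + τ) d a L R δ
  ahead-later τ d a L R δ = Sum-mono δ λ k _ → rng-mono′ L R (cells-mono (P-mono+ K τ) d (suc k + a))

  record Active (τ : ℕ) (pos : Dir → ℕ) (T : ℕ) (d : Dir) : Set where
    field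
      β : ℕ → ℤ → Bool
      burnt : ∀ i → i < h → ∀ c → β i c ≡ true → CB τ d (pos d) c i
      num : h * width pos d ≤ count pos β d + T

  -- A side that rests for r more steps, after which it is known to reach β′, δ lines further on, with a profit.
  record Waiting (τ : ℕ) (pos : Dir → ℕ) (T e : ℕ) (d : Dir) : Set where
    field
      r δ end : ℕ
      r+τ : r + τ ≡ end
      r+e : r + e ≡ K
      2≤δ : 2 ≤ δ
      δ≤D : δ ≤ D
      β′ : ℕ → ℤ → Bool
      burnt′ : ∀ i → i < h → ∀ c → β′ i c ≡ true → CB end d (δ + pos d) c i
      num : h * width pos d + (Pay + 2 * (h * r)) ≤ count pos β′ d + aheadOf end pos d δ + T
      seen : ∃ λ i → ∃ λ c → CB τ d (pos d) c i

  Front : ℕ → (Dir → ℕ) → ℕ → ℕ → Dir → Set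
  Front τ pos T e d = (e ≡ 0 × Active τ pos T d) ⊎ Waiting τ pos T e d

  front-mono : ∀ {τ pos pos′ T T′ e} d → (∀ x → pos x ≤ pos′ x) → pos′ d ≡ pos d →
    h * width pos′ d + T ≤ h * width pos d + T′ → Front τ pos T e d → Front τ pos′ T′ e d
  front-mono {τ} {pos} {pos′} {T} {T′} d le same le′ (inj₁ (e₀ , f)) = inj₁ (e₀ , record
    { β = β
    ; burnt = λ i i<h c e → subst (λ z → CB τ d z c i) (sym same) (burnt i i<h c e)
    ; num = active-mono _ _ T T′ _ _ num le′ (count-mono β d le) })
    where open Active f
  front-mono {τ} {pos} {pos′} {T} {T′} d le same le′ (inj₂ w) = inj₂ record
    { Waiting w hiding (burnt′; num; seen)
    ; burnt′ = λ i i<h c e → subst (λ z → CB end d (δ + z) c i) (sym same) (burnt′ i i<h c e)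
    ; num = waiting-mono _ _ T T′ _ _ _ _ _ num le′ (count-mono β′ d le)
        (≤-trans (ahead-mono end d (pos d) δ (le (lf d)) (le (rt d)))
          (≤-reflexive (cong (λ z → ahead end d z (pos′ (lf d)) (pos′ (rt d)) δ) (sym same))))
    ; seen = subst (λ z → ∃ λ i → ∃ λ c → CB τ d z c i) (sym same) seen }
    where open Waiting w

  -- When a side X is walled off, it remembers a wall as long as itself. This memory, which only shrinks as its fighters are
  -- handed over to an adjacent side, is what forbids both sides next to X to be walled off at once later on.
  potential : ℕ → (pos T el : Dir → ℕ) → ℕ → Dir → Set
  potential τ pos T el B₂ X =
    (1 + K) * (h * (v (lf X) + v (rt X))) ≤ (1 + K) * (h * (v X + v (op X)) + B₂ + κ) + K * (T X + aheadOf (K + τ) pos X D)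
    where v = λ d → pos d + el d

  -- T d is the number of half fighters credited to side d, el d the time for which d has been waiting, and B₁, B₂ are reserves
  -- that make up for delays. Fighters are counted K steps ahead of the fire.
  record State (τ : ℕ) : Set where
    field
      pos T el : Dir → ℕ
      B₁ B₂ : ℕ
      pos-pos : ∀ d → 1 ≤ pos d
      fronts : ∀ d → Front τ pos (T d) (el d) d
      fighters : ΣD T + B₁ + B₂ ≤ Area.box (P (K + τ)) pos + Area.box (P (K + τ)) pos
      progress : 3 * h * τ + 4 * h * R₀ ≤ h * ΣD (λ d → pos d + el d) + B₁
      axis : ∀ X → potential τ pos T el B₂ X ⊎ potential τ pos T el B₂ (op X)
      reach : ∀ d → pos d + el d ≤ τ + R₀
      extent : ∀ X → 2 * τ + 2 * R₀ ≤ (1 + K) * (pos X + pos (op X)) + 2 * (el X + el (op X))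

  module Jump {τ : ℕ} (st : State τ) (d : Dir) (w : Waiting τ (State.pos st) (State.T st d) (State.el st d) d)
    (now : Waiting.r w ≡ 0) where
    open State st
    open Waiting w

    pos′ el′ T′ : Dir → ℕ
    pos′ = adv d δ pos
    el′ x = off (d == x) (el x)
    -- The jumping side is credited with the fighters on the `δ` lines it passes and pays `Pay`:
    -- `h * δ` to each adjacent side, which becomes longer by `δ`, and `C₁` and `C₂` to the
    -- reserves.
    T′ x = if d == x then (T d + aheadOf (K + τ) pos d δ) ∸ Pay else (on (beside d x) (h * δ) + T x)

    end≡τ : end ≡ τ
    end≡τ = trans (sym r+τ) (cong (_+ τ) now)

    el≡K : el d ≡ K
    el≡K = trans (cong (_+ el d) (sym now)) r+e

    le : ∀ x → pos x ≤ pos′ x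
    le = adv-≥ d δ pos

    numτ : h * width pos d + Pay + 2 * (h * r) ≤ count pos β′ d + aheadOf (K + τ) pos d δ + T d
    numτ = ≤-trans (≤-reflexive (+-assoc (h * width pos d) Pay _))
      (≤-trans num (+-monoˡ-≤ (T d) (+-monoʳ-≤ (count pos β′ d)
        (≤-trans (≤-reflexive (cong (λ z → aheadOf z pos d δ) end≡τ)) (ahead-later τ d (pos d) (pos (lf d)) (pos (rt d)) δ)))))

    -- Makes the truncated subtraction in `T′` exact: covered cells alone cannot exceed the full
    -- line, so the profit must be backed by fighters.
    afford : Pay ≤ T d + aheadOf (K + τ) pos d δ
    afford = pay-afford _ _ (T d) (aheadOf (K + τ) pos d δ) Pay _ numτ (count-≤ pos β′ d)

    T′d : T′ d ≡ (T d + aheadOf (K + τ) pos d δ) ∸ Pay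
    T′d rewrite ==-refl d = refl

    paid : T′ d + Pay ≡ T d + aheadOf (K + τ) pos d δ
    paid = trans (cong (_+ Pay) T′d) (m∸n+n≡m afford)

    pos′d : pos′ d ≡ δ + pos d
    pos′d rewrite ==-refl d = refl

    el′d : el′ d ≡ 0
    el′d rewrite ==-refl d = refl

    width-d : ∀ d → width (adv d δ pos) d ≡ width pos d
    width-d N = refl
    width-d E = refl
    width-d S = refl
    width-d W = refl

    count-d : ∀ d β → count (adv d δ pos) β d ≡ count pos β d
    count-d N β = refl
    count-d E β = refl
    count-d S β = refl
    count-d W β = refl

    front-d : Front τ pos′ (T′ d) (el′ d) d
    front-d = inj₁ (el′d , record
      { β = β′
      ; burnt = λ i i<h c e → subst₂ (λ y z → CB y d z c i) end≡τ (sym pos′d) (burnt′ i i<h c e)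
      ; num = subst₂ (λ y z → h * y ≤ z + T′ d) (sym (width-d d)) (sym (count-d d β′))
          (jump-num (h * width pos d) (count pos β′ d) (T d) (aheadOf (K + τ) pos d δ) Pay _ (T′ d) numτ paid) })

    front-other : ∀ x → (d == x) ≡ false → Front τ pos′ (T′ x) (el′ x) x
    front-other x e = subst₂ (λ y z → Front τ pos′ y z x) (sym T′x) (sym el′x)
      (front-mono x le (cong (λ b → on b δ + pos x) e) (wide (beside d x) (beside-≥ d x δ e)) (fronts x))
      where
      T′x : T′ x ≡ on (beside d x) (h * δ) + T x
      T′x rewrite e = refl
      el′x : el′ x ≡ el x
      el′x rewrite e = refl
      wide : ∀ b → on (d == lf x) δ + on (d == rt x) δ ≤ on b δ →
        h * width pos′ x + T x ≤ h * width pos x + (on b (h * δ) + T x)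
      wide b le″ = ≤-trans (lateral-num h (pos (lf x)) (pos (rt x)) (pos′ (lf x)) (pos′ (rt x)) (T x) (on b δ)
          (≤-trans (≤-reflexive (shuffle (on (d == lf x) δ) (pos (lf x)) (on (d == rt x) δ) (pos (rt x))))
            (+-monoʳ-≤ (pos (lf x) + pos (rt x)) le″)))
          (≤-reflexive (cong (λ z → h * width pos x + (z + T x)) (scale-on b)))
        where
        shuffle : ∀ a b c d → a + b + (c + d) ≡ b + d + (a + c)
        shuffle a b c d = solve (a ∷ b ∷ c ∷ d ∷ [])
        scale-on : ∀ b → h * on b δ ≡ on b (h * δ)
        scale-on true = refl
        scale-on false = *-zeroʳ h

    fronts′ : ∀ x → Front τ pos′ (T′ x) (el′ x) x
    fronts′ x with same? d x
    ... | inj₁ refl = front-d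
    ... | inj₂ e = front-other x e

    fighters′ : ΣD T′ + (B₁ + h * K) + (B₂ + C₂) ≤ Area.box (P (K + τ)) pos′ + Area.box (P (K + τ)) pos′
    fighters′ = ≤-trans (≤-reflexive (cong (λ z → ΣD T′ + (B₁ + z) + (B₂ + C₂)) (sym C₁-def)))
      (all d refl paid (AreaMore.box-strip (P (K + τ)) d δ pos))
      where
      all : ∀ x → d ≡ x → T′ x + Pay ≡ T x + aheadOf (K + τ) pos x δ →
        Area.box (P (K + τ)) pos + Area.box (P (K + τ)) pos + AreaMore.strip (P (K + τ)) pos δ x ≤ Area.box (P (K + τ)) (adv x δ pos) + Area.box (P (K + τ)) (adv x δ pos) →
        ΣD T′ + (B₁ + C₁) + (B₂ + C₂) ≤ Area.box (P (K + τ)) (adv d δ pos) + Area.box (P (K + τ)) (adv d δ pos)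
      all N refl pd bs = ≤-trans (≤-reflexive (o (T′ N) (T′ E) (T′ S) (T′ W) (B₁ + C₁) (B₂ + C₂)))
        (jump-pay h D δ Pay C₁ C₂ (T N) _ (T E) (T W) (T S) (aheadOf (K + τ) pos N δ) B₁ B₂ _ _ Pay-def (≤-reflexive pd) δ≤D
          (≤-trans (≤-reflexive (sym (o (T N) (T E) (T S) (T W) B₁ B₂))) fighters) bs)
        where o : ∀ n e s w a b → n + e + s + w + a + b ≡ n + e + w + s + a + b
              o n e s w a b = solve (n ∷ e ∷ s ∷ w ∷ a ∷ b ∷ [])
      all E refl pd bs = ≤-trans (≤-reflexive (o (T′ N) (T′ E) (T′ S) (T′ W) (B₁ + C₁) (B₂ + C₂)))
        (jump-pay h D δ Pay C₁ C₂ (T E) _ (T S) (T N) (T W) (aheadOf (K + τ) pos E δ) B₁ B₂ _ _ Pay-def (≤-reflexive pd) δ≤D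
          (≤-trans (≤-reflexive (sym (o (T N) (T E) (T S) (T W) B₁ B₂))) fighters) bs)
        where o : ∀ n e s w a b → n + e + s + w + a + b ≡ e + s + n + w + a + b
              o n e s w a b = solve (n ∷ e ∷ s ∷ w ∷ a ∷ b ∷ [])
      all S refl pd bs = ≤-trans (≤-reflexive (o (T′ N) (T′ E) (T′ S) (T′ W) (B₁ + C₁) (B₂ + C₂)))
        (jump-pay h D δ Pay C₁ C₂ (T S) _ (T E) (T W) (T N) (aheadOf (K + τ) pos S δ) B₁ B₂ _ _ Pay-def (≤-reflexive pd) δ≤D
          (≤-trans (≤-reflexive (sym (o (T N) (T E) (T S) (T W) B₁ B₂))) fighters) bs)
        where o : ∀ n e s w a b → n + e + s + w + a + b ≡ s + e + w + n + a + b
              o n e s w a b = solve (n ∷ e ∷ s ∷ w ∷ a ∷ b ∷ [])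
      all W refl pd bs = ≤-trans (≤-reflexive (o (T′ N) (T′ E) (T′ S) (T′ W) (B₁ + C₁) (B₂ + C₂)))
        (jump-pay h D δ Pay C₁ C₂ (T W) _ (T N) (T S) (T E) (aheadOf (K + τ) pos W δ) B₁ B₂ _ _ Pay-def (≤-reflexive pd) δ≤D
          (≤-trans (≤-reflexive (sym (o (T N) (T E) (T S) (T W) B₁ B₂))) fighters) bs)
        where o : ∀ n e s w a b → n + e + s + w + a + b ≡ w + n + s + e + a + b
              o n e s w a b = solve (n ∷ e ∷ s ∷ w ∷ a ∷ b ∷ [])

    v v′ : Dir → ℕ
    v x = pos x + el x
    v′ x = pos′ x + el′ x

    -- A waiting side is credited with one line per step; the jump replaces these `K` lines by the
    -- `δ` actually gained.
    v-loss : ∀ x → v x ≤ v′ x + on (d == x) K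
    v-loss x with same? d x
    ... | inj₁ refl rewrite ==-refl d = ≤-trans (+-monoʳ-≤ (pos d) (≤-reflexive el≡K))
          (+-monoˡ-≤ K (≤-trans (m≤n+m (pos d) δ) (m≤m+n _ 0)))
    ... | inj₂ e rewrite e = m≤m+n _ 0

    v′≤v : ∀ x → v′ x ≤ v x
    v′≤v x with same? d x
    ... | inj₁ refl rewrite ==-refl d = ≤-trans (≤-reflexive (trans (+-identityʳ _) (+-comm δ (pos d))))
          (+-monoʳ-≤ (pos d) (≤-trans (≤-trans δ≤D D≤K) (≤-reflexive (sym el≡K))))
    ... | inj₂ e rewrite e = ≤-refl

    progress′ : 3 * h * τ + 4 * h * R₀ ≤ h * ΣD v′ + (B₁ + h * K)
    progress′ = jump-led _ h (ΣD v) B₁ (ΣD v′) K progress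
      (≤-trans (ΣD-mono v-loss) (≤-reflexive (trans (ΣD-+ v′ (λ x → on (d == x) K)) (cong (_+_ (ΣD v′)) (ΣD-on d K)))))

    -- For the jumping side the fighters on the lines passed move from the lines ahead into its
    -- account, so only the price is missing.
    hold : ∀ X → T X + aheadOf (K + τ) pos X D ≤ T′ X + aheadOf (K + τ) pos′ X D + Pay
    hold X with same? d X
    ... | inj₁ refl = hold-sum (T d) (T′ d) Pay (aheadOf (K + τ) pos d δ) (aheadOf (K + τ) pos d D) _ (≤-reflexive (sym paid))
          (≤-trans (Sum-≤-mono f (m≤n+m D δ)) (≤-reflexive (trans (Sum-split δ D f) (cong (_+_ (Sum δ f)) (shifted d)))))
      where
      f : ℕ → ℕ
      f k = span pos d (cells (line (P (K + τ)) d (suc k + pos d)))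
      g : Dir → (Dir → ℕ) → ℕ → ℕ
      g d pos′ a = span pos′ d (cells (line (P (K + τ)) d a))
      index : ∀ k → suc (δ + k + pos d) ≡ suc (k + (δ + pos d))
      index k = cong suc (trans (cong (_+ pos d) (+-comm δ k)) (+-assoc k δ (pos d)))
      spans : ∀ d a → g d pos a ≡ g d (adv d δ pos) a
      spans N a = refl
      spans E a = refl
      spans S a = refl
      spans W a = refl
      shifted : ∀ x → Sum D (λ k → f (δ + k)) ≡ aheadOf (K + τ) pos′ d D
      shifted x = Sum-cong D λ k → trans (cong (g d pos) (trans (index k) (cong (λ z → suc k + z) (sym pos′d)))) (spans d _)
    ... | inj₂ e = ≤-trans (+-mono-≤ T≤ (≤-trans (ahead-mono (K + τ) X (pos X) D (le (lf X)) (le (rt X)))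
          (≤-reflexive (cong (λ z → ahead (K + τ) X z (pos′ (lf X)) (pos′ (rt X)) D) (cong (λ b → on b δ + pos X) (sym e))))))
          (m≤m+n _ Pay)
      where T≤ : T X ≤ T′ X
            T≤ rewrite e = m≤n+m (T X) (on (beside d X) (h * δ))

    potential′ : ∀ X → potential τ pos T el B₂ X → potential τ pos′ T′ el′ (B₂ + C₂) X
    potential′ X pt = jump-J h K _ (v′ (lf X) + v′ (rt X)) (v X + v (op X)) (v′ X + v′ (op X))
      (T X + aheadOf (K + τ) pos X D) _ B₂ κ D C₁ C₂ C₂-def pt
      (+-mono-≤ (v′≤v (lf X)) (v′≤v (rt X)))
      (≤-trans (+-mono-≤ (v-loss X) (v-loss (op X))) (≤-trans (≤-reflexive (interchange (v′ X) _ _ _)) (+-monoʳ-≤ _ (axis-≤ d X K))))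
      (≤-trans (hold X) (≤-reflexive (cong (_+_ (T′ X + aheadOf (K + τ) pos′ X D)) Pay-def)))

    extent′ : ∀ X → 2 * τ + 2 * R₀ ≤ (1 + K) * (pos′ X + pos′ (op X)) + 2 * (el′ X + el′ (op X))
    extent′ X = bal-jump (1 + K) _ (pos X) (pos (op X)) (pos′ X) (pos′ (op X)) (el X) (el (op X)) (el′ X) (el′ (op X))
        (extent X) (each X) (each (op X))
      where
      each : ∀ x → (1 + K) * pos x + 2 * el x ≤ (1 + K) * pos′ x + 2 * el′ x
      each x with same? d x
      ... | inj₁ refl rewrite ==-refl d = bal-each K (pos d) (el d) δ el≡K 2≤δ
      ... | inj₂ e rewrite e = ≤-refl

    state : State τ
    state = record
      { pos = pos′ ; T = T′ ; el = el′ ; B₁ = B₁ + h * K ; B₂ = B₂ + C₂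
      ; pos-pos = λ x → ≤-trans (pos-pos x) (le x)
      ; fronts = fronts′ ; fighters = fighters′ ; progress = progress′
      ; axis = λ X → [ (λ p → inj₁ (potential′ X p)) , (λ p → inj₂ (potential′ (op X) p)) ]′ (axis X)
      ; reach = λ x → ≤-trans (v′≤v x) (reach x)
      ; extent = extent′ }

-- Two sides cannot be dead together

wait-start : ∀ a t c m g f pay x → a ≤ m + t → g ≡ pay + x → m + g ≤ c + f → a + (pay + x) ≤ c + f + t
wait-start a t c m g f pay x p0 p1 p2 = farkas 0 (+-mono-≤ p0 (+-mono-≤ (≤-reflexive (sym p1)) p2)) (solve (a ∷ t ∷
  c ∷ m ∷ g ∷ f ∷ pay ∷ x ∷ []))

dead-hold : ∀ a c t A H → a ≤ c + t → c ≤ A + H → a ≤ t + A + H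
dead-hold a c t A H p0 p1 = farkas 0 (+-mono-≤ p0 p1) (solve (a ∷ c ∷ t ∷ A ∷ H ∷ []))

-- Adjacent widths add up to all four distances, hence to 3 τ plus the head start 4 R₀, up to waits
-- and the reserve `B₁`, which consists of fighters too. Two dead sides face that many half fighters
-- per layer, while the supply is 3 h (K + τ): the terms in τ cancel and `R₀` decides.
clash-beside : ∀ h K H κ R τ pd px po px′ ed ex eo ex′ td tx to tx′ Ad Ax Ao Ax′ B1 B2 → 1 ≤ h →
  R ≡ 2 * (9 * K + κ + 2 * H + 1) →
  3 * h * τ + 4 * h * R ≤ h * (pd + ed + (px + ex) + (po + eo) + (px′ + ex′)) + B1 → ed ≤ K → ex ≤ K → eo ≤ K →
  ex′ ≤ K → h * (px + px′) ≤ td + Ad + H → h * (pd + po) ≤ tx + Ax + H →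
  td + tx + to + tx′ + B1 + B2 + (Ad + Ax + Ao + Ax′) ≤ 3 * h * (K + τ) → 1 ≤ 0
clash-beside h K H κ R τ pd px po px′ ed ex eo ex′ td tx to tx′ Ad Ax Ao Ax′ B1 B2 p0 p1 p2 p3 p4 p5 p6 p7 p8 p9 =
  farkas (Ao + Ax′ + B2 + 14 * H * h + 65 * K * h + 7 * h + 8 * h * κ + to + tx′) (+-mono-≤ (scale (2 * H + 1) p0)
  (+-mono-≤ (scale (4 * h) (≤-reflexive (sym p1))) (+-mono-≤ p2 (+-mono-≤ (scale h p3) (+-mono-≤ (scale h p4)
  (+-mono-≤ (scale h p5) (+-mono-≤ (scale h p6) (+-mono-≤ p7 (+-mono-≤ p8 p9))))))))) (solve (h ∷ K ∷ H ∷ κ ∷ R ∷ τ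
  ∷ pd ∷ px ∷ po ∷ px′ ∷ ed ∷ ex ∷ eo ∷ ex′ ∷ td ∷ tx ∷ to ∷ tx′ ∷ Ad ∷ Ax ∷ Ao ∷ Ax′ ∷ B1 ∷ B2 ∷ []))

-- Opposite sides have the same width, so two dead ones only account for twice the lateral distance
-- `px + px′`. The potential of the side `x` between them bounds the distance between the dead sides
-- by the lateral one plus the fighters of `x`, a third group of fighters in the same budget.
clash-opposite : ∀ h K H κ R τ pd px po px′ ed ex eo ex′ td tx to tx′ Ad Ax Ao Ax′ B1 B2 → 1 ≤ h →
  R ≡ 2 * (9 * K + κ + 2 * H + 1) →
  3 * h * τ + 4 * h * R ≤ h * (pd + ed + (px + ex) + (po + eo) + (px′ + ex′)) + B1 → ex ≤ K → ex′ ≤ K →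
  h * (px + px′) ≤ td + Ad + H → h * (px + px′) ≤ to + Ao + H →
  td + tx + to + tx′ + B1 + B2 + (Ad + Ax + Ao + Ax′) ≤ 3 * h * (K + τ) →
  h * (pd + ed + (po + eo)) ≤ h * (px + ex + (px′ + ex′)) + B2 + κ + (tx + Ax) → 1 ≤ 0
clash-opposite h K H κ R τ pd px po px′ ed ex eo ex′ td tx to tx′ Ad Ax Ao Ax′ B1 B2 p0 p1 p2 p3 p4 p5 p6 p7 p8 =
  farkas (Ax′ + 14 * H * h + 65 * K * h + 7 * h + 7 * h * κ + tx′) (+-mono-≤ (scale (2 * H + κ + 1) p0) (+-mono-≤
  (scale (4 * h) (≤-reflexive (sym p1))) (+-mono-≤ p2 (+-mono-≤ (scale (2 * h) p3) (+-mono-≤ (scale (2 * h) p4)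
  (+-mono-≤ p5 (+-mono-≤ p6 (+-mono-≤ p7 p8)))))))) (solve (h ∷ K ∷ H ∷ κ ∷ R ∷ τ ∷ pd ∷ px ∷ po ∷ px′ ∷ ed ∷ ex ∷
  eo ∷ ex′ ∷ td ∷ tx ∷ to ∷ tx′ ∷ Ad ∷ Ax ∷ Ao ∷ Ax′ ∷ B1 ∷ B2 ∷ []))

cancel-K : ∀ K a b t → (1 + K) * a ≤ (1 + K) * b + K * t → (1 + K) * a ≤ (1 + K) * (b + t)
cancel-K K a b t p0 = farkas t p0 (solve (K ∷ a ∷ b ∷ t ∷ []))

moving-num : ∀ h w bl br sl sr c c′ f t gl gr → h * w ≤ c + t → bl * h + sl ≤ gl → br * h + sr ≤ gr →
  c + gl + gr ≤ c′ + f → h * (w + bl + br) + (sr + sl) ≤ c′ + (t + f)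
moving-num h w bl br sl sr c c′ f t gl gr p0 p1 p2 p3 = farkas 0 (+-mono-≤ p0 (+-mono-≤ p1 (+-mono-≤ p2 p3)))
  (solve (h ∷ w ∷ bl ∷ br ∷ sl ∷ sr ∷ c ∷ c′ ∷ f ∷ t ∷ gl ∷ gr ∷ []))

moving-end : ∀ a c t f x y s t′ → a + s ≤ c + (t + f) → t′ + s ≡ t + f + x + y → a ≤ c + t′
moving-end a c t f x y s t′ p0 p1 = farkas (x + y) (+-mono-≤ p0 (≤-reflexive (sym p1))) (solve (a ∷ c ∷ t ∷ f ∷ x ∷
  y ∷ s ∷ t′ ∷ []))

afford-moving : ∀ a c t f s x y → a + s ≤ c + (t + f) → c ≤ a → s ≤ t + f + x + y
afford-moving a c t f s x y p0 p1 = farkas (x + y) (+-mono-≤ p0 p1) (solve (a ∷ c ∷ t ∷ f ∷ s ∷ x ∷ y ∷ []))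

-- The provision of 2 h for the step just spent pays for the growth of the line, at most one cell
-- per layer at each end.
waiting-num : ∀ h w w′ c c′ f f′ t t′ pay r → h * w + (pay + 2 * (h * (1 + r))) ≤ c + f + t → w′ ≤ w + 2 → c ≤ c′ →
  f ≤ f′ → t ≤ t′ → h * w′ + (pay + 2 * (h * r)) ≤ c′ + f′ + t′
waiting-num h w w′ c c′ f f′ t t′ pay r p0 p1 p2 p3 p4 = farkas 0 (+-mono-≤ p0 (+-mono-≤ (scale h p1) (+-mono-≤ p2
  (+-mono-≤ p3 p4)))) (solve (h ∷ w ∷ w′ ∷ c ∷ c′ ∷ f ∷ f′ ∷ t ∷ t′ ∷ pay ∷ r ∷ []))

progress-step : ∀ h τ R s s′ B → 3 * h * τ + 4 * h * R ≤ h * s + B → s + 3 ≤ s′ →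
  3 * h * (1 + τ) + 4 * h * R ≤ h * s′ + B
progress-step h τ R s s′ B p0 p1 = farkas 0 (+-mono-≤ p0 (scale h p1)) (solve (h ∷ τ ∷ R ∷ s ∷ s′ ∷ B ∷ []))

extent-step : ∀ Q τ R a b ea eb a′ b′ ea′ eb′ x y → 2 * τ + 2 * R ≤ Q * (a + b) + 2 * (ea + eb) →
  Q * a + 2 * ea + x ≤ Q * a′ + 2 * ea′ → Q * b + 2 * eb + y ≤ Q * b′ + 2 * eb′ → 2 ≤ x + y →
  2 * (1 + τ) + 2 * R ≤ Q * (a′ + b′) + 2 * (ea′ + eb′)
extent-step Q τ R a b ea eb a′ b′ ea′ eb′ x y p0 p1 p2 p3 = farkas 0 (+-mono-≤ p0 (+-mono-≤ p1 (+-mono-≤ p2 p3)))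
  (solve (Q ∷ τ ∷ R ∷ a ∷ b ∷ ea ∷ eb ∷ a′ ∷ b′ ∷ ea′ ∷ eb′ ∷ x ∷ y ∷ []))

-- The axis grows by 2, as much as the lateral distances can. A dead lateral side draws up to `h`
-- fighters from the account, but it stands still itself, which counts with the larger weight.
axis-step : ∀ h K l l′ x x′ t t′ b c z → (1 + K) * (h * l) ≤ (1 + K) * (h * x + b + c) + K * t → l′ + z ≤ l + 2 →
  x + 2 ≤ x′ → t ≤ t′ + h * z → (1 + K) * (h * l′) ≤ (1 + K) * (h * x′ + b + c) + K * t′
axis-step h K l l′ x x′ t t′ b c z p0 p1 p2 p3 = farkas (h * z) (+-mono-≤ p0 (+-mono-≤ (scale ((1 + K) * h) p1)
  (+-mono-≤ (scale ((1 + K) * h) p2) (scale K p3)))) (solve (h ∷ K ∷ l ∷ l′ ∷ x ∷ x′ ∷ t ∷ t′ ∷ b ∷ c ∷ z ∷ []))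

-- The fighters facing the dead side cover its width with weight `K`. The remaining share has weight
-- 1 and is at most 2 τ + 2 R₀, which the axis provides with its factor `1 + K`.
axis-refresh : ∀ h K H κ R τ w l′ px px′ ex ex′ x′ t′ B2 → κ ≡ h * (2 * K + 2) + H + 4 * (h * K) → h * w ≤ t′ + H →
  l′ ≤ w + 2 * K + 2 → w ≤ 2 * τ + 2 * R → 2 * τ + 2 * R ≤ (1 + K) * (px + px′) + 2 * (ex + ex′) → ex ≤ K →
  ex′ ≤ K → px + px′ ≤ x′ → (1 + K) * (h * l′) ≤ (1 + K) * (h * x′ + B2 + κ) + K * t′
axis-refresh h K H κ R τ w l′ px px′ ex ex′ x′ t′ B2 p0 p1 p2 p3 p4 p5 p6 p7 = farkas (B2 + B2 * K + H + 4 * K * K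
  * h) (+-mono-≤ (scale (1 + K) (≤-reflexive (sym p0))) (+-mono-≤ (scale K p1) (+-mono-≤ (scale ((1 + K) * h) p2)
  (+-mono-≤ (scale h p3) (+-mono-≤ (scale h p4) (+-mono-≤ (scale (2 * h) p5) (+-mono-≤ (scale (2 * h) p6) (scale
  ((1 + K) * h) p7)))))))) (solve (h ∷ K ∷ H ∷ κ ∷ R ∷ τ ∷ w ∷ l′ ∷ px ∷ px′ ∷ ex ∷ ex′ ∷ x′ ∷ t′ ∷ B2 ∷ []))

dead-num : ∀ h w bl br c c′ t nl nr sl sr tl tr → h * w ≤ c + t → c + nl + nr ≤ c′ → h * bl ≤ nl + sl + tl →
  h * br ≤ nr + sr + tr → h * (w + bl + br) ≤ c′ + (t + (sl + sr) + (tl + tr))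
dead-num h w bl br c c′ t nl nr sl sr tl tr p0 p1 p2 p3 = farkas 0 (+-mono-≤ p0 (+-mono-≤ p1 (+-mono-≤ p2 p3)))
  (solve (h ∷ w ∷ bl ∷ br ∷ c ∷ c′ ∷ t ∷ nl ∷ nr ∷ sl ∷ sr ∷ tl ∷ tr ∷ []))

all-or-none : ∀ n (f : ℕ → ℕ) → (∀ i → i < n → 1 ≤ f i) ⊎ (∃ λ i → i < n × f i ≡ 0)
all-or-none zero f = inj₁ λ i ()
all-or-none (suc n) f with all-or-none n f
... | inj₂ (i , i<n , e) = inj₂ (i , m≤n⇒m≤1+n i<n , e)
... | inj₁ pos with f n in eq
...   | zero = inj₂ (n , ≤-refl , eq)
...   | suc x = inj₁ λ i i<n → [ pos i , (λ { refl → ≤-trans (s≤s z≤n) (≤-reflexive (sym eq)) }) ]′ (m≤n⇒m<n∨m≡n (s≤s⁻¹ i<n))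

module Play (h : ℕ) (1≤h : 1 ≤ h) (M : Model h (Constants.R₀ h)) where
  open Constants h
  open Chase h M public

  1≤K : 1 ≤ K
  1≤K = ≤-trans (s≤s z≤n) (≤-trans (m≤m+n 2 D) 2+D≤K)

  Settled : ∀ {τ} → State τ → Dir → Set
  Settled st d = State.el st d < K

  settle : ∀ {τ} (st : State τ) d → Σ (State τ) λ st′ → Settled st′ d × (∀ x → Settled st x → Settled st′ x)
  settle st d with State.fronts st d
  ... | inj₁ (e₀ , _) = st , ≤-trans (s≤s (≤-reflexive e₀)) 1≤K , λ x s → s
  ... | inj₂ w with Waiting.r w in eq
  ...   | suc r = st , ≤-trans (s≤s (m≤n+m _ r)) (≤-reflexive (trans (cong (_+ State.el st d) (sym eq)) (Waiting.r+e w))) , λ x s → s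
  ...   | zero = Jump.state st d w eq , ≤-trans (s≤s (≤-reflexive (Jump.el′d st d w eq))) 1≤K ,
      λ x s → ≤-trans (s≤s (off-≤ (d == x))) s
    where off-≤ : ∀ b {k} → off b k ≤ k
          off-≤ true = z≤n
          off-≤ false = ≤-refl

  settle-all : ∀ {τ} → State τ → Σ (State τ) λ st → ∀ d → Settled st d
  settle-all st₀ =
    let (st₁ , n₁ , k₁) = settle st₀ N
        (st₂ , e₂ , k₂) = settle st₁ E
        (st₃ , s₃ , k₃) = settle st₂ S
        (st₄ , w₄ , k₄) = settle st₃ W
    in st₄ , λ { N → k₄ N (k₃ N (k₂ N n₁)) ; E → k₄ E (k₃ E e₂) ; S → k₄ S s₃ ; W → w₄ }

  data Status (τ : ℕ) (pos : Dir → ℕ) (T e : ℕ) (d : Dir) : Set where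
    moving : e ≡ 0 → (a : Active τ pos T d) → (∀ i → i < h → 1 ≤ span pos d (λ c → ⟦ Active.β a i c ⟧)) → Status τ pos T e d
    dead : e ≡ 0 → (a : Active τ pos T d) → count pos (Active.β a) d ≤ aheadOf (K + τ) pos d D + H → Status τ pos T e d
    waiting : (w : Waiting τ pos T e d) → 1 ≤ Waiting.r w → Status τ pos T e d

  isMoving isDead : ∀ {τ pos T e d} → Status τ pos T e d → Bool
  isMoving (moving _ _ _) = true
  isMoving _ = false
  isDead (dead _ _ _) = true
  isDead _ = false

  covered : ∀ {τ pos T e d} → Status τ pos T e d → ℕ → ℤ → Bool
  covered (moving _ a _) = Active.β a
  covered _ = λ _ _ → false

  classify : ∀ {τ pos T e d} → e < K → Front τ pos T e d → Status τ pos T e d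
  classify e<K (inj₂ w) = waiting w (+-cancelʳ-≤ _ 1 _ (≤-trans e<K (≤-reflexive (sym (Waiting.r+e w)))))
  classify {τ} {pos} {T} {e} {d} e<K (inj₁ (e₀ , a))
    with all-or-none h (λ i → span pos d (λ c → ⟦ Active.β a i c ⟧))
  ... | inj₁ all = moving e₀ a all
  ... | inj₂ empty with lookahead τ d (pos d) (pos (lf d)) (pos (rt d)) (Active.β a) (Active.burnt a) empty
  ...   | inj₂ small = dead e₀ a small
  ...   | inj₁ b with count pos (Active.β a) d in eq
  -- A side without any covered cell could not produce the fire asked for by `seen`; as a dead side
  -- it satisfies its bound trivially.
  ...     | zero = dead e₀ a (≤-trans (≤-reflexive eq) z≤n)
  ...     | suc k = waiting record
    { r = K ; δ = δ ; end = K + τ ; r+τ = refl ; r+e = trans (cong (_+_ K) e₀) (+-identityʳ K)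
    ; 2≤δ = 2≤δ ; δ≤D = δ≤D ; β′ = β′ ; burnt′ = burnt′
    ; num = wait-start _ T (count pos β′ d) _ G (aheadOf (K + τ) pos d δ) Pay _ num G-def (≤-trans (≤-reflexive (cong (_+ G) eq)) profit)
    ; seen = seen } 1≤K
    where
    open Active a
    open Breakthrough b
    seen : ∃ λ i → ∃ λ c → CB τ d (pos d) c i
    seen with Sum-pos h (λ i → span pos d (λ c → ⟦ β i c ⟧)) (≤-trans (s≤s z≤n) (≤-reflexive (sym eq)))
    ... | i , i<h , q with rng-pos _ _ _ q
    ...   | c , _ , q′ = i , c , burnt i i<h c (true-⟦⟧ q′)

  Statuses : ∀ {τ} → State τ → Set
  Statuses {τ} st = ∀ d → Status τ pos (T d) (el d) d
    where open State st

  module Step {τ : ℕ} (st : State τ) (settled : ∀ d → Settled st d) (status : Statuses st) where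
    open State st

    m z : Dir → Bool
    m d = isMoving (status d)
    z d = isDead (status d)

    A : Dir → ℕ
    A d = aheadOf (K + τ) pos d D

    dead-holds : ∀ d → z d ≡ true → h * width pos d ≤ T d + A d + H
    dead-holds d e with status d
    ... | dead _ a small = dead-hold _ _ (T d) (A d) H (Active.num a) small

    total : ΣD T + B₁ + B₂ + ΣD A ≤ 3 * h * (K + τ)
    total = ≤-trans (+-monoˡ-≤ (ΣD A) fighters)
      (≤-trans (AreaMore.box-strips (P (K + τ)) D pos) (budget (K + τ) (λ d → D + pos d)))

    el≤K : ∀ d → el d ≤ K
    el≤K d = <⇒≤ (settled d)

    Order : Dir → Dir → Set
    Order d x = ∀ f → ΣD f ≡ f d + f x + f (op d) + f (op x)

    reorder : ∀ {d x} → Order d x → T d + T x + T (op d) + T (op x) + B₁ + B₂ + (A d + A x + A (op d) + A (op x)) ≤ 3 * h * (K + τ)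
    reorder o = subst₂ (λ y w → y + B₁ + B₂ + w ≤ 3 * h * (K + τ)) (o T) (o A) total

    1≰0 : ¬ 1 ≤ 0
    1≰0 ()

    beside-clash : ∀ d x → Order d x → width pos d ≡ pos x + pos (op x) → width pos x ≡ pos d + pos (op d) →
      z d ≡ true → z x ≡ true → ⊥
    beside-clash d x o wd wx zd zx = 1≰0 (clash-beside h K H κ R₀ τ (pos d) (pos x) (pos (op d)) (pos (op x))
      (el d) (el x) (el (op d)) (el (op x)) (T d) (T x) (T (op d)) (T (op x)) (A d) (A x) (A (op d)) (A (op x)) B₁ B₂
      1≤h R₀-def (≤-trans progress (≤-reflexive (cong (λ y → h * y + B₁) (o (λ d → pos d + el d)))))
      (el≤K d) (el≤K x) (el≤K (op d)) (el≤K (op x))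
      (subst (λ y → h * y ≤ T d + A d + H) wd (dead-holds d zd)) (subst (λ y → h * y ≤ T x + A x + H) wx (dead-holds x zx))
      (reorder o))

    opposite-clash : ∀ d x → Order d x → lf x ≡ d → rt x ≡ op d → width pos d ≡ pos x + pos (op x) → width pos (op d) ≡ pos x + pos (op x) →
      z d ≡ true → z (op d) ≡ true → potential τ pos T el B₂ x → ⊥
    opposite-clash d x o refl rx wd wo zd zo pt = 1≰0 (clash-opposite h K H κ R₀ τ (pos d) (pos x) (pos (op d)) (pos (op x))
      (el d) (el x) (el (op d)) (el (op x)) (T d) (T x) (T (op d)) (T (op x)) (A d) (A x) (A (op d)) (A (op x)) B₁ B₂
      1≤h R₀-def (≤-trans progress (≤-reflexive (cong (λ y → h * y + B₁) (o (λ d → pos d + el d)))))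
      (el≤K x) (el≤K (op x))
      (subst (λ y → h * y ≤ T d + A d + H) wd (dead-holds d zd))
      (subst (λ y → h * y ≤ T (op d) + A (op d) + H) wo (dead-holds (op d) zo))
      (reorder o)
      (*-cancelˡ-≤ (1 + K) (cancel-K K _ (h * (pos x + el x + (pos (op x) + el (op x))) + B₂ + κ) (T x + A x)
        (subst (λ y → (1 + K) * (h * (pos (lf x) + el (lf x) + (pos y + el y))) ≤ (1 + K) * (h * (pos x + el x + (pos (op x) + el (op x))) + B₂ + κ) + K * (T x + A x)) rx pt))))

    no-NE : z N ≡ true → z E ≡ true → ⊥
    no-NE = beside-clash N E (λ f → refl) (+-comm (pos W) (pos E)) (+-comm (pos S) (pos N))

    no-NW : z N ≡ true → z W ≡ true → ⊥
    no-NW = beside-clash N W (λ f → o (f N) (f E) (f S) (f W)) refl (+-comm (pos S) (pos N))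
      where o : ∀ n e s w → n + e + s + w ≡ n + w + s + e
            o n e s w = solve (n ∷ e ∷ s ∷ w ∷ [])

    no-ES : z E ≡ true → z S ≡ true → ⊥
    no-ES = beside-clash E S (λ f → o (f N) (f E) (f S) (f W)) refl (+-comm (pos W) (pos E))
      where o : ∀ n e s w → n + e + s + w ≡ e + s + w + n
            o n e s w = solve (n ∷ e ∷ s ∷ w ∷ [])

    no-SW : z S ≡ true → z W ≡ true → ⊥
    no-SW = beside-clash S W (λ f → o (f N) (f E) (f S) (f W)) refl refl
      where o : ∀ n e s w → n + e + s + w ≡ s + w + n + e
            o n e s w = solve (n ∷ e ∷ s ∷ w ∷ [])

    no-SN : z S ≡ true → z N ≡ true → ⊥
    no-SN zs zn with axis E
    ... | inj₁ pt = opposite-clash S E (λ f → o (f N) (f E) (f S) (f W)) refl refl (+-comm (pos W) (pos E)) (+-comm (pos W) (pos E)) zs zn pt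
      where o : ∀ n e s w → n + e + s + w ≡ s + e + n + w
            o n e s w = solve (n ∷ e ∷ s ∷ w ∷ [])
    ... | inj₂ pt = opposite-clash S W (λ f → o (f N) (f E) (f S) (f W)) refl refl refl refl zs zn pt
      where o : ∀ n e s w → n + e + s + w ≡ s + w + n + e
            o n e s w = solve (n ∷ e ∷ s ∷ w ∷ [])

    no-WE : z W ≡ true → z E ≡ true → ⊥
    no-WE zw ze with axis N
    ... | inj₁ pt = opposite-clash W N (λ f → o (f N) (f E) (f S) (f W)) refl refl (+-comm (pos S) (pos N)) (+-comm (pos S) (pos N)) zw ze pt
      where o : ∀ n e s w → n + e + s + w ≡ w + n + e + s
            o n e s w = solve (n ∷ e ∷ s ∷ w ∷ [])
    ... | inj₂ pt = opposite-clash W S (λ f → o (f N) (f E) (f S) (f W)) refl refl refl refl zw ze pt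
      where o : ∀ n e s w → n + e + s + w ≡ w + s + e + n
            o n e s w = solve (n ∷ e ∷ s ∷ w ∷ [])

    one-dead : ∀ d x → z d ≡ true → z x ≡ true → d ≡ x
    one-dead N N _ _ = refl
    one-dead N E p q = ⊥-elim (no-NE p q)
    one-dead N S p q = ⊥-elim (no-SN q p)
    one-dead N W p q = ⊥-elim (no-NW p q)
    one-dead E N p q = ⊥-elim (no-NE q p)
    one-dead E E _ _ = refl
    one-dead E S p q = ⊥-elim (no-ES p q)
    one-dead E W p q = ⊥-elim (no-WE q p)
    one-dead S N p q = ⊥-elim (no-SN p q)
    one-dead S E p q = ⊥-elim (no-ES q p)
    one-dead S S _ _ = refl
    one-dead S W p q = ⊥-elim (no-SW p q)
    one-dead W N p q = ⊥-elim (no-NW q p)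
    one-dead W E p q = ⊥-elim (no-WE p q)
    one-dead W S p q = ⊥-elim (no-SW q p)
    one-dead W W _ _ = refl

-- One step of the fire

bump-on : ∀ b x → bump b x ≡ x + on b 1
bump-on true x = +-comm 1 x
bump-on false x = sym (+-identityʳ x)

bump-≥ : ∀ b x → x ≤ bump b x
bump-≥ true x = n≤1+n x
bump-≥ false x = ≤-refl

gain-sum : ∀ b z n (f : ℕ → Bool) → (b ≡ true → z ≡ false) →
  on b 1 * n + on z (Sum n (λ i → ¬⟦ f i ⟧)) ≤ Sum n (λ i → gain b (f i))
gain-sum true z n f ex rewrite ex refl = ≤-reflexive (trans (+-identityʳ _) (trans (*-comm 1 n) (sym (Sum-const n 1))))
gain-sum false true n f ex = ≤-refl
gain-sum false false n f ex = z≤n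

growth : ∀ mL mR L R β → 1 ≤ L → 1 ≤ R → 1 ≤ rng L R (λ c → ⟦ β c ⟧) →
  rng L R (λ c → ⟦ β c ⟧) + gain mL (β -[1+ pred L ]) + gain mR (β (+ pred R)) ≤ rng (bump mL L) (bump mR R) (λ c → ⟦ dilate β c ⟧)
growth mL mR (suc L) (suc R) β _ _ ne = layer-growth mL mR L R β ne

extend : ∀ mL mR L R (β β⁺ : ℤ → Bool) x y → (∀ c → β c ≡ true → β⁺ c ≡ true) →
  ⟦ x ⟧ ≤ on mL ⟦ β⁺ -[1+ L ] ⟧ → ⟦ y ⟧ ≤ on mR ⟦ β⁺ (+ R) ⟧ →
  rng L R (λ c → ⟦ β c ⟧) + ⟦ x ⟧ + ⟦ y ⟧ ≤ rng (bump mL L) (bump mR R) (λ c → ⟦ β⁺ c ⟧)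
extend mL mR L R β β⁺ x y sub hx hy =
  ≤-trans (+-mono-≤ (+-mono-≤ (rng-mono′ L R λ c → ⟦⟧-mono (sub c)) hx) hy) (add mL mR)
  where
  g : ℤ → ℕ
  g c = ⟦ β⁺ c ⟧
  add : ∀ mL mR → rng L R g + on mL (g -[1+ L ]) + on mR (g (+ R)) ≤ rng (bump mL L) (bump mR R) g
  add false false = ≤-reflexive (trans (+-identityʳ _) (+-identityʳ _))
  add false true = ≤-reflexive (trans (cong (_+ g (+ R)) (+-identityʳ _)) (sym (addR L R g)))
  add true false = ≤-reflexive (trans (+-identityʳ _) (sym (addL L R g)))
  add true true = ≤-reflexive (trans (cong (_+ g (+ R)) (sym (addL L R g))) (sym (addR (suc L) R g)))

∧-on : ∀ b x y → (b ≡ true → x ≡ true → y ≡ true) → ⟦ b ∧ x ⟧ ≤ on b ⟦ y ⟧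
∧-on true x y f = ⟦⟧-mono (f refl)
∧-on false x y f = z≤n

∨-case : ∀ {a b} → a ∨ b ≡ true → a ≡ true ⊎ b ≡ true
∨-case {true} e = inj₁ refl
∨-case {false} e = inj₂ e

∧-case : ∀ {a b} → a ∧ b ≡ true → a ≡ true × b ≡ true
∧-case {true} e = refl , e

∨-left : ∀ {a b} → a ≡ true → a ∨ b ≡ true
∨-left refl = refl

∨-right : ∀ {a b} → b ≡ true → a ∨ b ≡ true
∨-right {true} e = refl
∨-right {false} e = e

isZero-⊎ : ∀ {A : Set} n → isZero n ≡ true → A ⊎ 1 ≤ n → A
isZero-⊎ n e (inj₁ a) = a
isZero-⊎ zero e (inj₂ ())

collect : ∀ t t′ s o p b1 b2 x y → t′ + o ≡ t + s + o + p → t + b1 + b2 ≤ x → x + s + p ≤ y → t′ + b1 + b2 ≤ y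
collect t t′ s o p b1 b2 x y p0 p1 p2 = farkas 0 (+-mono-≤ (≤-reflexive p0) (+-mono-≤ p1 p2)) (solve (t ∷ t′ ∷ s ∷
  o ∷ p ∷ b1 ∷ b2 ∷ x ∷ y ∷ []))

three-gained : ∀ a a′ o → a′ + o ≡ a + 4 → o ≤ 1 → a + 3 ≤ a′
three-gained a a′ o p0 p1 = farkas 0 (+-mono-≤ (≤-reflexive (sym p0)) p1) (solve (a ∷ a′ ∷ o ∷ []))

none-lost : ∀ a a′ o → a′ + o ≡ a + 1 → o ≤ 1 → a ≤ a′
none-lost a a′ o p0 p1 = farkas 0 (+-mono-≤ (≤-reflexive (sym p0)) p1) (solve (a ∷ a′ ∷ o ∷ []))

extent-move : ∀ K p e → e ≡ 0 → 1 ≤ K → (1 + K) * p + 2 * e + 2 ≤ (1 + K) * (1 + p) + 2 * 0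
extent-move K p e p0 p1 = farkas 0 (+-mono-≤ (scale 2 (≤-reflexive p0)) p1) (solve (K ∷ p ∷ e ∷ []))

extent-wait : ∀ a e → a + 2 * e + 2 ≤ a + 2 * (1 + e)
extent-wait a e = farkas 0 (≤-refl {0}) (solve (a ∷ e ∷ []))

hold-step : ∀ t t′ a a′ s o i p → t′ + o ≡ t + s + i + p → a ≤ s + a′ → t + a ≤ t′ + a′ + o
hold-step t t′ a a′ s o i p p0 p1 = farkas (i + p) (+-mono-≤ (≤-reflexive (sym p0)) p1) (solve (t ∷ t′ ∷ a ∷ a′ ∷ s
  ∷ o ∷ i ∷ p ∷ []))

lateral-step : ∀ a b a′ b′ x y → a′ + x ≡ a + 1 → b′ + y ≡ b + 1 → a′ + b′ + (x + y) ≤ a + b + 2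
lateral-step a b a′ b′ x y p0 p1 = farkas 0 (+-mono-≤ (≤-reflexive p0) (≤-reflexive p1)) (solve (a ∷ b ∷ a′ ∷ b′ ∷
  x ∷ y ∷ []))

alive-step : ∀ a b a′ b′ → a′ ≡ a + 1 → b′ ≡ b + 1 → a + b + 2 ≤ a′ + b′
alive-step a b a′ b′ p0 p1 = farkas 0 (+-mono-≤ (≤-reflexive (sym p0)) (≤-reflexive (sym p1))) (solve (a ∷ b ∷ a′ ∷
  b′ ∷ []))

near-ends : ∀ a b x y K a′ b′ → a′ ≤ a + x + 1 → b′ ≤ b + y + 1 → x ≤ K → y ≤ K → a′ + b′ ≤ a + b + 2 * K + 2
near-ends a b x y K a′ b′ p0 p1 p2 p3 = farkas 0 (+-mono-≤ p0 (+-mono-≤ p1 (+-mono-≤ p2 p3))) (solve (a ∷ b ∷ x ∷ y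
  ∷ K ∷ a′ ∷ b′ ∷ []))

far-ends : ∀ a b x y τ R → a + x ≤ τ + R → b + y ≤ τ + R → a + b ≤ 2 * τ + 2 * R
far-ends a b x y τ R p0 p1 = farkas (x + y) (+-mono-≤ p0 p1) (solve (a ∷ b ∷ x ∷ y ∷ τ ∷ R ∷ []))

extent-start : ∀ K R → 2 * 0 + 2 * R ≤ (1 + K) * (R + R) + 2 * (0 + 0)
extent-start K R = farkas (2 * K * R) (≤-refl {0}) (solve (K ∷ R ∷ []))

double-far : ∀ K τ R a b x y c → 2 * τ + 2 * R ≤ (1 + K) * (a + b) + 2 * (x + y) → x ≤ K → y ≤ K → a ≤ c → b ≤ c →
  2 * τ ≤ 2 * ((1 + K) * c + 2 * K)
double-far K τ R a b x y c p0 p1 p2 p3 p4 = farkas (2 * R) (+-mono-≤ p0 (+-mono-≤ (scale 2 p1) (+-mono-≤ (scale 2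
  p2) (+-mono-≤ (scale (1 + K) p3) (scale (1 + K) p4))))) (solve (K ∷ τ ∷ R ∷ a ∷ b ∷ x ∷ y ∷ c ∷ []))

far-enough : ∀ K τ R a b x y c → 2 * τ + 2 * R ≤ (1 + K) * (a + b) + 2 * (x + y) → x ≤ K → y ≤ K → a ≤ c → b ≤ c → τ ≤ (1 + K) * c + 2 * K
far-enough K τ R a b x y c p0 p1 p2 p3 p4 = *-cancelˡ-≤ 2 (double-far K τ R a b x y c p0 p1 p2 p3 p4)

share : ∀ t w → 1 ≤ ⟦ t ∧ isZero w ⟧ + ¬⟦ t ⟧ + w
share true zero = ≤-refl
share true (suc w) = s≤s z≤n
share false w = s≤s z≤n

module Play′ (h : ℕ) (1≤h : 1 ≤ h) (M : Model h (Constants.R₀ h)) where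
  open Constants h
  open Play h 1≤h M public

  module Next {τ : ℕ} (st : State τ) (settled : ∀ d → Settled st d) (status : Statuses st) where
    open State st
    open Step st settled status

    q⁺ : ℤ → ℤ → ℕ
    q⁺ = P (K + suc τ)

    open Area q⁺

    pos′ : Dir → ℕ
    pos′ = pos⁺ pos m

    swept : Dir → ℕ
    swept = met pos m

    βs : Dir → ℕ → ℤ → Bool
    βs d = covered (status d)

    -- The last cell, in the direction of side d, of the two lines that meet side d, and the end point of the range there.
    edge cap : Dir → ℤ
    edge N = + pred (pos N)
    edge E = + pred (pos E)
    edge S = -[1+ pred (pos S) ]
    edge W = -[1+ pred (pos W) ]
    cap N = + pos N
    cap E = + pos E
    cap S = neg (pos S)
    cap W = neg (pos W)

    -- An uncovered end cell of an advancing side is gained there without being needed, so it is handed to the dead side it meets.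
    blank spare tip : Dir → Dir → ℕ
    blank x d = Sum h (λ i → ¬⟦ βs x i (edge d) ⟧)
    spare x d = on (m x) (on (z d) (blank x d))
    tip x d = on (m x) (off (m d) (at x (suc (pos x)) (cap d) q⁺))

    T′ : Dir → ℕ
    T′ d = (T d + swept d + (spare (lf d) d + spare (rt d) d) + (tip (lf d) d + tip (rt d) d)) ∸ (spare d (rt d) + spare d (lf d))

    lapse : ∀ {τ pos T e d} → Status τ pos T e d → ℕ
    lapse {e = e} (waiting _ _) = suc e
    lapse _ = 0

    el′ : Dir → ℕ
    el′ d = lapse (status d)

    le : ∀ x → pos x ≤ pos′ x
    le x = bump-≥ (m x) (pos x)

    width′ : ∀ d → width pos′ d ≡ width pos d + on (m (lf d)) 1 + on (m (rt d)) 1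
    width′ d = trans (cong₂ _+_ (bump-on (m (lf d)) (pos (lf d))) (bump-on (m (rt d)) (pos (rt d)))) (o (pos (lf d)) _ (pos (rt d)) _)
      where o : ∀ a x b y → a + x + (b + y) ≡ a + b + x + y
            o a x b y = solve (a ∷ x ∷ b ∷ y ∷ [])

    not-dead : ∀ d → m d ≡ true → z d ≡ false
    not-dead d e with status d
    ... | moving _ _ _ = refl

    edge-rt : ∀ d → edge (rt d) ≡ + pred (pos (rt d))
    edge-rt N = refl
    edge-rt E = refl
    edge-rt S = refl
    edge-rt W = refl

    edge-lf : ∀ d → edge (lf d) ≡ -[1+ pred (pos (lf d)) ]
    edge-lf N = refl
    edge-lf E = refl
    edge-lf S = refl
    edge-lf W = refl

    module _ (d : Dir) (e₀ : el d ≡ 0) (a : Active τ pos (T d) d) (full : ∀ i → i < h → 1 ≤ span pos d (λ c → ⟦ Active.β a i c ⟧))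
      (eq : status d ≡ moving e₀ a full) where
      private
        open Active a

        w : ℕ → ℕ → ℤ → ℕ
        w t i = cells (line (layer t i) d (suc (pos d)))

        β′ : ℕ → ℤ → Bool
        β′ i = dilate (β i) free w (suc τ) i

        md : m d ≡ true
        md = cong isMoving eq

        gL gR : ℕ
        gL = Sum h (λ i → gain (m (lf d)) (β i -[1+ pred (pos (lf d)) ]))
        gR = Sum h (λ i → gain (m (rt d)) (β i (+ pred (pos (rt d)))))

        -- In every layer the covered set dilates; the cells where a fighter stands are removed from
        -- it and charged to `swept`.
        grown : count pos β d + gL + gR ≤ count pos′ β′ d + swept d
        grown = ≤-trans (≤-reflexive (sym (trans (Sum-+ h _ _) (cong (_+ gR) (Sum-+ h _ _)))))
          (≤-trans (Sum-mono h each) (≤-trans (≤-reflexive (Sum-+ h _ _)) (+-monoʳ-≤ (count pos′ β′ d)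
            (≤-trans (≤-reflexive (trans (rng-Sum h _ _ (w (suc τ))) (rng-cong _ _ (Sum-cell h (λ i → layer (suc τ) i) d (suc (pos d))))))
            (≤-trans (rng-mono′ _ _ (cells-mono (P-mono+ K (suc τ)) d (suc (pos d)))) (≤-reflexive (cong (λ b → on b (span pos′ d (cells (line q⁺ d (suc (pos d)))))) (sym md))))))))
          where
          each : ∀ i → i < h → _ ≤ span pos′ d (λ c → ⟦ β′ i c ⟧) + span pos′ d (w (suc τ) i)
          each i i<h = ≤-trans (growth (m (lf d)) (m (rt d)) _ _ (β i) (pos-pos (lf d)) (pos-pos (rt d)) (full i i<h))
            (≤-trans (rng-mono′ _ _ (free-count (dilate (β i)) (w (suc τ) i))) (≤-reflexive (rng-+ _ _ _ _)))

        spare-≤ : ∀ x c → edge x ≡ c → on (m x) 1 * h + spare d x ≤ Sum h (λ i → gain (m x) (β i c))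
        spare-≤ x c refl = subst₂ (λ b γ → on (m x) 1 * h + on b (on (z x) (Sum h (λ i → ¬⟦ γ i (edge x) ⟧))) ≤ Sum h (λ i → gain (m x) (β i (edge x))))
          (sym md) (cong covered (sym eq)) (gain-sum (m x) (z x) h (λ i → β i (edge x)) (not-dead x))

        balance : h * width pos′ d + (spare d (rt d) + spare d (lf d)) ≤ count pos′ β′ d + (T d + swept d)
        balance = subst (λ y → h * y + (spare d (rt d) + spare d (lf d)) ≤ count pos′ β′ d + (T d + swept d)) (sym (width′ d))
          (moving-num h (width pos d) (on (m (lf d)) 1) (on (m (rt d)) 1) (spare d (lf d)) (spare d (rt d))
            (count pos β d) (count pos′ β′ d) (swept d) (T d) gL gR num
            (spare-≤ (lf d) _ (edge-lf d)) (spare-≤ (rt d) _ (edge-rt d)) grown)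

        received handed : ℕ
        received = spare (lf d) d + spare (rt d) d
        handed = tip (lf d) d + tip (rt d) d

        afford : spare d (rt d) + spare d (lf d) ≤ T d + swept d + received + handed
        afford = afford-moving _ (count pos′ β′ d) (T d) (swept d) _ received handed balance (count-≤ pos′ β′ d)

      moved : Active (suc τ) pos′ (T′ d) d
      moved = record
        { β = β′
        ; burnt = λ i i<h c e → subst (λ y → CB (suc τ) d y c i) (sym (cong (λ b → bump b (pos d)) md))
            (free-burnt (dilate (β i)) (w (suc τ) i) c (CB-dilate (β i) i<h (burnt i i<h) c) e)
        ; num = moving-end _ (count pos′ β′ d) (T d) (swept d) received handed _ (T′ d) balance (m∸n+n≡m afford) }

      afford-moved : spare d (rt d) + spare d (lf d) ≤ T d + swept d + (spare (lf d) d + spare (rt d) d) + (tip (lf d) d + tip (rt d) d)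
      afford-moved = afford

    T′-still : ∀ d → m d ≡ false → T′ d ≡ T d + (spare (lf d) d + spare (rt d) d) + (tip (lf d) d + tip (rt d) d)
    T′-still d md = trans (cong (λ b → (T d + on b (span pos′ d (cells (line q⁺ d (suc (pos d))))) + r + t) ∸ (on b (on (z (rt d)) (blank d (rt d))) + on b (on (z (lf d)) (blank d (lf d))))) md)
        (cong (λ y → y + r + t) (+-identityʳ (T d)))
      where
      r t : ℕ
      r = spare (lf d) d + spare (rt d) d
      t = tip (lf d) d + tip (rt d) d

    T≤T′ : ∀ d → m d ≡ false → T d ≤ T′ d
    T≤T′ d md = ≤-trans (≤-trans (m≤m+n (T d) _) (m≤m+n _ _)) (≤-reflexive (sym (T′-still d md)))

    pos′-still : ∀ d → m d ≡ false → pos′ d ≡ pos d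
    pos′-still d md = cong (λ b → bump b (pos d)) md

    covered-burnt : ∀ x i → i < h → ∀ c → βs x i c ≡ true → CB τ x (pos x) c i
    covered-burnt x i i<h c e with status x
    ... | moving _ a _ = Active.burnt a i i<h c e

    lineR : ∀ x n {i} → 1 ≤ n → i < h → CB τ x (pos x) (+ pred n) i →
      CB (suc τ) (rt x) n (beyond x (pos x)) i ⊎ 1 ≤ at x (suc (pos x)) (+ n) (layer (suc τ) i)
    lineR x (suc n) _ i<h b = endR x i<h b

    lineL : ∀ x n {i} → 1 ≤ n → i < h → CB τ x (pos x) -[1+ pred n ] i →
      CB (suc τ) (lf x) n (beyond x (pos x)) i ⊎ 1 ≤ at x (suc (pos x)) (neg n) (layer (suc τ) i)
    lineL x (suc n) _ i<h b = endL x i<h b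

    Meets : Dir → Dir → Set
    Meets x d = ∀ {i} → i < h → CB τ x (pos x) (edge d) i →
      CB (suc τ) d (pos d) (beyond x (pos x)) i ⊎ 1 ≤ at x (suc (pos x)) (cap d) (layer (suc τ) i)

    meets-lf : ∀ d → Meets (lf d) d
    meets-lf N = lineR W (pos N) (pos-pos N)
    meets-lf E = lineR S (pos E) (pos-pos E)
    meets-lf S = lineL W (pos S) (pos-pos S)
    meets-lf W = lineL S (pos W) (pos-pos W)

    meets-rt : ∀ d → Meets (rt d) d
    meets-rt N = lineR E (pos N) (pos-pos N)
    meets-rt E = lineR N (pos E) (pos-pos E)
    meets-rt S = lineL E (pos S) (pos-pos S)
    meets-rt W = lineL N (pos W) (pos-pos W)

    beyond-lf : ∀ d a → beyond (lf d) a ≡ -[1+ a ]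
    beyond-lf N a = refl
    beyond-lf E a = refl
    beyond-lf S a = refl
    beyond-lf W a = refl

    beyond-rt : ∀ d a → beyond (rt d) a ≡ + a
    beyond-rt N a = refl
    beyond-rt E a = refl
    beyond-rt S a = refl
    beyond-rt W a = refl

    module _ (d : Dir) (e₀ : el d ≡ 0) (a : Active τ pos (T d) d) (small : count pos (Active.β a) d ≤ aheadOf (K + τ) pos d D + H)
      (eq : status d ≡ dead e₀ a small) where
      private
        open Active a

        md : m d ≡ false
        md = cong isMoving eq

        zd : z d ≡ true
        zd = cong isDead eq

        fighter : Dir → ℕ → ℕ
        fighter x i = at x (suc (pos x)) (cap d) (layer (suc τ) i)

        new : Dir → ℕ → Bool
        new x i = m x ∧ (βs x i (edge d) ∧ isZero (fighter x i))

        new-burnt : ∀ x → Meets x d → ∀ i → i < h → new x i ≡ true → CB (suc τ) d (pos d) (beyond x (pos x)) i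
        new-burnt x meets i i<h e =
          let (_ , e′) = ∧-case {m x} e
              (b , f) = ∧-case {βs x i (edge d)} e′
          in isZero-⊎ (fighter x i) f (meets i<h (covered-burnt x i i<h (edge d) b))

        β⁺ : ℕ → ℤ → Bool
        β⁺ i (+ k) = β i (+ k) ∨ ((k ≡ᵇ pos (rt d)) ∧ new (rt d) i)
        β⁺ i -[1+ k ] = β i -[1+ k ] ∨ ((k ≡ᵇ pos (lf d)) ∧ new (lf d) i)

        burnt⁺ : ∀ i → i < h → ∀ c → β⁺ i c ≡ true → CB (suc τ) d (pos d) c i
        burnt⁺ i i<h (+ k) e with ∨-case {β i (+ k)} e
        ... | inj₁ e′ = CB-mono d (burnt i i<h (+ k) e′)
        ... | inj₂ e′ with ∧-case {k ≡ᵇ pos (rt d)} e′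
        ...   | k≡ , n rewrite ≡ᵇ-true k (pos (rt d)) k≡ =
          subst (λ c → CB (suc τ) d (pos d) c i) (beyond-rt d (pos (rt d))) (new-burnt (rt d) (meets-rt d) i i<h n)
        burnt⁺ i i<h -[1+ k ] e with ∨-case {β i -[1+ k ]} e
        ... | inj₁ e′ = CB-mono d (burnt i i<h -[1+ k ] e′)
        ... | inj₂ e′ with ∧-case {k ≡ᵇ pos (lf d)} e′
        ...   | k≡ , n rewrite ≡ᵇ-true k (pos (lf d)) k≡ =
          subst (λ c → CB (suc τ) d (pos d) c i) (beyond-lf d (pos (lf d))) (new-burnt (lf d) (meets-lf d) i i<h n)

        keeps : ∀ i c → β i c ≡ true → β⁺ i c ≡ true
        keeps i (+ k) e = ∨-left e
        keeps i -[1+ k ] e = ∨-left e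

        fresh : Dir → ℕ
        fresh x = Sum h (λ i → ⟦ new x i ⟧)

        longer : count pos β d + fresh (lf d) + fresh (rt d) ≤ count pos′ β⁺ d
        longer = ≤-trans (≤-reflexive (sym (trans (Sum-+ h _ _) (cong (_+ fresh (rt d)) (Sum-+ h _ _))))) (Sum-mono h λ i _ →
          extend (m (lf d)) (m (rt d)) (pos (lf d)) (pos (rt d)) (β i) (β⁺ i) (new (lf d) i) (new (rt d) i) (keeps i)
            (∧-on (m (lf d)) _ _ λ mx n → ∨-right {β i -[1+ pos (lf d) ]} (both (pos (lf d)) (lf d) i mx n))
            (∧-on (m (rt d)) _ _ λ mx n → ∨-right {β i (+ pos (rt d))} (both (pos (rt d)) (rt d) i mx n)))
          where
          both : ∀ k x i → m x ≡ true → βs x i (edge d) ∧ isZero (fighter x i) ≡ true → (k ≡ᵇ k) ∧ new x i ≡ true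
          both k x i mx n = trans (cong (_∧ new x i) (≡ᵇ-refl k)) (trans (cong (_∧ (βs x i (edge d) ∧ isZero (fighter x i))) mx) n)

        -- For the cell that `d` gains next to a moving side `x` each layer has three cases: the
        -- cell burns; or the end cell of `x` is uncovered and its gain is handed over as `spare`;
        -- or a fighter stands on the decisive point and is handed over as `tip`.
        shared : ∀ x → h * on (m x) 1 ≤ fresh x + spare x d + tip x d
        shared x = subst₂ (λ b c → h * on (m x) 1 ≤ fresh x + on (m x) (on b (blank x d)) + on (m x) (off c (at x (suc (pos x)) (cap d) q⁺)))
          (sym zd) (sym md) (go (m x))
          where
          go : ∀ b → h * on b 1 ≤ Sum h (λ i → ⟦ b ∧ (βs x i (edge d) ∧ isZero (fighter x i)) ⟧) + on b (blank x d) + on b (at x (suc (pos x)) (cap d) q⁺)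
          go false = ≤-trans (≤-reflexive (*-zeroʳ h)) z≤n
          go true = ≤-trans (≤-reflexive (sym (Sum-const h 1))) (≤-trans (Sum-mono h λ i _ → share (βs x i (edge d)) (fighter x i))
            (≤-trans (≤-reflexive (trans (Sum-+ h _ _) (cong₂ _+_ (Sum-+ h _ _) (Sum-line h (λ i → layer (suc τ) i) x (suc (pos x)) (cap d)))))
              (+-monoʳ-≤ _ (line-mono (P-mono+ K (suc τ)) x (suc (pos x)) (cap d)))))

      rested : Active (suc τ) pos′ (T′ d) d
      rested = record
        { β = β⁺
        ; burnt = λ i i<h c e → subst (λ y → CB (suc τ) d y c i) (sym (pos′-still d md)) (burnt⁺ i i<h c e)
        ; num = subst₂ (λ y t → h * y ≤ count pos′ β⁺ d + t) (sym (width′ d)) (sym (T′-still d md))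
            (dead-num h (width pos d) (on (m (lf d)) 1) (on (m (rt d)) 1) (count pos β d) (count pos′ β⁺ d) (T d) (fresh (lf d)) (fresh (rt d))
              (spare (lf d) d) (spare (rt d) d) (tip (lf d) d) (tip (rt d) d) num longer (shared (lf d)) (shared (rt d))) }

    width-step : ∀ d → width pos′ d ≤ width pos d + 2
    width-step d = ≤-trans (≤-reflexive (trans (width′ d) (+-assoc (width pos d) _ _))) (+-monoʳ-≤ (width pos d) (+-mono-≤ (one (m (lf d))) (one (m (rt d)))))
      where one : ∀ b → on b 1 ≤ 1
            one true = ≤-refl
            one false = z≤n

    waited : ∀ d (w : Waiting τ pos (T d) (el d) d) → 1 ≤ Waiting.r w → m d ≡ false →
      Waiting (suc τ) pos′ (T′ d) (suc (el d)) d
    waited d w 1≤r md with Waiting.r w in er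
    ... | suc k = record
      { r = k ; δ = δ ; end = end ; r+τ = trans (+-suc k τ) (trans (cong (_+ τ) (sym er)) r+τ)
      ; r+e = trans (+-suc k (el d)) (trans (cong (_+ el d) (sym er)) r+e)
      ; 2≤δ = 2≤δ ; δ≤D = δ≤D ; β′ = β′
      ; burnt′ = λ i i<h c e → subst (λ y → CB end d (δ + y) c i) (sym still) (burnt′ i i<h c e)
      ; num = waiting-num h (width pos d) (width pos′ d) (count pos β′ d) (count pos′ β′ d) (aheadOf end pos d δ) (aheadOf end pos′ d δ)
          (T d) (T′ d) Pay k (subst (λ y → h * width pos d + (Pay + 2 * (h * y)) ≤ count pos β′ d + aheadOf end pos d δ + T d) er num) (width-step d) (count-mono β′ d le)
          (≤-trans (ahead-mono end d (pos d) δ (le (lf d)) (le (rt d))) (≤-reflexive (cong (λ y → ahead end d y (pos′ (lf d)) (pos′ (rt d)) δ) (sym still))))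
          (T≤T′ d md)
      ; seen = let (i , c , b) = seen in i , c , subst (λ y → CB (suc τ) d y c i) (sym still) (CB-mono d b) }
      where
      open Waiting w
      still : pos′ d ≡ pos d
      still = pos′-still d md

    front′ : ∀ d (s : Status τ pos (T d) (el d) d) → status d ≡ s → Front (suc τ) pos′ (T′ d) (lapse s) d
    front′ d (moving e₀ a full) eq = inj₁ (refl , moved d e₀ a full eq)
    front′ d (dead e₀ a small) eq = inj₁ (refl , rested d e₀ a small eq)
    front′ d (waiting w 1≤r) eq = inj₂ (waited d w 1≤r (cong isMoving eq))

    -- The subtraction in `T′` is exact: only a moving side gives anything away, and since its
    -- covered cells cannot exceed the full line, it owns at least what it gives.
    account : ∀ d → T′ d + (spare d (rt d) + spare d (lf d)) ≡ T d + swept d + (spare (lf d) d + spare (rt d) d) + (tip (lf d) d + tip (rt d) d)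
    account d = m∸n+n≡m (afford (status d) refl)
      where
      rhs = T d + swept d + (spare (lf d) d + spare (rt d) d) + (tip (lf d) d + tip (rt d) d)
      nothing : m d ≡ false → spare d (rt d) + spare d (lf d) ≤ rhs
      nothing md = ≤-trans (≤-reflexive (cong₂ _+_ (cong (λ b → on b (on (z (rt d)) (blank d (rt d)))) md) (cong (λ b → on b (on (z (lf d)) (blank d (lf d)))) md))) z≤n
      afford : ∀ s → status d ≡ s → spare d (rt d) + spare d (lf d) ≤ rhs
      afford (moving e₀ a full) eq = afford-moved d e₀ a full eq
      afford (dead e₀ a small) eq = nothing (cong isMoving eq)
      afford (waiting w 1≤r) eq = nothing (cong isMoving eq)

    exchange : ∀ (f : Dir → Dir → ℕ) → ΣD (λ d → f (lf d) d + f (rt d) d) ≡ ΣD (λ d → f d (rt d) + f d (lf d))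
    exchange f = o (f W N) (f E N) (f S E) (f N E) (f W S) (f E S) (f S W) (f N W)
      where o : ∀ wn en se ne ws es sw nw → wn + en + (se + ne) + (ws + es) + (sw + nw) ≡ ne + nw + (en + es) + (se + sw) + (wn + ws)
            o wn en se ne ws es sw nw = solve (wn ∷ en ∷ se ∷ ne ∷ ws ∷ es ∷ sw ∷ nw ∷ [])

    later-area : ∀ {q q′ : ℤ → ℤ → ℕ} → (∀ u v → q u v ≤ q′ u v) → Area.box q pos ≤ Area.box q′ pos
    later-area le = rng-mono′ _ _ λ v → rng-mono′ _ _ λ u → le u v

    P-suc : ∀ u v → P (K + τ) u v ≤ q⁺ u v
    P-suc u v = subst (λ t → P (K + τ) u v ≤ P t u v) (sym (+-suc K τ)) (P-mono (K + τ) u v)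

    fighters′ : ΣD T′ + B₁ + B₂ ≤ box pos′ + box pos′
    fighters′ = collect (ΣD T) (ΣD T′) (ΣD swept) (ΣD (λ d → spare d (rt d) + spare d (lf d))) (ΣD (λ d → tipR pos m d + tipL pos m d)) B₁ B₂
        (box pos + box pos) (box pos′ + box pos′) sums
        (≤-trans fighters (+-mono-≤ (later-area P-suc) (later-area P-suc))) (box-grows pos m)
      where
      sums : ΣD T′ + ΣD (λ d → spare d (rt d) + spare d (lf d)) ≡
        ΣD T + ΣD swept + ΣD (λ d → spare d (rt d) + spare d (lf d)) + ΣD (λ d → tipR pos m d + tipL pos m d)
      sums = trans (sym (ΣD-+ T′ (λ d → spare d (rt d) + spare d (lf d)))) (trans (ΣD-cong account)
        (trans (ΣD-+ (λ d → T d + swept d + (spare (lf d) d + spare (rt d) d)) (λ d → tip (lf d) d + tip (rt d) d))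
          (cong₂ _+_ (trans (ΣD-+ (λ d → T d + swept d) (λ d → spare (lf d) d + spare (rt d) d)) (cong₂ _+_ (ΣD-+ T swept) (exchange spare))) (exchange tip))))

    v v′ : Dir → ℕ
    v d = pos d + el d
    v′ d = pos′ d + el′ d

    v-step : ∀ d → v′ d + on (z d) 1 ≡ v d + 1
    v-step d = go (status d)
      where
      go : (s : Status τ pos (T d) (el d) d) → bump (isMoving s) (pos d) + lapse s + on (isDead s) 1 ≡ pos d + el d + 1
      go (moving e₀ _ _) = trans (o (pos d)) (cong (λ y → pos d + y + 1) (sym e₀))
        where o : ∀ x → suc x + 0 + 0 ≡ x + 0 + 1
              o x = solve (x ∷ [])
      go (dead e₀ _ _) = cong (λ y → pos d + y + 1) (sym e₀)
      go (waiting _ _) = o (pos d) (el d)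
        where o : ∀ x y → x + suc y + 0 ≡ x + y + 1
              o x y = solve (x ∷ y ∷ [])

    any-dead : (∃ λ d → z d ≡ true) ⊎ (∀ d → z d ≡ false)
    any-dead = search (z N) (z E) (z S) (z W) refl refl refl refl
      where
      search : ∀ a b c d → z N ≡ a → z E ≡ b → z S ≡ c → z W ≡ d → (∃ λ d → z d ≡ true) ⊎ (∀ d → z d ≡ false)
      search true _ _ _ e _ _ _ = inj₁ (N , e)
      search false true _ _ _ e _ _ = inj₁ (E , e)
      search false false true _ _ _ e _ = inj₁ (S , e)
      search false false false true _ _ _ e = inj₁ (W , e)
      search false false false false n e s w = inj₂ λ { N → n ; E → e ; S → s ; W → w }

    few-dead : ΣD (λ d → on (z d) 1) ≤ 1
    few-dead with any-dead
    ... | inj₂ none = ≤-trans (ΣD-mono (λ d → ≤-reflexive (cong (λ b → on b 1) (none d)))) z≤n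
    ... | inj₁ (d , e) = ≤-trans (ΣD-mono λ x → only x (z x) refl) (≤-reflexive (ΣD-on d 1))
      where
      only : ∀ x b → z x ≡ b → on b 1 ≤ on (d == x) 1
      only x false _ = z≤n
      only x true zx with one-dead d x e zx
      ... | refl = ≤-reflexive (cong (λ b → on b 1) (sym (==-refl d)))

    progress′ : 3 * h * suc τ + 4 * h * R₀ ≤ h * ΣD v′ + B₁
    progress′ = progress-step h τ R₀ (ΣD v) (ΣD v′) B₁ progress
      (three-gained (ΣD v) (ΣD v′) _ (trans (sym (ΣD-+ v′ (λ d → on (z d) 1))) (trans (ΣD-cong v-step) (ΣD-+ v (λ _ → 1)))) few-dead)

    v≤v′ : ∀ d → v d ≤ v′ d
    v≤v′ d = none-lost (v d) (v′ d) _ (v-step d) (at-most-one (z d))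
      where at-most-one : ∀ b → on b 1 ≤ 1
            at-most-one true = ≤-refl
            at-most-one false = z≤n

    v′≤1+v : ∀ d → v′ d ≤ v d + 1
    v′≤1+v d = ≤-trans (m≤m+n _ _) (≤-reflexive (v-step d))

    extent-at : ∀ x → (1 + K) * pos x + 2 * el x + off (z x) 2 ≤ (1 + K) * pos′ x + 2 * el′ x
    extent-at x = go (status x)
      where
      go : (s : Status τ pos (T x) (el x) x) → (1 + K) * pos x + 2 * el x + off (isDead s) 2 ≤ (1 + K) * bump (isMoving s) (pos x) + 2 * lapse s
      go (moving e₀ _ _) = extent-move K (pos x) (el x) e₀ 1≤K
      go (dead e₀ _ _) = ≤-reflexive (trans (+-identityʳ _) (cong (λ y → (1 + K) * pos x + 2 * y) e₀))
      go (waiting _ _) = extent-wait ((1 + K) * pos x) (el x)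

    alive-pair : ∀ X → 2 ≤ off (z X) 2 + off (z (op X)) 2
    alive-pair X with z X in p | z (op X) in q
    ... | false | _ = m≤m+n 2 _
    ... | true | false = ≤-refl
    ... | true | true = ⊥-elim (differ X (one-dead X (op X) p q))
      where differ : ∀ X → X ≢ op X
            differ N ()
            differ E ()
            differ S ()
            differ W ()

    -- One of two opposite sides is not dead. If it moves it contributes 1 + K ≥ 2, and if it waits
    -- 2 by its elapsed time.
    extent′ : ∀ X → 2 * suc τ + 2 * R₀ ≤ (1 + K) * (pos′ X + pos′ (op X)) + 2 * (el′ X + el′ (op X))
    extent′ X = extent-step (1 + K) τ R₀ (pos X) (pos (op X)) (el X) (el (op X)) (pos′ X) (pos′ (op X)) (el′ X) (el′ (op X))
      (off (z X) 2) (off (z (op X)) 2) (extent X) (extent-at X) (extent-at (op X)) (alive-pair X)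

    A′ : Dir → ℕ
    A′ Y = aheadOf (K + suc τ) pos′ Y D

    ahead-step : ∀ Y → A Y ≤ swept Y + A′ Y
    ahead-step Y = go (m Y) refl
      where
      f : ℕ → ℕ
      f k = span pos′ Y (cells (line q⁺ Y (suc k + pos Y)))
      A≤ : ∀ n → aheadOf (K + τ) pos Y n ≤ Sum n f
      A≤ n = Sum-mono n λ k _ → ≤-trans (rng-mono′ _ _ (cells-mono P-suc Y (suc k + pos Y))) (rng-≤-mono _ (le (lf Y)) (le (rt Y)))
      go : ∀ b → m Y ≡ b → A Y ≤ swept Y + A′ Y
      go false e = ≤-trans (≤-trans (A≤ D) (≤-reflexive (Sum-cong D λ k → cong (λ y → span pos′ Y (cells (line q⁺ Y (suc k + y)))) (sym (pos′-still Y e))))) (m≤n+m _ (swept Y))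
      go true e = ≤-trans (A≤ D) (≤-trans (Sum-≤-mono f (n≤1+n D)) (≤-reflexive (trans (Sum-front D f)
        (cong₂ _+_ (cong (λ b → on b (span pos′ Y (cells (line q⁺ Y (suc (pos Y)))))) (sym e))
          (Sum-cong D λ k → cong (λ y → span pos′ Y (cells (line q⁺ Y y))) (trans (sym (+-suc (suc k) (pos Y))) (cong (λ y → suc k + y) (cong (λ b → bump b (pos Y)) (sym e)))))))))

    hold : ∀ Y → T Y + A Y ≤ T′ Y + A′ Y + (spare Y (rt Y) + spare Y (lf Y))
    hold Y = hold-step (T Y) (T′ Y) (A Y) (A′ Y) (swept Y) _ _ _ (account Y) (ahead-step Y)

    spare-dead : ∀ x d → spare x d ≤ h * on (z d) 1
    spare-dead x d = go (m x) (z d)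
      where
      go : ∀ b c → on b (on c (blank x d)) ≤ h * on c 1
      go false c = z≤n
      go true false = z≤n
      go true true = ≤-trans (Sum-mono h λ i _ → bit (βs x i (edge d))) (≤-reflexive (Sum-const h 1))
        where bit : ∀ b → ¬⟦ b ⟧ ≤ 1
              bit true = z≤n
              bit false = ≤-refl

    potential-keeps : ∀ Y → z Y ≡ false → z (op Y) ≡ false → potential τ pos T el B₂ Y → potential (suc τ) pos′ T′ el′ B₂ Y
    potential-keeps Y zY zO pt = axis-step h K (v (lf Y) + v (rt Y)) (v′ (lf Y) + v′ (rt Y)) (v Y + v (op Y)) (v′ Y + v′ (op Y))
      (T Y + A Y) (T′ Y + A′ Y) B₂ κ (on (z (lf Y)) 1 + on (z (rt Y)) 1) pt
      (lateral-step (v (lf Y)) (v (rt Y)) (v′ (lf Y)) (v′ (rt Y)) (on (z (lf Y)) 1) (on (z (rt Y)) 1) (v-step (lf Y)) (v-step (rt Y)))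
      (alive-step (v Y) (v (op Y)) (v′ Y) (v′ (op Y)) (alive Y zY) (alive (op Y) zO))
      (≤-trans (hold Y) (+-monoʳ-≤ (T′ Y + A′ Y) (≤-trans (+-mono-≤ (spare-dead Y (rt Y)) (spare-dead Y (lf Y)))
        (≤-reflexive (trans (+-comm (h * on (z (rt Y)) 1) _) (sym (*-distribˡ-+ h (on (z (lf Y)) 1) _)))))))
      where
      alive : ∀ d → z d ≡ false → v′ d ≡ v d + 1
      alive d zd = trans (sym (+-identityʳ _)) (trans (cong (λ b → v′ d + on b 1) (sym zd)) (v-step d))

    potential-renewed : ∀ Y → z Y ≡ true → potential (suc τ) pos′ T′ el′ B₂ Y
    potential-renewed Y zY = axis-refresh h K H κ R₀ τ (width pos Y) (v′ (lf Y) + v′ (rt Y)) (pos Y) (pos (op Y)) (el Y) (el (op Y))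
      (v′ Y + v′ (op Y)) (T′ Y + A′ Y) B₂ κ-def
      (≤-trans (dead-holds Y zY) (+-monoˡ-≤ H (+-mono-≤ (T≤T′ Y mY) (≤-trans (ahead-step Y) (≤-reflexive (cong (λ b → on b (span pos′ Y (cells (line q⁺ Y (suc (pos Y))))) + A′ Y) mY))))))
      (near-ends (pos (lf Y)) (pos (rt Y)) (el (lf Y)) (el (rt Y)) K _ _ (v′≤1+v (lf Y)) (v′≤1+v (rt Y)) (el≤K (lf Y)) (el≤K (rt Y)))
      (far-ends (pos (lf Y)) (pos (rt Y)) (el (lf Y)) (el (rt Y)) τ R₀ (reach (lf Y)) (reach (rt Y)))
      (extent Y) (el≤K Y) (el≤K (op Y))
      (+-mono-≤ (≤-trans (m≤m+n (pos Y) (el Y)) (v≤v′ Y)) (≤-trans (m≤m+n (pos (op Y)) (el (op Y))) (v≤v′ (op Y))))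
      where
      mY : m Y ≡ false
      mY with status Y
      ... | dead _ _ _ = refl

    op-op : ∀ X → op (op X) ≡ X
    op-op N = refl
    op-op E = refl
    op-op S = refl
    op-op W = refl

    -- A potential is kept while both sides of the axis are alive, and a dead side renews its own.
    -- Which of the two sides holds it can therefore change, hence the disjunction.
    axis′ : ∀ X → potential (suc τ) pos′ T′ el′ B₂ X ⊎ potential (suc τ) pos′ T′ el′ B₂ (op X)
    axis′ X = choose (z X) (z (op X)) refl refl
      where
      choose : ∀ a b → z X ≡ a → z (op X) ≡ b → potential (suc τ) pos′ T′ el′ B₂ X ⊎ potential (suc τ) pos′ T′ el′ B₂ (op X)
      choose true _ p _ = inj₁ (potential-renewed X p)
      choose false true _ q = inj₂ (potential-renewed (op X) q)
      choose false false p q with axis X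
      ... | inj₁ pt = inj₁ (potential-keeps X p q pt)
      ... | inj₂ pt = inj₂ (potential-keeps (op X) q (trans (cong z (op-op X)) p) pt)

    next : State (suc τ)
    next = record
      { pos = pos′ ; T = T′ ; el = el′ ; B₁ = B₁ ; B₂ = B₂
      ; pos-pos = λ d → ≤-trans (pos-pos d) (le d)
      ; fronts = λ d → front′ d (status d) refl
      ; fighters = fighters′ ; progress = progress′ ; axis = axis′
      ; reach = λ d → ≤-trans (v′≤1+v d) (≤-trans (+-monoˡ-≤ 1 (reach d)) (≤-reflexive (+-comm _ 1)))
      ; extent = extent′ }

  initial : State 0
  initial = record
    { pos = λ _ → R₀ ; T = λ _ → 0 ; el = λ _ → 0 ; B₁ = 0 ; B₂ = 0
    ; pos-pos = λ _ → ≤-trans (≤-trans (m≤n+m 1 (9 * K + κ + 2 * H)) (m≤m+n _ _)) (≤-reflexive (sym R₀-def))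
    ; fronts = λ d → inj₁ (refl , record { β = λ _ → inside ; burnt = burnt d ; num = full })
    ; fighters = z≤n
    ; progress = ≤-reflexive (sums h R₀)
    -- The initial box is a square, so its potentials hold without any fighters.
    ; axis = λ _ → inj₁ (≤-trans (scale (1 + K) (≤-trans (m≤m+n _ 0) (m≤m+n _ κ))) (m≤m+n _ _))
    ; reach = λ _ → ≤-reflexive (+-identityʳ R₀)
    ; extent = λ _ → extent-start K R₀ }
    where
    inside : ℤ → Bool
    inside c = ∣ c ∣ ≤ᵇ R₀
    bounded : ∀ c → inside c ≡ true → ∣ c ∣ ≤ R₀
    bounded c e = ≤ᵇ⇒≤ ∣ c ∣ R₀ (subst Bool.T (sym e) _)
    isInside : ∀ c → ∣ c ∣ ≤ R₀ → 1 ≤ ⟦ inside c ⟧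
    isInside c le with ∣ c ∣ ≤ᵇ R₀ | ≤⇒≤ᵇ {∣ c ∣} {R₀} le
    ... | true | _ = ≤-refl
    burnt : ∀ d i → i < h → ∀ c → inside c ≡ true → CB 0 d R₀ c i
    burnt N i i<h c e = [ (λ b → inj₁ (bat b)) , (λ b → inj₂ (bat b)) ]′ (startH (bounded c e) refl i<h)
    burnt E i i<h c e = [ (λ b → inj₁ (bat b)) , (λ b → inj₂ (bat b)) ]′ (startV refl (bounded c e) i<h)
    burnt S i i<h c e = [ (λ b → inj₁ (bat b)) , (λ b → inj₂ (bat b)) ]′ (startH (bounded c e) (∣neg∣ R₀) i<h)
    burnt W i i<h c e = [ (λ b → inj₁ (bat b)) , (λ b → inj₂ (bat b)) ]′ (startV (∣neg∣ R₀) (bounded c e) i<h)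
    full : h * (R₀ + R₀) ≤ Sum h (λ i → rng R₀ R₀ (λ c → ⟦ inside c ⟧)) + 0
    full = ≤-trans (≤-trans (≤-reflexive (sym (Sum-const h (R₀ + R₀)))) (Sum-mono h λ i _ →
      ≤-trans (≤-reflexive (sym (trans (rng-const R₀ R₀ 1) (*-identityʳ _)))) (rng-mono R₀ R₀ λ { (+ k) k< → isInside (+ k) (<⇒≤ k<) ; -[1+ k ] k< → isInside -[1+ k ] k< })))
      (m≤m+n _ 0)
    sums : ∀ h R → 3 * h * 0 + 4 * h * R ≡ h * (R + 0 + (R + 0) + (R + 0) + (R + 0)) + 0
    sums h R = solve (h ∷ R ∷ [])

  settled-state : ∀ {τ} → State τ → Σ (State τ) λ st → (∀ d → Settled st d) × Statuses st
  settled-state st = let (st′ , s) = settle-all st in st′ , s , λ d → classify (s d) (State.fronts st′ d)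

  state-at : ∀ τ → State τ
  state-at zero = initial
  state-at (suc τ) = let (st , s , status) = settled-state (state-at τ) in Next.next st s status

  -- At most one side is dead, so one of the two axes has fire on both its sides; by the extent of
  -- that axis the farther side is at a distance proportional to the time.
  escape : ∀ τ → ∃ λ d → ∃ λ a → ∃ λ c → ∃ λ i → CB τ d a c i × τ ≤ (1 + K) * a + 2 * K
  escape τ = let (st , s , status) = settled-state (state-at τ) in Far.far-fire st s status
    where
    module Far {τ : ℕ} (st : State τ) (settled : ∀ d → Settled st d) (status : Statuses st) where
      open State st
      open Step st settled status
      open Next st settled status using (any-dead)

      alive-burns : ∀ d → z d ≡ false → ∃ λ i → ∃ λ c → CB τ d (pos d) c i
      alive-burns d e with status d
      ... | moving _ a full = let (c , _ , q) = rng-pos _ _ _ (full 0 1≤h) in 0 , c , Active.burnt a 0 1≤h c (true-⟦⟧ q)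
      ... | waiting w _ = Waiting.seen w

      along : ∀ X → z X ≡ false → z (op X) ≡ false → ∃ λ d → ∃ λ a → ∃ λ c → ∃ λ i → CB τ d a c i × τ ≤ (1 + K) * a + 2 * K
      along X p q with ≤-total (pos X) (pos (op X))
      ... | inj₁ le = let (i , c , b) = alive-burns (op X) q in op X , pos (op X) , c , i , b ,
            far-enough K τ R₀ (pos X) (pos (op X)) (el X) (el (op X)) (pos (op X)) (extent X) (el≤K X) (el≤K (op X)) le ≤-refl
      ... | inj₂ le = let (i , c , b) = alive-burns X p in X , pos X , c , i , b ,
            far-enough K τ R₀ (pos X) (pos (op X)) (el X) (el (op X)) (pos X) (extent X) (el≤K X) (el≤K (op X)) ≤-refl le

      other : ∀ d x → z d ≡ true → d ≢ x → z x ≡ false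
      other d x e ne with z x in q
      ... | false = refl
      ... | true = ⊥-elim (ne (one-dead d x e q))

      far-fire : ∃ λ d → ∃ λ a → ∃ λ c → ∃ λ i → CB τ d a c i × τ ≤ (1 + K) * a + 2 * K
      far-fire with any-dead
      ... | inj₂ none = along N (none N) (none S)
      ... | inj₁ (N , e) = along E (other N E e λ ()) (other N W e λ ())
      ... | inj₁ (S , e) = along E (other S E e λ ()) (other S W e λ ())
      ... | inj₁ (E , e) = along N (other E N e λ ()) (other E S e λ ())
      ... | inj₁ (W , e) = along N (other W N e λ ()) (other W S e λ ())

  spreads : ∀ ρ → (∀ τ u v i → B τ u v i → ∣ u ∣ ≤ ρ × ∣ v ∣ ≤ ρ) → ⊥
  spreads ρ confined =
    let (d , a , c , i , b , far) = escape (suc ((1 + K) * ρ + 2 * K))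
    in <-irrefl refl (≤-trans far (+-monoˡ-≤ (2 * K) (scale (1 + K) (short d b))))
    where
    point : ∀ d {τ a c i} → Bat τ d a c i → a ≤ ρ
    point N (bat b) = proj₂ (confined _ _ _ _ b)
    point E (bat b) = proj₁ (confined _ _ _ _ b)
    point S {a = a} (bat b) = ≤-trans (≤-reflexive (sym (∣neg∣ a))) (proj₂ (confined _ _ _ _ b))
    point W {a = a} (bat b) = ≤-trans (≤-reflexive (sym (∣neg∣ a))) (proj₁ (confined _ _ _ _ b))
    short : ∀ d {τ a c i} → CB τ d a c i → a ≤ ρ
    short d = [ point d , point d ]′

-- Rational rates

unnormalise : ∀ n d → toℚᵘ ((+ n) / suc d) ℚᵘ.≃ mkℚᵘ (+ n) d
unnormalise n d = ℚ.toℚᵘ-fromℚᵘ (mkℚᵘ (+ n) d)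

rate-bound : ∀ c n t → (+ c) / 1 ℚ.≤ ((+ n) / 2) ℚ.* ((+ t) / 1) → 2 * c ≤ n * t
rate-bound c n t le with ℚᵘ.≤-respˡ-≃ (unnormalise c 0) (ℚᵘ.≤-respʳ-≃ (ℚᵘ.≃-trans (ℚ.toℚᵘ-homo-* ((+ n) / 2) ((+ t) / 1))
    (ℚᵘ.*-cong (unnormalise n 1) (unnormalise t 0))) (ℚ.toℚᵘ-mono-≤ le))
... | ℚᵘ.*≤* q = subst₂ _≤_ (*-comm c 2) (*-identityʳ (n * t)) (ℤ.drop‿+≤+ (subst₂ ℤ._≤_ l r q))
  where
  l : + c ℤ.* + 2 ≡ + (c * 2)
  l = sym (ℤ.pos-* c 2)
  r : + n ℤ.* + t ℤ.* + 1 ≡ + (n * t * 1)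
  r = trans (cong (ℤ._* + 1) (sym (ℤ.pos-* n t))) (sym (ℤ.pos-* (n * t) 1))

-- A positive ε is at least 1 / d for its denominator d, so this much can be spent.
rate-reached : ∀ ε → ℚ.0ℚ ℚ.< ε → ∃ λ d → ∀ n c t → c * (2 * suc d) ≤ (n * suc d + 2) * t →
  (+ c) / 1 ℚ.≤ (((+ n) / 2) ℚ.+ ε) ℚ.* ((+ t) / 1)
rate-reached (mkℚ (+ zero) d co) (ℚ.*<* (ℤ.+<+ ()))
rate-reached (mkℚ -[1+ a ] d co) (ℚ.*<* ())
rate-reached (mkℚ (+ suc a) d co) pos = d , λ n c t le → ℚ.toℚᵘ-cancel-≤
    (ℚᵘ.≤-respˡ-≃ (ℚᵘ.≃-sym (unnormalise c 0)) (ℚᵘ.≤-respʳ-≃ (ℚᵘ.≃-sym (ℚᵘ.≃-trans (ℚ.toℚᵘ-homo-* (((+ n) / 2) ℚ.+ ε) ((+ t) / 1))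
    (ℚᵘ.*-cong (ℚᵘ.≃-trans (ℚ.toℚᵘ-homo-+ ((+ n) / 2) ε) (ℚᵘ.+-cong (unnormalise n 1) ℚᵘ.≃-refl)) (unnormalise t 0)))) (core n c t le)))
  where
  ε = mkℚ (+ suc a) d co
  core : ∀ n c t → c * (2 * suc d) ≤ (n * suc d + 2) * t →
    mkℚᵘ (+ c) 0 ℚᵘ.≤ (mkℚᵘ (+ n) 1 ℚᵘ.+ mkℚᵘ (+ suc a) d) ℚᵘ.* mkℚᵘ (+ t) 0
  core n c t le = ℚᵘ.*≤* (subst₂ ℤ._≤_ (ℤ.pos-* c (2 * suc d * 1)) r (ℤ.+≤+ (≤-trans (≤-reflexive (cong (c *_) (*-identityʳ (2 * suc d))))
      (≤-trans le (≤-trans (*-monoˡ-≤ t (+-monoʳ-≤ (n * suc d) (m≤m+n 2 _))) (≤-reflexive (sym (*-identityʳ (x * t)))))))))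
    where
    x = n * suc d + suc a * 2
    r : + ((n * suc d + suc a * 2) * t * 1) ≡ (+ n ℤ.* + suc d ℤ.+ + suc a ℤ.* + 2) ℤ.* + t ℤ.* + 1
    r = trans (ℤ.pos-* (x * t) 1) (cong (ℤ._* + 1) (trans (ℤ.pos-* x t) (cong (ℤ._* + t)
      (trans (ℤ.pos-+ (n * suc d) (suc a * 2)) (cong₂ ℤ._+_ (ℤ.pos-* n (suc d)) (ℤ.pos-* (suc a) 2))))))

-- Fighters and fires on the layered graphs

_==ℤ_ : ℤ → ℤ → Bool
(+ a) ==ℤ (+ b) = a ≡ᵇ b
-[1+ a ] ==ℤ -[1+ b ] = a ≡ᵇ b
_ ==ℤ _ = false

==ℤ-refl : ∀ z → (z ==ℤ z) ≡ true
==ℤ-refl (+ n) = ≡ᵇ-refl n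
==ℤ-refl -[1+ n ] = ≡ᵇ-refl n

Sum-point : ∀ n a → Sum n (λ k → ⟦ a ≡ᵇ k ⟧) ≤ 1
Sum-point zero a = z≤n
Sum-point (suc n) a with a ≟ n
... | no a≢n rewrite ≡ᵇ-false a n a≢n = ≤-trans (≤-reflexive (+-identityʳ _)) (Sum-point n a)
... | yes refl rewrite ≡ᵇ-refl a = ≤-reflexive (cong (_+ 1) (n≤0⇒n≡0 (≤-trans (Sum-mono a none) (≤-reflexive (Sum-zero a)))))
  where none : ∀ k → k < a → ⟦ a ≡ᵇ k ⟧ ≤ 0
        none k k<a rewrite ≡ᵇ-false a k (λ e → <⇒≢ k<a (sym e)) = z≤n

opaque
  unfolding rng

  rng-point : ∀ L R z → rng L R (λ c → ⟦ z ==ℤ c ⟧) ≤ 1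
  rng-point L R (+ a) = ≤-trans (+-mono-≤ (Sum-point R a) (≤-reflexive (Sum-zero L))) ≤-refl
  rng-point L R -[1+ a ] = ≤-trans (+-mono-≤ (≤-reflexive (Sum-zero R)) (Sum-point L a)) ≤-refl

*-≤1 : ∀ {a b} → b ≤ 1 → a * b ≤ a
*-≤1 {a} b≤1 = ≤-trans (*-monoʳ-≤ a b≤1) (≤-reflexive (*-identityʳ a))

rng-* : ∀ L R k f → rng L R (λ c → k * f c) ≡ k * rng L R f
rng-* L R zero f = rng-zero L R
rng-* L R (suc k) f = trans (rng-+ L R f (λ c → k * f c)) (cong (_+_ (rng L R f)) (rng-* L R k f))

Sum-* : ∀ n k f → Sum n (λ i → k * f i) ≡ k * Sum n f
Sum-* n zero f = Sum-zero n
Sum-* n (suc k) f = trans (Sum-+ n f (λ c → k * f c)) (cong (_+_ (Sum n f)) (Sum-* n k f))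

sc-suc : ∀ z → sc z ≡ z ℤ.+ ℤ.1ℤ
sc-suc (+ n) = cong +_ (+-comm 1 n)
sc-suc -[1+ zero ] = refl
sc-suc -[1+ suc n ] = refl

pd-pred : ∀ z → pd z ≡ z ℤ.- ℤ.1ℤ
pd-pred (+ zero) = refl
pd-pred (+ suc n) = refl
pd-pred -[1+ n ] = cong (λ k → -[1+ suc k ]) (sym (+-identityʳ n))

Near-abs : ∀ {u v} → Near u v → ∣ v ∣ ≤ suc ∣ u ∣
Near-abs {+ n} up = ≤-refl
Near-abs { -[1+ zero ]} up = z≤n
Near-abs { -[1+ suc n ]} up = m≤n+m _ 2
Near-abs {+ zero} dn = ≤-refl
Near-abs {+ suc n} dn = m≤n+m _ 2
Near-abs { -[1+ n ]} dn = ≤-refl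

ints : ℕ → List ℤ
ints r = map +_ (upTo (suc r)) ++ map -[1+_] (upTo (suc r))

∈-ints : ∀ r z → ∣ z ∣ ≤ r → z ∈ ints r
∈-ints r (+ n) le = ∈-++⁺ˡ (∈-map⁺ +_ (∈-upTo⁺ (s≤s le)))
∈-ints r -[1+ n ] le = ∈-++⁺ʳ (map +_ (upTo (suc r))) (∈-map⁺ -[1+_] (∈-upTo⁺ (s≤s (<⇒≤ le))))

layers : ∀ {h} → (Vtx h → Vtx h → Set) → Graph
layers {h} Adj = record { V = Vtx h ; Adj = Adj }

module Guards {h : ℕ} (φu φv : Vtx h → ℤ) where

  floor : Vtx h → ℕ
  floor (_ , _ , i) = toℕ i

  mark : Vtx h → ℤ → ℤ → ℕ → ℕ
  mark w u v i = ⟦ φv w ==ℤ v ⟧ * (⟦ φu w ==ℤ u ⟧ * ⟦ floor w ≡ᵇ i ⟧)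

  -- Counted with multiplicity, so that the length of the list bounds the sum over any box without
  -- assumptions on repetitions.
  hits : List (Vtx h) → ℤ → ℤ → ℕ → ℕ
  hits [] u v i = 0
  hits (w ∷ L) u v i = mark w u v i + hits L u v i

  hits-++ˡ : ∀ L L′ u v i → hits L u v i ≤ hits (L ++ L′) u v i
  hits-++ˡ [] L′ u v i = z≤n
  hits-++ˡ (w ∷ L) L′ u v i = +-monoʳ-≤ (mark w u v i) (hits-++ˡ L L′ u v i)

  hits-∈ : ∀ {w} L → w ∈ L → 1 ≤ hits L (φu w) (φv w) (floor w)
  hits-∈ {w} (.w ∷ L) (here refl) rewrite ==ℤ-refl (φu w) | ==ℤ-refl (φv w) | ≡ᵇ-refl (floor w) = s≤s z≤n
  hits-∈ (_ ∷ L) (there w∈L) = ≤-trans (hits-∈ L w∈L) (m≤n+m _ _)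

  hits-box : ∀ L pos → Area.box (λ u v → Sum h (hits L u v)) pos ≤ length L
  hits-box [] pos = ≤-reflexive (trans (rng-cong _ _ λ v → trans (rng-cong _ _ λ u → Sum-zero h) (rng-zero _ _)) (rng-zero _ _))
  hits-box (w ∷ L) pos = ≤-trans (≤-reflexive (trans (rng-cong _ _ λ v → trans (rng-cong _ _ λ u → Sum-+ h _ _) (rng-+ _ _ _ _)) (rng-+ _ _ _ _)))
    (+-mono-≤ single (hits-box L pos))
    where
    single : rng (pos S) (suc (pos N)) (λ v → rng (pos W) (suc (pos E)) (λ u → Sum h (mark w u v))) ≤ 1
    single = ≤-trans (rng-mono′ _ _ λ v → ≤-trans (≤-reflexive (trans (rng-cong _ _ λ u → Sum-* h ⟦ φv w ==ℤ v ⟧ _) (rng-* _ _ ⟦ φv w ==ℤ v ⟧ _)))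
      (*-≤1 (≤-trans (rng-mono′ _ _ λ u → ≤-trans (≤-reflexive (Sum-* h ⟦ φu w ==ℤ u ⟧ _)) (*-≤1 (Sum-point h (floor w)))) (rng-point _ _ (φu w)))))
      (rng-point _ _ (φv w))

module Fires {h : ℕ} (Adj : Vtx h → Vtx h → Set) (φu φv : Vtx h → ℤ) (B₀ : List (Vtx h))
  (P : ℕ → List (Vtx h)) where
  open Game (layers Adj) public
  open Guards φu φv public

  guarded : ℕ → List (Vtx h)
  guarded zero = []
  guarded (suc t) = guarded t ++ P (suc t)

  guarded-length : ∀ t → length (guarded t) ≡ count P t
  guarded-length zero = refl
  guarded-length (suc t) = trans (length-++ (guarded t)) (cong (_+ length (P (suc t))) (guarded-length t))

  guarded-∈ : ∀ t {w} → ProtectedBy P t w → w ∈ guarded t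
  guarded-∈ zero (s , 1≤s , s≤0 , _) = ⊥-elim (<-irrefl refl (≤-trans 1≤s s≤0))
  guarded-∈ (suc t) (s , 1≤s , s≤t , w∈) with m≤n⇒m<n∨m≡n s≤t
  ... | inj₁ lt = ∈-++⁺ˡ (guarded-∈ t (s , 1≤s , s≤s⁻¹ lt , w∈))
  ... | inj₂ refl = ∈-++⁺ʳ (guarded t) w∈

  guard : ℕ → ℤ → ℤ → ℕ → ℕ
  guard t = hits (guarded t)

  guard-mono : ∀ t u v i → guard t u v i ≤ guard (suc t) u v i
  guard-mono t u v i = hits-++ˡ (guarded t) (P (suc t)) u v i

  -- Protection is replaced by the positivity of a count, which can be decided; a vanishing count
  -- excludes protection.
  spread-or-guard : ∀ {t w w′} → Burning B₀ P t w → Adj w w′ → Burning B₀ P (suc t) w′ ⊎ 1 ≤ guard (suc t) (φu w′) (φv w′) (floor w′)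
  spread-or-guard {t} {w} {w′} b adj with guard (suc t) (φu w′) (φv w′) (floor w′) in e
  ... | suc n = inj₂ (s≤s z≤n)
  ... | zero = inj₁ (spread b adj λ prot → <-irrefl refl (≤-trans (hits-∈ (guarded (suc t)) (guarded-∈ (suc t) prot)) (≤-reflexive e)))

  settled : ((T , _) : Contains B₀ P) → ∀ t {w} → Burning B₀ P t w → Burning B₀ P T w
  settled c@(T , stop) t {w} b with ≤-total t T
  ... | inj₁ t≤T = subst (λ z → Burning B₀ P z w) (m∸n+n≡m t≤T) (later (T ∸ t))
    where later : ∀ k → Burning B₀ P (k + t) w
          later zero = b
          later (suc k) = stay (later k)
  ... | inj₂ T≤t = back (t ∸ T) (subst (λ z → Burning B₀ P z w) (sym (m∸n+n≡m T≤t)) b)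
    where back : ∀ k → Burning B₀ P (k + T) w → Burning B₀ P T w
          back zero b = b
          back (suc k) b = back k (stop (k + T) (m≤n+m T k) w b)

∣∣-step : ∀ x x′ → ∣ x ℤ.- x′ ∣ ≤ 1 → ∣ x′ ∣ ≤ suc ∣ x ∣
∣∣-step x x′ le = ≤-trans (≤-reflexive (cong ∣_∣ (e x x′))) (≤-trans (ℤ.∣i-j∣≤∣i∣+∣j∣ x (x ℤ.- x′)) (≤-trans (+-monoʳ-≤ ∣ x ∣ le) (≤-reflexive (+-comm ∣ x ∣ 1))))
  where e : ∀ x x′ → x′ ≡ x ℤ.- (x ℤ.- x′)
        e = ℤ-Solver.solve-∀

grid : ∀ h → ℕ → List (Vtx h)
grid h r = cartesianProduct (ints r) (cartesianProduct (ints r) (allFin h))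

∈-grid : ∀ {h} r x y (i : Fin h) → ∣ x ∣ ≤ r → ∣ y ∣ ≤ r → (x , y , i) ∈ grid h r
∈-grid r x y i p q = ∈-cartesianProduct⁺ (∈-ints r x p) (∈-cartesianProduct⁺ (∈-ints r y q) (∈-allFin i))

module Reach {h : ℕ} (Adj : Vtx h → Vtx h → Set) (φu φv : Vtx h → ℤ)
  (local : ∀ {w w′} → Adj w w′ → ∣ φu w ℤ.- φu w′ ∣ ≤ 1 × ∣ φv w ℤ.- φv w′ ∣ ≤ 1) where
  open Game (layers Adj)

  Within : ℕ → Vtx h → Set
  Within r w = ∣ φu w ∣ ≤ r × ∣ φv w ∣ ≤ r

  within-step : ∀ {r w w′} → Adj w w′ → Within r w → Within (suc r) w′
  within-step {r} {w} {w′} adj (p , q) = let (du , dv) = local adj in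
    ≤-trans (∣∣-step (φu w) (φu w′) du) (s≤s p) , ≤-trans (∣∣-step (φv w) (φv w′) dv) (s≤s q)

  radius : ∀ L → ∃ λ r → ∀ {w} → w ∈ L → Within r w
  radius [] = 0 , λ ()
  radius (x ∷ L) = let (r , f) = radius L in ∣ φu x ∣ + ∣ φv x ∣ + r , λ
    { (here refl) → ≤-trans (m≤m+n ∣ φu x ∣ _) (m≤m+n _ r) , ≤-trans (m≤n+m ∣ φv x ∣ ∣ φu x ∣) (m≤m+n _ r)
    ; (there w∈L) → ≤-trans (proj₁ (f w∈L)) (m≤n+m r _) , ≤-trans (proj₂ (f w∈L)) (m≤n+m r _) }

  within : ∀ {B₀ r} → (∀ {w} → w ∈ B₀ → Within r w) → ∀ P {t w} → Burning B₀ P t w → Within (r + t) w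
  within {B₀} {r} base P = go
    where
    go : ∀ {t w} → Burning B₀ P t w → Within (r + t) w
    go (init w∈) = let (p , q) = base w∈ in ≤-trans p (≤-reflexive (sym (+-identityʳ r))) , ≤-trans q (≤-reflexive (sym (+-identityʳ r)))
    go (stay {t} b) = let (p , q) = go b in ≤-trans p (+-monoʳ-≤ r (n≤1+n t)) , ≤-trans q (+-monoʳ-≤ r (n≤1+n t))
    go (spread {t} {u} {w} b adj _) = subst (λ z → Within z w) (sym (+-suc r t)) (within-step adj (go b))

-- Fires that cannot be contained

small : ∀ R k z x y → k ≤ z → z ≤ x + y → x ≤ R → y ≤ R → k ≤ 3 * R + 1
small R k z x y p0 p1 p2 p3 = farkas (1 + R) (+-mono-≤ p0 (+-mono-≤ p1 (+-mono-≤ p2 p3))) (solve (R ∷ k ∷ z ∷ x ∷ y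
  ∷ []))

small′ : ∀ R d k z x y → d ≤ x + k → k ≤ z → z ≤ x + y → x ≤ R → y ≤ R → d ≤ 3 * R
small′ R d k z x y p0 p1 p2 p3 p4 = farkas 0 (+-mono-≤ p0 (+-mono-≤ p1 (+-mono-≤ p2 (+-mono-≤ (scale 2 p3) p4))))
  (solve (R ∷ d ∷ k ∷ z ∷ x ∷ y ∷ []))

small″ : ∀ R k z x y → k ≤ z → z ≤ x + y → x ≤ R → y ≤ R → k + 1 ≤ 3 * R + 1
small″ R k z x y p0 p1 p2 p3 = farkas R (+-mono-≤ p0 (+-mono-≤ p1 (+-mono-≤ p2 p3))) (solve (R ∷ k ∷ z ∷ x ∷ y ∷
  []))

half-budget : ∀ h t τ c b → b ≤ c → 2 * c ≤ 3 * 2 * h * t → t + t ≤ τ → b + b ≤ 3 * h * τ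
half-budget h t τ c b p0 p1 p2 = farkas 0 (+-mono-≤ (scale 2 p0) (+-mono-≤ p1 (scale (3 * h) p2))) (solve (h ∷ t ∷
  τ ∷ c ∷ b ∷ []))

half : ∀ z → ∃ λ k → (z ≡ k ℤ.+ k ⊎ z ≡ sc (k ℤ.+ k)) × ∣ k ∣ ≤ ∣ z ∣
half (+ n) = let (m , e , le) = halfℕ n in + m , [ (λ e → inj₁ (cong +_ e)) , (λ e → inj₂ (cong +_ e)) ]′ e , le
  where
  halfℕ : ∀ n → ∃ λ m → (n ≡ m + m ⊎ n ≡ suc (m + m)) × m ≤ n
  halfℕ zero = 0 , inj₁ refl , z≤n
  halfℕ (suc n) with halfℕ n
  ... | m , inj₁ refl , le = m , inj₂ refl , m≤n⇒m≤1+n le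
  ... | m , inj₂ refl , le = suc m , inj₁ (cong suc (sym (+-suc m m))) , s≤s le
half -[1+ n ] with half (+ n)
... | + m , inj₁ refl , le = -[1+ m ] , inj₂ refl , s≤s le
... | + m , inj₂ refl , le = -[1+ m ] , inj₁ refl , s≤s (≤-trans (m≤m+n m m) (n≤1+n _))
... | -[1+ m ] , inj₁ () , _
... | -[1+ zero ] , inj₂ () , _
... | -[1+ suc m ] , inj₂ () , _

sc≡ : ∀ z → z ℤ.+ ℤ.1ℤ ≡ sc z
sc≡ z = sym (sc-suc z)

pd≡ : ∀ z → z ℤ.- ℤ.1ℤ ≡ pd z
pd≡ z = sym (pd-pred z)

d+ : ∀ x → ∣ x ℤ.- (x ℤ.+ ℤ.1ℤ) ∣ ≡ 1
d+ x = cong ∣_∣ (e x)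
  where e : ∀ x → x ℤ.- (x ℤ.+ ℤ.1ℤ) ≡ ℤ.-1ℤ
        e = ℤ-Solver.solve-∀

d- : ∀ x → ∣ x ℤ.- (x ℤ.- ℤ.1ℤ) ∣ ≡ 1
d- x = cong ∣_∣ (e x)
  where e : ∀ x → x ℤ.- (x ℤ.- ℤ.1ℤ) ≡ ℤ.1ℤ
        e = ℤ-Solver.solve-∀

d0 : ∀ x → ∣ x ℤ.- x ∣ ≡ 0
d0 x = cong ∣_∣ (e x)
  where e : ∀ x → x ℤ.- x ≡ ℤ.0ℤ
        e = ℤ-Solver.solve-∀

floor-move : ∀ {h j} (i : Fin h) (j<h : j < h) → suc (toℕ i) ≡ j ⊎ suc j ≡ toℕ i → PathAdj i (fromℕ< j<h)
floor-move i j<h (inj₁ e) = inj₁ (trans e (sym (Fin.toℕ-fromℕ< j<h)))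
floor-move i j<h (inj₂ e) = inj₂ (trans (cong suc (Fin.toℕ-fromℕ< j<h)) e)

floor-dist : ∀ (x : ℤ) → ∣ x ℤ.- x ∣ ≤ 1
floor-dist x = ≤-trans (≤-reflexive (d0 x)) z≤n

module Cartesian (h : ℕ) (1≤h : 1 ≤ h) where

  R : ℕ
  R = Constants.R₀ h

  Adj₁ : Vtx h → Vtx h → Set
  Adj₁ = Graph.Adj (G₁ h)

  -- The lines of the diagonal grid are the diagonals x + y = u and x - y = v.
  φu φv : Vtx h → ℤ
  φu (x , y , _) = x ℤ.+ y
  φv (x , y , _) = x ℤ.- y

  local₁ : ∀ {w w′} → Adj₁ w w′ → ∣ φu w ℤ.- φu w′ ∣ ≤ 1 × ∣ φv w ℤ.- φv w′ ∣ ≤ 1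
  local₁ {x , y , _} {x′ , y′ , _} (inj₁ (_ , e)) =
      ≤-trans (≤-reflexive (cong ∣_∣ (eu x y x′ y′))) (≤-trans (ℤ.∣i+j∣≤∣i∣+∣j∣ (x ℤ.- x′) (y ℤ.- y′)) (≤-reflexive e)) ,
      ≤-trans (≤-reflexive (cong ∣_∣ (ev x y x′ y′))) (≤-trans (ℤ.∣i-j∣≤∣i∣+∣j∣ (x ℤ.- x′) (y ℤ.- y′)) (≤-reflexive e))
    where eu : ∀ x y x′ y′ → x ℤ.+ y ℤ.- (x′ ℤ.+ y′) ≡ x ℤ.- x′ ℤ.+ (y ℤ.- y′)
          eu = ℤ-Solver.solve-∀
          ev : ∀ x y x′ y′ → x ℤ.- y ℤ.- (x′ ℤ.- y′) ≡ x ℤ.- x′ ℤ.- (y ℤ.- y′)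
          ev = ℤ-Solver.solve-∀
  local₁ {x , y , _} (inj₂ (refl , refl , _)) = floor-dist (x ℤ.+ y) , floor-dist (x ℤ.- y)

  open Reach Adj₁ φu φv (λ {w} {w′} → local₁ {w} {w′}) public

  B₀ : List (Vtx h)
  -- The first coordinate is half of u + v, crudely at most 2 R, and the second is u minus that;
  -- rounding adds one.
  B₀ = grid h (3 * R + 1)

  module _ (P : ℕ → List (Vtx h)) (legal : Game.Legal (G₁ h) (Game.linear (G₁ h) ((+ (3 * 1 * h)) / 2)) B₀ P) where
    open Fires Adj₁ φu φv B₀ P

    At : ℕ → ℤ → ℤ → ℕ → Set
    At τ u v i = ∃ λ w → φu w ≡ u × φv w ≡ v × floor w ≡ i × Burning B₀ P τ w

    emit : ∀ {τ u v i} w w′ → φu w′ ≡ u → φv w′ ≡ v → floor w′ ≡ i → Burning B₀ P τ w → Adj₁ w w′ → At (suc τ) u v i ⊎ 1 ≤ guard (suc τ) u v i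
    emit w w′ refl refl refl b adj = map₁ (λ b′ → w′ , refl , refl , refl , b′) (spread-or-guard {w = w} b adj)

    diag′ : ∀ {τ u v u′ v′ i} → i < h → Near u u′ → Near v v′ → At τ u v i → At (suc τ) u′ v′ i ⊎ 1 ≤ guard (suc τ) u′ v′ i
    diag′ _ up up (w@(x , y , i) , refl , refl , refl , b) = emit w (x ℤ.+ ℤ.1ℤ , y , i)
        (trans (e x y) (sc≡ _)) (trans (f x y) (sc≡ _)) refl b (inj₁ (refl , cong₂ _+_ (d+ x) (d0 y)))
      where e : ∀ x y → x ℤ.+ ℤ.1ℤ ℤ.+ y ≡ x ℤ.+ y ℤ.+ ℤ.1ℤ
            e = ℤ-Solver.solve-∀
            f : ∀ x y → x ℤ.+ ℤ.1ℤ ℤ.- y ≡ x ℤ.- y ℤ.+ ℤ.1ℤ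
            f = ℤ-Solver.solve-∀
    diag′ _ up dn (w@(x , y , i) , refl , refl , refl , b) = emit w (x , y ℤ.+ ℤ.1ℤ , i)
        (trans (e x y) (sc≡ _)) (trans (f x y) (pd≡ _)) refl b (inj₁ (refl , cong₂ _+_ (d0 x) (d+ y)))
      where e : ∀ x y → x ℤ.+ (y ℤ.+ ℤ.1ℤ) ≡ x ℤ.+ y ℤ.+ ℤ.1ℤ
            e = ℤ-Solver.solve-∀
            f : ∀ x y → x ℤ.- (y ℤ.+ ℤ.1ℤ) ≡ x ℤ.- y ℤ.- ℤ.1ℤ
            f = ℤ-Solver.solve-∀
    diag′ _ dn up (w@(x , y , i) , refl , refl , refl , b) = emit w (x , y ℤ.- ℤ.1ℤ , i)
        (trans (e x y) (pd≡ _)) (trans (f x y) (sc≡ _)) refl b (inj₁ (refl , cong₂ _+_ (d0 x) (d- y)))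
      where e : ∀ x y → x ℤ.+ (y ℤ.- ℤ.1ℤ) ≡ x ℤ.+ y ℤ.- ℤ.1ℤ
            e = ℤ-Solver.solve-∀
            f : ∀ x y → x ℤ.- (y ℤ.- ℤ.1ℤ) ≡ x ℤ.- y ℤ.+ ℤ.1ℤ
            f = ℤ-Solver.solve-∀
    diag′ _ dn dn (w@(x , y , i) , refl , refl , refl , b) = emit w (x ℤ.- ℤ.1ℤ , y , i)
        (trans (e x y) (pd≡ _)) (trans (f x y) (pd≡ _)) refl b (inj₁ (refl , cong₂ _+_ (d- x) (d0 y)))
      where e : ∀ x y → x ℤ.- ℤ.1ℤ ℤ.+ y ≡ x ℤ.+ y ℤ.- ℤ.1ℤ
            e = ℤ-Solver.solve-∀
            f : ∀ x y → x ℤ.- ℤ.1ℤ ℤ.- y ≡ x ℤ.- y ℤ.- ℤ.1ℤ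
            f = ℤ-Solver.solve-∀

    -- The point (u , v) is a vertex exactly when u + v is even; otherwise its neighbour in either
    -- coordinate is one.
    start′ : ∀ {u v i} → ∣ u ∣ ≤ R → ∣ v ∣ ≤ R → i < h → (At 0 u v i ⊎ At 0 (sc u) v i) × (At 0 u v i ⊎ At 0 u (sc v) i)
    start′ {u} {v} {i} ∣u∣ ∣v∣ i<h with half (u ℤ.+ v)
    ... | k , inj₁ e , le = inj₁ here′ , inj₁ here′
      where
      here′ : At 0 u v i
      here′ = (k , u ℤ.- k , fromℕ< i<h) , e₁ u k , trans (e₂ u k) (trans (cong (ℤ._- u) (sym e)) (e₃ u v)) , Fin.toℕ-fromℕ< i<h ,
        init (∈-grid (3 * R + 1) k (u ℤ.- k) _ (small R _ _ _ _ le (ℤ.∣i+j∣≤∣i∣+∣j∣ u v) ∣u∣ ∣v∣)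
          (≤-trans (small′ R _ _ _ _ _ (ℤ.∣i-j∣≤∣i∣+∣j∣ u k) le (ℤ.∣i+j∣≤∣i∣+∣j∣ u v) ∣u∣ ∣v∣) (m≤m+n _ 1)))
        where
        e₁ : ∀ u k → k ℤ.+ (u ℤ.- k) ≡ u
        e₁ = ℤ-Solver.solve-∀
        e₂ : ∀ u k → k ℤ.- (u ℤ.- k) ≡ k ℤ.+ k ℤ.- u
        e₂ = ℤ-Solver.solve-∀
        e₃ : ∀ u v → u ℤ.+ v ℤ.- u ≡ v
        e₃ = ℤ-Solver.solve-∀
    ... | k , inj₂ e , le = inj₂ right , inj₂ above
      where
      e′ : u ℤ.+ v ≡ k ℤ.+ k ℤ.+ ℤ.1ℤ
      e′ = trans e (sc-suc _)
      k≤ : ∣ k ℤ.+ ℤ.1ℤ ∣ ≤ 3 * R + 1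
      k≤ = ≤-trans (ℤ.∣i+j∣≤∣i∣+∣j∣ k ℤ.1ℤ) (small″ R _ _ _ _ le (ℤ.∣i+j∣≤∣i∣+∣j∣ u v) ∣u∣ ∣v∣)
      right : At 0 (sc u) v i
      right = (k ℤ.+ ℤ.1ℤ , u ℤ.- k , fromℕ< i<h) , trans (e₁ u k) (sc≡ u) , trans (e₂ u k) (trans (cong (ℤ._- u) (sym e′)) (e₃ u v)) , Fin.toℕ-fromℕ< i<h ,
        init (∈-grid (3 * R + 1) _ (u ℤ.- k) _ k≤
          (≤-trans (small′ R _ _ _ _ _ (ℤ.∣i-j∣≤∣i∣+∣j∣ u k) le (ℤ.∣i+j∣≤∣i∣+∣j∣ u v) ∣u∣ ∣v∣) (m≤m+n _ 1)))
        where
        e₁ : ∀ u k → k ℤ.+ ℤ.1ℤ ℤ.+ (u ℤ.- k) ≡ u ℤ.+ ℤ.1ℤ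
        e₁ = ℤ-Solver.solve-∀
        e₂ : ∀ u k → k ℤ.+ ℤ.1ℤ ℤ.- (u ℤ.- k) ≡ k ℤ.+ k ℤ.+ ℤ.1ℤ ℤ.- u
        e₂ = ℤ-Solver.solve-∀
        e₃ : ∀ u v → u ℤ.+ v ℤ.- u ≡ v
        e₃ = ℤ-Solver.solve-∀
      above : At 0 u (sc v) i
      above = (k ℤ.+ ℤ.1ℤ , u ℤ.- k ℤ.- ℤ.1ℤ , fromℕ< i<h) , e₁ u k , trans (e₂ u k) (trans (cong (λ z → z ℤ.- u ℤ.+ ℤ.1ℤ) (sym e′)) (trans (e₃ u v) (sc≡ v))) , Fin.toℕ-fromℕ< i<h ,
        init (∈-grid (3 * R + 1) _ (u ℤ.- k ℤ.- ℤ.1ℤ) _ k≤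
          (≤-trans (ℤ.∣i-j∣≤∣i∣+∣j∣ (u ℤ.- k) ℤ.1ℤ)
            (+-monoˡ-≤ 1 (small′ R _ _ _ _ _ (ℤ.∣i-j∣≤∣i∣+∣j∣ u k) le (ℤ.∣i+j∣≤∣i∣+∣j∣ u v) ∣u∣ ∣v∣))))
        where
        e₁ : ∀ u k → k ℤ.+ ℤ.1ℤ ℤ.+ (u ℤ.- k ℤ.- ℤ.1ℤ) ≡ u
        e₁ = ℤ-Solver.solve-∀
        e₂ : ∀ u k → k ℤ.+ ℤ.1ℤ ℤ.- (u ℤ.- k ℤ.- ℤ.1ℤ) ≡ k ℤ.+ k ℤ.+ ℤ.1ℤ ℤ.- u ℤ.+ ℤ.1ℤ
        e₂ = ℤ-Solver.solve-∀
        e₃ : ∀ u v → u ℤ.+ v ℤ.- u ℤ.+ ℤ.1ℤ ≡ v ℤ.+ ℤ.1ℤ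
        e₃ = ℤ-Solver.solve-∀

    model : Model h R
    model = record
      { B = At
      ; p = guard
      ; B-mono = λ { (w , eu , ev , ei , b) → w , eu , ev , ei , stay b }
      ; p-mono = λ {τ} {u} {v} {i} → guard-mono τ u v i
      ; diag = diag′
      ; vert = λ { {τ} {u} {v} {i} {j} _ j<h adj (w@(x , y , k) , refl , refl , refl , b) →
          [ (λ { (w′ , eu , ev , ei , b′) → inj₁ (w′ , eu , ev , ei , stay b′) }) , (λ g → inj₂ (≤-trans g (guard-mono (suc τ) u v j))) ]′
            (emit w (x , y , fromℕ< j<h) refl refl (Fin.toℕ-fromℕ< j<h) b (inj₂ (refl , refl , floor-move k j<h adj))) }
      ; startH = λ p q i<h → proj₁ (start′ p (≤-reflexive q) i<h)
      ; startV = λ p q i<h → proj₂ (start′ (≤-reflexive p) q i<h)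
      ; budget = λ τ pos → ≤-trans (≤-trans (+-mono-≤ (hits-box (guarded τ) pos) (hits-box (guarded τ) pos))
          (≤-reflexive (trans (cong (λ z → z + z) (guarded-length τ)) (cong (_+_ (count P τ)) (sym (+-identityʳ _))))))
          (rate-bound (count P τ) (3 * 1 * h) τ (proj₂ legal τ)) }

    uncontained : ¬ Contains B₀ P
    uncontained c@(T , _) = Play′.spreads h 1≤h model (proj₁ (radius B₀) + T) λ { τ _ _ i (w , refl , refl , refl , b) →
      within (proj₂ (radius B₀)) P (settled c τ b) }

  uncontainable : Σ (List (Vtx h)) λ B₀ → ¬ (Σ (Game.Strategy (G₁ h)) λ P →
    Game.Legal (G₁ h) (Game.linear (G₁ h) ((+ (3 * 1 * h)) / 2)) B₀ P × Game.Contains (G₁ h) B₀ P)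
  uncontainable = B₀ , λ { (P , legal , contains) → uncontained P legal contains }

even-sc : ∀ z → even ∣ sc z ∣ ≡ not (even ∣ z ∣)
even-sc (+ n) = refl
even-sc -[1+ zero ] = refl
even-sc -[1+ suc n ] = sym (not-involutive _)

even-pd : ∀ z → even ∣ pd z ∣ ≡ not (even ∣ z ∣)
even-pd (+ zero) = refl
even-pd (+ suc n) = sym (not-involutive _)
even-pd -[1+ n ] = refl

even-twice : ∀ z → even ∣ z ℤ.+ z ∣ ≡ true
even-twice (+ n) = trans (cong even (sym (+-identityʳ (n + n)))) (even-double n 0)
even-twice -[1+ n ] = trans (not-involutive _) (trans (cong even (sym (+-identityʳ (n + n)))) (even-double n 0))

near-odd : ∀ x {u} → Near (x ℤ.+ x) u → even ∣ u ∣ ≢ true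
near-odd x up e with trans (sym e) (trans (even-sc (x ℤ.+ x)) (cong not (even-twice x)))
... | ()
near-odd x dn e with trans (sym e) (trans (even-pd (x ℤ.+ x)) (cong not (even-twice x)))
... | ()

near-twice : ∀ x {u u′} → Near (x ℤ.+ x) u → Near u u′ → ∃ λ x′ → x′ ℤ.+ x′ ≡ u′ × (x′ ≡ x ⊎ ∣ x ℤ.- x′ ∣ ≡ 1)
near-twice x up up = x ℤ.+ ℤ.1ℤ , trans (e x) (trans (cong (ℤ._+ ℤ.1ℤ) (sc≡ (x ℤ.+ x))) (sc≡ _)) , inj₂ (d+ x)
  where e : ∀ x → x ℤ.+ ℤ.1ℤ ℤ.+ (x ℤ.+ ℤ.1ℤ) ≡ x ℤ.+ x ℤ.+ ℤ.1ℤ ℤ.+ ℤ.1ℤ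
        e = ℤ-Solver.solve-∀
near-twice x up dn = x , sym (pd-sc _) , inj₁ refl
near-twice x dn up = x , sym (sc-pd _) , inj₁ refl
near-twice x dn dn = x ℤ.- ℤ.1ℤ , trans (e x) (trans (cong (ℤ._- ℤ.1ℤ) (pd≡ (x ℤ.+ x))) (pd≡ _)) , inj₂ (d- x)
  where e : ∀ x → x ℤ.- ℤ.1ℤ ℤ.+ (x ℤ.- ℤ.1ℤ) ≡ x ℤ.+ x ℤ.- ℤ.1ℤ ℤ.- ℤ.1ℤ
        e = ℤ-Solver.solve-∀

half-step : ∀ n → ⌊ suc n /2⌋ ≡ ⌊ n /2⌋ ⊎ ⌊ suc n /2⌋ ≡ suc ⌊ n /2⌋
half-step zero = inj₁ refl
half-step (suc zero) = inj₂ refl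
half-step (suc (suc n)) = [ (λ e → inj₁ (cong suc e)) , (λ e → inj₂ (cong suc e)) ]′ (half-step n)

-- A king move takes two diagonal half steps on the doubled grid: the vertex (x , y) becomes the point (2x , 2y) and
-- the points with odd coordinates are intermediate ones, which cannot be protected.
module Strong (h : ℕ) (1≤h : 1 ≤ h) where

  R : ℕ
  R = Constants.R₀ h

  Adj₂ : Vtx h → Vtx h → Set
  Adj₂ = Graph.Adj (G₂ h)

  column row : Vtx h → ℤ
  column (x , _ , _) = x
  row (_ , y , _) = y

  local₂ : ∀ {w w′} → Adj₂ w w′ → ∣ column w ℤ.- column w′ ∣ ≤ 1 × ∣ row w ℤ.- row w′ ∣ ≤ 1
  local₂ (inj₁ (_ , e)) = ≤-trans (m≤m⊔n _ _) (≤-reflexive e) , ≤-trans (m≤n⊔m _ _) (≤-reflexive e)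
  local₂ {x , y , _} (inj₂ (refl , refl , _)) = floor-dist x , floor-dist y

  open Reach Adj₂ column row (λ {w} {w′} → local₂ {w} {w′}) public

  φu φv : Vtx h → ℤ
  φu (x , y , _) = x ℤ.+ x
  φv (x , y , _) = y ℤ.+ y

  B₀ : List (Vtx h)
  B₀ = grid h (R + 1)

  module _ (P : ℕ → List (Vtx h)) (legal : Game.Legal (G₂ h) (Game.linear (G₂ h) ((+ (3 * 2 * h)) / 2)) B₀ P) where
    open Fires Adj₂ φu φv B₀ P

    -- An intermediate point needs a vertex that burned one half step earlier, so there are none at
    -- time 0.
    Before : ℕ → Vtx h → Set
    Before zero w = ⊥
    Before (suc τ) w = Burning B₀ P ⌊ τ /2⌋ w

    Real Ghost At : ℕ → ℤ → ℤ → ℕ → Set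
    Real τ u v i = ∃ λ w → φu w ≡ u × φv w ≡ v × floor w ≡ i × Burning B₀ P ⌊ τ /2⌋ w
    Ghost τ u v i = ∃ λ w → Near (φu w) u × Near (φv w) v × floor w ≡ i × Before τ w
    At τ u v i = Real τ u v i ⊎ Ghost τ u v i

    burning-mono : ∀ τ {w} → Burning B₀ P ⌊ τ /2⌋ w → Burning B₀ P ⌊ suc τ /2⌋ w
    burning-mono τ {w} b = [ (λ e → subst (λ t → Burning B₀ P t w) (sym e) b) , (λ e → subst (λ t → Burning B₀ P t w) (sym e) (stay b)) ]′ (half-step τ)

    guard-half-mono : ∀ τ u v i → guard ⌊ τ /2⌋ u v i ≤ guard ⌊ suc τ /2⌋ u v i
    guard-half-mono τ u v i = [ (λ e → ≤-reflexive (cong (λ t → guard t u v i) (sym e))) ,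
      (λ e → ≤-trans (guard-mono ⌊ τ /2⌋ u v i) (≤-reflexive (cong (λ t → guard t u v i) (sym e)))) ]′ (half-step τ)

    At-mono : ∀ {τ u v i} → At τ u v i → At (suc τ) u v i
    At-mono {τ} (inj₁ (w , eu , ev , ei , b)) = inj₁ (w , eu , ev , ei , burning-mono τ b)
    At-mono {suc τ} (inj₂ (w , nu , nv , ei , b)) = inj₂ (w , nu , nv , ei , burning-mono τ b)

    emit : ∀ {τ u v i} w w′ → φu w′ ≡ u → φv w′ ≡ v → floor w′ ≡ i → Burning B₀ P ⌊ τ /2⌋ w → Adj₂ w w′ →
      At (2 + τ) u v i ⊎ 1 ≤ guard ⌊ 2 + τ /2⌋ u v i
    emit w w′ refl refl refl b adj = map₁ (λ b′ → inj₁ (w′ , refl , refl , refl , b′)) (spread-or-guard {w = w} b adj)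

    diag′ : ∀ {τ u v u′ v′ i} → i < h → Near u u′ → Near v v′ → At τ u v i → At (suc τ) u′ v′ i ⊎ 1 ≤ guard ⌊ suc τ /2⌋ u′ v′ i
    diag′ {τ} _ nu nv (inj₁ (w , refl , refl , ei , b)) = inj₁ (inj₂ (w , nu , nv , ei , b))
    diag′ {suc τ} _ nu nv (inj₂ (w@(x , y , k) , nx , ny , refl , b)) with near-twice x nx nu | near-twice y ny nv
    -- The two half steps cancel and lead back to the burning vertex itself.
    ... | x′ , ex , inj₁ refl | y′ , ey , inj₁ refl = inj₁ (inj₁ (w , ex , ey , refl , stay b))
    ... | x′ , ex , inj₁ refl | y′ , ey , inj₂ dy = emit {τ} w (x′ , y′ , k) ex ey refl b (inj₁ (refl , cong₂ _⊔_ (d0 x) dy))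
    ... | x′ , ex , inj₂ dx | y′ , ey , inj₁ refl = emit {τ} w (x′ , y′ , k) ex ey refl b (inj₁ (refl , cong₂ _⊔_ dx (d0 y)))
    ... | x′ , ex , inj₂ dx | y′ , ey , inj₂ dy = emit {τ} w (x′ , y′ , k) ex ey refl b (inj₁ (refl , cong₂ _⊔_ dx dy))

    vert′ : ∀ {τ u v i j} → even ∣ u ∣ ≡ true ⊎ even ∣ v ∣ ≡ true → j < h → suc i ≡ j ⊎ suc j ≡ i →
      At τ u v i → At (2 + τ) u v j ⊎ 1 ≤ guard ⌊ 2 + τ /2⌋ u v j
    vert′ {τ} _ j<h adj (inj₁ (w@(x , y , k) , eu , ev , refl , b)) =
      emit {τ} w (x , y , fromℕ< j<h) eu ev (Fin.toℕ-fromℕ< j<h) b (inj₂ (refl , refl , floor-move k j<h adj))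
    vert′ (inj₁ e) _ _ (inj₂ ((x , y , k) , nx , ny , _)) = ⊥-elim (near-odd x nx e)
    vert′ (inj₂ e) _ _ (inj₂ ((x , y , k) , nx , ny , _)) = ⊥-elim (near-odd y ny e)

    even-R : even R ≡ true
    even-R = trans (cong even (trans (Constants.R₀-def h) (e n))) (even-double n 0)
      where n = 9 * Constants.K h + Constants.κ h + 2 * Constants.H h + 1
            e : ∀ n → 2 * n ≡ n + n + 0
            e n = solve (n ∷ [])

    even-half : ∀ z → ∣ z ∣ ≡ R → ∃ λ k → k ℤ.+ k ≡ z × ∣ k ∣ ≤ R + 1
    even-half z e with half z
    ... | k , inj₁ q , le = k , sym q , ≤-trans le (≤-trans (≤-reflexive e) (m≤m+n R 1))
    ... | k , inj₂ q , le with trans (sym even-R) (trans (cong even (sym e)) (trans (cong (λ y → even ∣ y ∣) q) (trans (even-sc (k ℤ.+ k)) (cong not (even-twice k)))))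
    ...   | ()

    any-half : ∀ z → ∣ z ∣ ≤ R → ∃ λ k → (k ℤ.+ k ≡ z ⊎ k ℤ.+ k ≡ sc z) × ∣ k ∣ ≤ R + 1
    any-half z le′ with half z
    ... | k , inj₁ q , le = k , inj₁ (sym q) , ≤-trans le (≤-trans le′ (m≤m+n R 1))
    ... | k , inj₂ q , le = k ℤ.+ ℤ.1ℤ , inj₂ (trans (e k) (trans (cong (ℤ._+ ℤ.1ℤ) (trans (sc≡ (k ℤ.+ k)) (sym q))) (sc≡ z))) ,
        ≤-trans (ℤ.∣i+j∣≤∣i∣+∣j∣ k ℤ.1ℤ) (+-monoˡ-≤ 1 (≤-trans le le′))
      where e : ∀ k → k ℤ.+ ℤ.1ℤ ℤ.+ (k ℤ.+ ℤ.1ℤ) ≡ k ℤ.+ k ℤ.+ ℤ.1ℤ ℤ.+ ℤ.1ℤ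
            e = ℤ-Solver.solve-∀

    born : ∀ {i} x y → (i<h : i < h) → ∣ x ∣ ≤ R + 1 → ∣ y ∣ ≤ R + 1 → ∀ {u v} → x ℤ.+ x ≡ u → y ℤ.+ y ≡ v → At 0 u v i
    born x y i<h p q eu ev = inj₁ ((x , y , fromℕ< i<h) , eu , ev , Fin.toℕ-fromℕ< i<h , init (∈-grid (R + 1) x y _ p q))

    startH′ : ∀ {u v i} → ∣ u ∣ ≤ R → ∣ v ∣ ≡ R → i < h → At 0 u v i ⊎ At 0 (sc u) v i
    startH′ {u} {v} ∣u∣ ∣v∣ i<h with any-half u ∣u∣ | even-half v ∣v∣
    ... | x , inj₁ ex , p | y , ey , q = inj₁ (born x y i<h p q ex ey)
    ... | x , inj₂ ex , p | y , ey , q = inj₂ (born x y i<h p q ex ey)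

    startV′ : ∀ {u v i} → ∣ u ∣ ≡ R → ∣ v ∣ ≤ R → i < h → At 0 u v i ⊎ At 0 u (sc v) i
    startV′ {u} {v} ∣u∣ ∣v∣ i<h with even-half u ∣u∣ | any-half v ∣v∣
    ... | x , ex , p | y , inj₁ ey , q = inj₁ (born x y i<h p q ex ey)
    ... | x , ex , p | y , inj₂ ey , q = inj₂ (born x y i<h p q ex ey)

    model : Model h R
    model = record
      { B = At
      ; p = λ τ → guard ⌊ τ /2⌋
      ; B-mono = At-mono
      ; p-mono = λ {τ} {u} {v} {i} → guard-half-mono τ u v i
      ; diag = diag′
      ; vert = vert′
      ; startH = startH′
      ; startV = startV′
      ; budget = λ τ pos → half-budget h ⌊ τ /2⌋ τ (count P ⌊ τ /2⌋) _
          (≤-trans (hits-box (guarded ⌊ τ /2⌋) pos) (≤-reflexive (guarded-length ⌊ τ /2⌋)))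
          (rate-bound (count P ⌊ τ /2⌋) (3 * 2 * h) ⌊ τ /2⌋ (proj₂ legal ⌊ τ /2⌋))
          (≤-trans (+-monoʳ-≤ ⌊ τ /2⌋ (⌊n/2⌋≤⌈n/2⌉ τ)) (≤-reflexive (⌊n/2⌋+⌈n/2⌉≡n τ))) }

    uncontained : ¬ Contains B₀ P
    uncontained c@(T , _) = Play′.spreads h 1≤h model (suc (r + T + (r + T))) λ
      { τ _ _ i (inj₁ (w , refl , refl , refl , b)) → let (p , q) = double (settled c ⌊ τ /2⌋ b) in m≤n⇒m≤1+n p , m≤n⇒m≤1+n q
      ; (suc τ) u v i (inj₂ (w , nu , nv , refl , b)) → let (p , q) = double (settled c ⌊ τ /2⌋ b) in
          ≤-trans (Near-abs nu) (s≤s p) , ≤-trans (Near-abs nv) (s≤s q) }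
      where
      r = proj₁ (radius B₀)
      double : ∀ {w} → Burning B₀ P T w → ∣ φu w ∣ ≤ r + T + (r + T) × ∣ φv w ∣ ≤ r + T + (r + T)
      double {x , y , _} b = let (p , q) = within (proj₂ (radius B₀)) P b in
        ≤-trans (ℤ.∣i+j∣≤∣i∣+∣j∣ x x) (+-mono-≤ p p) , ≤-trans (ℤ.∣i+j∣≤∣i∣+∣j∣ y y) (+-mono-≤ q q)

  uncontainable : Σ (List (Vtx h)) λ B₀ → ¬ (Σ (Game.Strategy (G₂ h)) λ P →
    Game.Legal (G₂ h) (Game.linear (G₂ h) ((+ (3 * 2 * h)) / 2)) B₀ P × Game.Contains (G₂ h) B₀ P)
  uncontainable = B₀ , λ { (P , legal , contains) → uncontained P legal contains }

-- Fires that can be contained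

pair-sum : ∀ s q n x y → s + s ≤ q * (1 + n) → x + y ≤ q → s + x + y + (s + x + y) ≤ q * (3 + n)
pair-sum s q n x y p0 p1 = farkas 0 (+-mono-≤ p0 (scale 2 p1)) (solve (s ∷ q ∷ n ∷ x ∷ y ∷ []))

two-halves : ∀ r l q x y → r + r ≤ q * (1 + (1 + y)) → l + l ≤ q * (1 + x) → 2 * (r + l) ≤ q * (x + y + 3)
two-halves r l q x y p0 p1 = farkas 0 (+-mono-≤ p0 p1) (solve (r ∷ l ∷ q ∷ x ∷ y ∷ []))

phase₁ : ∀ M q b t ρ → ρ ≡ b + t → 2 * b + 3 ≤ t → M * (q * (ρ + ρ + 3)) ≤ (3 * q * M + 2) * t
phase₁ M q b t ρ p0 p1 = farkas (2 * t) (+-mono-≤ (scale (M * q * 2) (≤-reflexive p0)) (scale (M * q) p1)) (solve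
  (M ∷ q ∷ b ∷ t ∷ ρ ∷ []))

phase₂ : ∀ M q b t ρ aS aE → ρ ≡ b + t → M * q * (3 * b + aS + 6) ≤ t → aE ≤ ρ →
  M * (q * (ρ + aE + 3) + q * (aS + ρ + 3)) ≤ (3 * q * M + 2) * t
phase₂ M q b t ρ aS aE p0 p1 p2 = farkas t (+-mono-≤ (scale (3 * M * q) (≤-reflexive p0)) (+-mono-≤ p1 (scale (M *
  q) p2))) (solve (M ∷ q ∷ b ∷ t ∷ ρ ∷ aS ∷ aE ∷ []))

phase₃ : ∀ M q b t ρ aS aE aW → ρ ≡ b + t → M * q * (3 * b + aE + 2 * aS + 9) ≤ t → aW ≤ ρ →
  M * (q * (aW + aE + 3) + q * (aS + ρ + 3) + q * (aS + ρ + 3)) ≤ (3 * q * M + 2) * t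
phase₃ M q b t ρ aS aE aW p0 p1 p2 = farkas t (+-mono-≤ (scale (3 * M * q) (≤-reflexive p0)) (+-mono-≤ p1 (scale (M
  * q) p2))) (solve (M ∷ q ∷ b ∷ t ∷ ρ ∷ aS ∷ aE ∷ aW ∷ []))

phase₄ : ∀ M q b t ρ aS aE aW aN → ρ ≡ b + t → aN ≡ 2 * aW + 2 * aE + 2 * aS + 12 + 3 * b → aN ≤ ρ →
  M * (q * (aW + aE + 3) + q * (aS + aN + 3) + q * (aS + aN + 3) + q * (aW + aE + 3)) ≤ (3 * q * M + 2) * t
phase₄ M q b t ρ aS aE aW aN p0 p1 p2 = farkas (2 * t) (+-mono-≤ (scale (3 * M * q) (≤-reflexive p0)) (+-mono-≤
  (scale (M * q) (≤-reflexive (sym p1))) (scale (3 * M * q) p2))) (solve (M ∷ q ∷ b ∷ t ∷ ρ ∷ aS ∷ aE ∷ aW ∷ aN ∷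
  []))

last-side : ∀ w n e s b → n ≡ 2 * w + 2 * e + 2 * s + 12 + 3 * b → w ≤ n
last-side w n e s b p0 = farkas (12 + 3 * b + 2 * e + 2 * s + w) (≤-reflexive (sym p0)) (solve (w ∷ n ∷ e ∷ s ∷ b ∷
  []))

first-side : ∀ b s → s ≡ b + (2 * b + 3) → b < s
first-side b s p0 = farkas (2 + 2 * b) (≤-reflexive (sym p0)) (solve (b ∷ s ∷ []))

Sum-cut : ∀ n x f g → (∀ k → k < x → f k ≤ g k) → (∀ k → x ≤ k → k < n → f k ≡ 0) → Sum n f ≤ Sum x g
Sum-cut zero x f g le none = z≤n
Sum-cut (suc n) x f g le none with x ≤? n
... | yes x≤n rewrite none n x≤n ≤-refl = ≤-trans (≤-reflexive (+-identityʳ _)) (Sum-cut n x f g le (λ k p q → none k p (m≤n⇒m≤1+n q)))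
... | no x≰n = ≤-trans (Sum-mono (suc n) (λ k k≤n → le k (≤-trans k≤n (≰⇒> x≰n)))) (Sum-≤-mono g (≰⇒> x≰n))

Sum-pairs : ∀ n q f → (∀ k → f k + f (suc k) ≤ q) → Sum n f + Sum n f ≤ q * (1 + n)
Sum-pairs zero q f pair = z≤n
Sum-pairs (suc zero) q f pair = ≤-trans (+-mono-≤ one one) (≤-reflexive (double q))
  where one : f 0 ≤ q
        one = ≤-trans (m≤m+n (f 0) _) (pair 0)
        double : ∀ q → q + q ≡ q * 2
        double q = solve (q ∷ [])
Sum-pairs (suc (suc n)) q f pair = pair-sum (Sum n f) q n (f n) (f (suc n)) (Sum-pairs n q f pair) (pair n)

module _ {A : Set} where

  collect-list : ℕ → (ℕ → List A) → List A
  collect-list zero g = []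
  collect-list (suc n) g = collect-list n g ++ g n

  collect-length : ∀ n g → length (collect-list n g) ≡ Sum n (λ k → length (g k))
  collect-length zero g = refl
  collect-length (suc n) g = trans (length-++ (collect-list n g)) (cong (_+ length (g n)) (collect-length n g))

  collect-∈⁺ : ∀ n g k {x} → k < n → x ∈ g k → x ∈ collect-list n g
  collect-∈⁺ (suc n) g k k<n x∈ with m≤n⇒m<n∨m≡n (s≤s⁻¹ k<n)
  ... | inj₁ lt = ∈-++⁺ˡ (collect-∈⁺ n g k lt x∈)
  ... | inj₂ refl = ∈-++⁺ʳ (collect-list n g) x∈

  collect-∈⁻ : ∀ n g {x} → x ∈ collect-list n g → ∃ λ k → x ∈ g k
  collect-∈⁻ (suc n) g x∈ with ∈-++⁻ (collect-list n g) x∈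
  ... | inj₁ p = collect-∈⁻ n g p
  ... | inj₂ p = n , p

  along : ℕ → ℕ → (ℤ → List A) → List A
  along L R g = collect-list R (λ k → g (+ k)) ++ collect-list L (λ k → g -[1+ k ])

  along-∈⁺ : ∀ L R g c {x} → In L R c → x ∈ g c → x ∈ along L R g
  along-∈⁺ L R g (+ k) k< x∈ = ∈-++⁺ˡ (collect-∈⁺ R _ k k< x∈)
  along-∈⁺ L R g -[1+ k ] k< x∈ = ∈-++⁺ʳ (collect-list R (λ k → g (+ k))) (collect-∈⁺ L _ k k< x∈)

  along-∈⁻ : ∀ L R g {x} → x ∈ along L R g → ∃ λ c → x ∈ g c
  along-∈⁻ L R g x∈ with ∈-++⁻ (collect-list R (λ k → g (+ k))) x∈
  ... | inj₁ p = let (k , q) = collect-∈⁻ R _ p in + k , q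
  ... | inj₂ p = let (k , q) = collect-∈⁻ L _ p in -[1+ k ] , q

  opaque
    unfolding rng

    along-length : ∀ L R g → length (along L R g) ≡ rng L R (λ c → length (g c))
    along-length L R g = trans (length-++ (collect-list R (λ k → g (+ k))))
      (cong₂ _+_ (collect-length R _) (collect-length L _))

≤ᵇ-true : ∀ {m n} → m ≤ n → (m ≤ᵇ n) ≡ true
≤ᵇ-true {m} {n} le with m ≤ᵇ n | ≤⇒≤ᵇ le
... | true | _ = refl

≤ᵇ-false : ∀ {m n} → n < m → (m ≤ᵇ n) ≡ false
≤ᵇ-false {m} {n} lt with m ≤ᵇ n in e
... | false = refl
... | true = ⊥-elim (<⇒≱ lt (≤ᵇ⇒≤ m n (subst Bool.T (sym e) _)))

opaque
  unfolding rng

  -- Two adjacent points of a line carry at most q vertices, so a segment carries about q / 2 per unit of length.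
  segment : ∀ L R ρ x y a q (f : ℤ → ℕ) → (∀ c → f c + f (sc c) ≤ q) → L ≤ x ⊎ ρ ≤ x → R ≤ y ⊎ ρ ≤ y →
    2 * rng L (suc R) (λ c → ⟦ a ⊔ ∣ c ∣ ≤ᵇ ρ ⟧ * f c) ≤ q * (x + y + 3)
  segment L R ρ x y a q f pair hx hy = two-halves (Sum (suc R) (λ k → ⟦ a ⊔ k ≤ᵇ ρ ⟧ * f (+ k))) (Sum L (λ k → ⟦ a ⊔ suc k ≤ᵇ ρ ⟧ * f -[1+ k ])) q x y
      (≤-trans (+-mono-≤ right right) (Sum-pairs (suc y) q (λ k → f (+ k)) (λ k → pair (+ k))))
      (≤-trans (+-mono-≤ left left) (Sum-pairs x q (λ k → f -[1+ k ]) (λ k → ≤-trans (≤-reflexive (+-comm (f -[1+ k ]) _)) (pair -[1+ suc k ]))))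
    where
    drop : ∀ b n → ⟦ b ⟧ * n ≤ n
    drop true n = ≤-reflexive (+-identityʳ n)
    drop false n = z≤n
    zero-out : ∀ k n → ρ < k → ⟦ a ⊔ k ≤ᵇ ρ ⟧ * n ≡ 0
    zero-out k n lt = cong (λ b → ⟦ b ⟧ * n) (≤ᵇ-false (≤-trans lt (m≤n⊔m a k)))
    right : Sum (suc R) (λ k → ⟦ a ⊔ k ≤ᵇ ρ ⟧ * f (+ k)) ≤ Sum (suc y) (λ k → f (+ k))
    right = Sum-cut (suc R) (suc y) _ _ (λ k _ → drop (a ⊔ k ≤ᵇ ρ) _) λ k y<k k≤R → zero-out k _
      ([ (λ R≤y → ⊥-elim (<-irrefl refl (≤-trans y<k (≤-trans (s≤s⁻¹ k≤R) R≤y)))) , (λ ρ≤y → ≤-trans (s≤s ρ≤y) y<k) ]′ hy)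
    left : Sum L (λ k → ⟦ a ⊔ suc k ≤ᵇ ρ ⟧ * f -[1+ k ]) ≤ Sum x (λ k → f -[1+ k ])
    left = Sum-cut L x _ _ (λ k _ → drop (a ⊔ suc k ≤ᵇ ρ) _) λ k x≤k k<L → zero-out (suc k) _
      ([ (λ L≤x → ⊥-elim (<-irrefl refl (≤-trans k<L (≤-trans L≤x x≤k)))) , (λ ρ≤x → s≤s (≤-trans ρ≤x x≤k)) ]′ hx)

once : ∀ b t n → Sum t (λ s → ⟦ n ≡ᵇ (b + suc s) ⟧) ≤ ⟦ n ≤ᵇ b + t ⟧
once b zero n = z≤n
once b (suc t) n with n ≟ b + suc t
... | yes refl rewrite ≡ᵇ-refl (b + suc t) | ≤ᵇ-true (≤-refl {b + suc t}) =
  +-monoˡ-≤ 1 (≤-trans (once b t (b + suc t)) (≤-reflexive (cong ⟦_⟧ (≤ᵇ-false (≤-reflexive (sym (+-suc b t)))))))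
... | no n≢ rewrite ≡ᵇ-false n (b + suc t) n≢ = ≤-trans (≤-reflexive (+-identityʳ _))
  (≤-trans (once b t n) (⟦⟧-mono λ e → ≤ᵇ-true (≤-trans (≤ᵇ⇒≤ n (b + t) (subst Bool.T (sym e) _)) (+-monoʳ-≤ b (n≤1+n t)))))

InsideZ : ℕ → ℕ → ℤ → Set
InsideZ L R (+ k) = k < R
InsideZ L R -[1+ k ] = suc k < L

inside-step : ∀ {L R} z z′ → 1 ≤ L → 1 ≤ R → ∣ z ℤ.- z′ ∣ ≤ 1 → InsideZ L R z → InsideZ L R z′ ⊎ (z′ ≡ + R ⊎ z′ ≡ neg L)
inside-step {L} {R} z z′ 1≤L 1≤R d ins = go z (z ℤ.- z′) (e z z′) d ins
  where
  e : ∀ z z′ → z′ ≡ z ℤ.- (z ℤ.- z′)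
  e = ℤ-Solver.solve-∀
  atR : ∀ k → suc k ≤ R → InsideZ L R (+ suc k) ⊎ (+ suc k ≡ + R ⊎ + suc k ≡ neg L)
  atR k le = [ inj₁ , (λ { refl → inj₂ (inj₁ refl) }) ]′ (m≤n⇒m<n∨m≡n le)
  atL : ∀ k → suc k ≤ L → InsideZ L R -[1+ k ] ⊎ (-[1+ k ] ≡ + R ⊎ -[1+ k ] ≡ neg L)
  atL k le = [ inj₁ , (λ { refl → inj₂ (inj₂ refl) }) ]′ (m≤n⇒m<n∨m≡n le)
  same : ∀ {z z′} → z′ ≡ z → InsideZ L R z → InsideZ L R z′ ⊎ (z′ ≡ + R ⊎ z′ ≡ neg L)
  same refl i = inj₁ i
  upward : ∀ z → InsideZ L R z → InsideZ L R (sc z) ⊎ (sc z ≡ + R ⊎ sc z ≡ neg L)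
  upward (+ k) i = atR k i
  upward -[1+ zero ] i = inj₁ 1≤R
  upward -[1+ suc k ] i = inj₁ (<⇒≤ i)
  downward : ∀ z → InsideZ L R z → InsideZ L R (pd z) ⊎ (pd z ≡ + R ⊎ pd z ≡ neg L)
  downward (+ zero) i = atL 0 1≤L
  downward (+ suc k) i = inj₁ (<⇒≤ i)
  downward -[1+ k ] i = atL (suc k) i
  go : ∀ z δ → z′ ≡ z ℤ.- δ → ∣ δ ∣ ≤ 1 → InsideZ L R z → InsideZ L R z′ ⊎ (z′ ≡ + R ⊎ z′ ≡ neg L)
  go z (+ zero) eq _ i = same (trans eq (ℤ.+-identityʳ z)) i
  go z (+ suc zero) eq _ i = subst (λ y → InsideZ L R y ⊎ (y ≡ + R ⊎ y ≡ neg L)) (sym (trans eq (pd≡ z))) (downward z i)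
  go z (+ suc (suc n)) eq (s≤s ()) i
  go z -[1+ zero ] eq _ i = subst (λ y → InsideZ L R y ⊎ (y ≡ + R ⊎ y ≡ neg L)) (sym (trans eq (sc≡ z))) (upward z i)
  go z -[1+ suc n ] eq (s≤s ()) i

inside-In : ∀ {L R} z → InsideZ L R z → In L (suc R) z
inside-In (+ k) i = m≤n⇒m≤1+n i
inside-In -[1+ k ] i = <⇒≤ i

neg-In : ∀ L {R} → In L (suc R) (neg L)
neg-In zero = s≤s z≤n
neg-In (suc L) = ≤-refl

inside-abs : ∀ {L R r} z → L ≤ r → R ≤ r → InsideZ L R z → ∣ z ∣ ≤ r
inside-abs (+ k) L≤ R≤ i = ≤-trans (<⇒≤ i) R≤
inside-abs -[1+ k ] L≤ R≤ i = ≤-trans (<⇒≤ i) L≤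

abs-inside : ∀ {L R r} z → ∣ z ∣ ≤ r → r < L → r < R → InsideZ L R z
abs-inside (+ k) le lL lR = ≤-trans (s≤s le) lR
abs-inside -[1+ k ] le lL lR = ≤-trans (s≤s le) lL

_≟V_ : ∀ {h} (v w : Vtx h) → Dec (v ≡ w)
_≟V_ = Product.≡-dec ℤ._≟_ (Product.≡-dec ℤ._≟_ Fin._≟_)

any? : ∀ {A : Set} {Q : A → Set} → (∀ x → Dec (Q x)) → (L : List A) → Dec (∃ λ x → x ∈ L × Q x)
any? Q? [] = no λ { (_ , () , _) }
any? Q? (x ∷ L) with Q? x | any? Q? L
... | yes q | _ = yes (x , here refl , q)
... | no _ | yes (y , y∈ , q) = yes (y , there y∈ , q)
... | no ¬q | no ¬any = no λ { (y , here refl , q) → ¬q q ; (y , there y∈ , q) → ¬any (y , y∈ , q) }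

-- What containment has to know about either graph. Two adjacent points of a line carry at most `q`
-- vertices: on the diagonals one of them carries none, for king moves both carry a column. This is
-- the origin of the factor 2 between the rates.
record Layout {h : ℕ} (Adj : Vtx h → Vtx h → Set) (q : ℕ) : Set₁ where
  field
    φu φv : Vtx h → ℤ
    local : ∀ {w w′} → Adj w w′ → ∣ φu w ℤ.- φu w′ ∣ ≤ 1 × ∣ φv w ℤ.- φv w′ ∣ ≤ 1
    adj? : ∀ w w′ → Dec (Adj w w′)
    points : ℤ → ℤ → List (Vtx h)
    complete : ∀ w → w ∈ points (φu w) (φv w)
    sound : ∀ {u v w} → w ∈ points u v → φu w ≡ u × φv w ≡ v
    pairH : ∀ u v → length (points u v) + length (points (sc u) v) ≤ q
    pairV : ∀ u v → length (points u v) + length (points u (sc v)) ≤ q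
    pool : ℕ → List (Vtx h)
    pooled : ∀ {r} w → ∣ φu w ∣ ≤ r → ∣ φv w ∣ ≤ r → w ∈ pool r

module Contain {h : ℕ} {Adj : Vtx h → Vtx h → Set} {q : ℕ} (layout : Layout Adj q)
  (B₀ : List (Vtx h)) (M : ℕ) where
  open Layout layout
  open Game (layers Adj)
  open Reach Adj φu φv (λ {w} {w′} → local {w} {w′})

  b : ℕ
  b = proj₁ (radius B₀)

  opaque
    aS aE aW aN : ℕ
    -- At radius ρ = b + t each open end of a side costs `q * ρ` in the doubled count. S alone has
    -- two of them, covered by the rate once t ≥ 2 b + 3. After E, and again after W, two ends are
    -- open and one finished length is at most ρ; the constant rest is paid by the surplus ε, hence
    -- the factor `M * q` in `aE` and `aW`. From radius `aN` on the whole boundary costs at most 3 q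
    -- t.
    aS = 3 * b + 3
    aE = b + M * q * (3 * b + aS + 6) + aS
    aW = b + M * q * (3 * b + aE + 2 * aS + 9) + aE
    aN = 2 * aW + 2 * aE + 2 * aS + 12 + 3 * b

    aS-def : aS ≡ b + (2 * b + 3)
    aS-def = split b
      where split : ∀ b → 3 * b + 3 ≡ b + (2 * b + 3)
            split b = solve (b ∷ [])

    aE-def : aE ≡ b + M * q * (3 * b + aS + 6) + aS
    aE-def = refl

    aW-def : aW ≡ b + M * q * (3 * b + aE + 2 * aS + 9) + aE
    aW-def = refl

    aN-def : aN ≡ 2 * aW + 2 * aE + 2 * aS + 12 + 3 * b
    aN-def = refl

  a : Dir → ℕ
  a N = aN
  a E = aE
  a S = aS
  a W = aW

  aS≤aE : aS ≤ aE
  aS≤aE = ≤-trans (m≤n+m aS _) (≤-reflexive (sym aE-def))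

  aE≤aW : aE ≤ aW
  aE≤aW = ≤-trans (m≤n+m aE _) (≤-reflexive (sym aW-def))

  aW≤aN : aW ≤ aN
  aW≤aN = last-side aW aN aE aS b aN-def

  b<aS : b < aS
  b<aS = first-side b aS aS-def

  b<a : ∀ d → b < a d
  b<a N = ≤-trans b<aS (≤-trans aS≤aE (≤-trans aE≤aW aW≤aN))
  b<a E = ≤-trans b<aS aS≤aE
  b<a S = b<aS
  b<a W = ≤-trans b<aS (≤-trans aS≤aE aE≤aW)

  -- Every point of the boundary of the rectangle is protected at the last moment, when an unhindered fire would reach it.
  ring : Dir → ℕ → ℤ → List (Vtx h)
  ring d t c = if a d ⊔ ∣ c ∣ ≡ᵇ b + t then at d (a d) c points else []

  side : Dir → ℕ → List (Vtx h)
  side d t = along (a (lf d)) (suc (a (rt d))) (ring d t)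

  P : Strategy
  P t = side N t ++ side E t ++ side S t ++ side W t

  side⊆P : ∀ d t {w} → w ∈ side d t → w ∈ P t
  side⊆P N t w∈ = ∈-++⁺ˡ w∈
  side⊆P E t w∈ = ∈-++⁺ʳ (side N t) (∈-++⁺ˡ w∈)
  side⊆P S t w∈ = ∈-++⁺ʳ (side N t) (∈-++⁺ʳ (side E t) (∈-++⁺ˡ w∈))
  side⊆P W t w∈ = ∈-++⁺ʳ (side N t) (∈-++⁺ʳ (side E t) (∈-++⁺ʳ (side S t) w∈))

  P⊆side : ∀ t {w} → w ∈ P t → ∃ λ d → w ∈ side d t
  P⊆side t w∈ with ∈-++⁻ (side N t) w∈
  ... | inj₁ p = N , p
  ... | inj₂ w∈ with ∈-++⁻ (side E t) w∈
  ...   | inj₁ p = E , p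
  ...   | inj₂ w∈ with ∈-++⁻ (side S t) w∈
  ...     | inj₁ p = S , p
  ...     | inj₂ p = W , p

  fire-within : ∀ {t w} → Burning B₀ P t w → Within (b + t) w
  fire-within = within (proj₂ (radius B₀)) P

  coordinates : ∀ d k c {w r} → w ∈ at d k c points → Within r w → k ⊔ ∣ c ∣ ≤ r
  coordinates N k c w∈ (p , q) with sound w∈
  ... | refl , e = ⊔-lub (≤-trans (≤-reflexive (sym (cong ∣_∣ e))) q) p
  coordinates E k c w∈ (p , q) with sound w∈
  ... | e , refl = ⊔-lub (≤-trans (≤-reflexive (sym (cong ∣_∣ e))) p) q
  coordinates S k c w∈ (p , q) with sound w∈
  ... | refl , e = ⊔-lub (≤-trans (≤-reflexive (trans (sym (∣neg∣ k)) (sym (cong ∣_∣ e)))) q) p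
  coordinates W k c w∈ (p , q) with sound w∈
  ... | e , refl = ⊔-lub (≤-trans (≤-reflexive (trans (sym (∣neg∣ k)) (sym (cong ∣_∣ e)))) p) q

  not-yet : ∀ t w → w ∈ P (suc t) → ¬ Burning B₀ P t w
  not-yet t w w∈ burns with P⊆side (suc t) w∈
  ... | d , w∈d with along-∈⁻ (a (lf d)) (suc (a (rt d))) (ring d (suc t)) w∈d
  ...   | c , w∈c with a d ⊔ ∣ c ∣ ≡ᵇ b + suc t in e
  ...     | true = <-irrefl refl (≤-trans (≤-reflexive (sym (trans (≡ᵇ-true _ _ e) (+-suc b t)))) (coordinates d (a d) c w∈c (fire-within burns)))

  on-time : ∀ d c {t w} → In (a (lf d)) (suc (a (rt d))) c → w ∈ at d (a d) c points → Within (b + t) w → ProtectedBy P t w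
  on-time d c {t} {w} c-in w∈ near = s , +-cancelˡ-≤ b 1 s (≤-trans (≤-reflexive (+-comm b 1)) (≤-trans (≤-trans (b<a d) (m≤m⊔n (a d) ∣ c ∣)) (≤-reflexive b+s))) ,
      +-cancelˡ-≤ b s t (≤-trans (≤-reflexive (sym b+s)) (coordinates d (a d) c w∈ near)) ,
      side⊆P d s (along-∈⁺ (a (lf d)) (suc (a (rt d))) (ring d s) c c-in here′)
    where
    s : ℕ
    s = (a d ⊔ ∣ c ∣) ∸ b
    b+s : a d ⊔ ∣ c ∣ ≡ b + s
    b+s = sym (m+[n∸m]≡n (≤-trans (<⇒≤ (b<a d)) (m≤m⊔n (a d) ∣ c ∣)))
    here′ : w ∈ ring d s c
    here′ rewrite trans (cong (λ n → (a d ⊔ ∣ c ∣) ≡ᵇ n) (sym b+s)) (≡ᵇ-refl (a d ⊔ ∣ c ∣)) = w∈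

  Inside : Vtx h → Set
  Inside w = InsideZ aW aE (φu w) × InsideZ aS aN (φv w)

  1≤a : ∀ d → 1 ≤ a d
  1≤a d = ≤-trans (s≤s z≤n) (b<a d)

  -- Both coordinates change by at most one, so the fire could leave only through the boundary, at a
  -- point that an unhindered fire has reached by then; all of these are protected already, corners
  -- included.
  inside : ∀ {t w} → Burning B₀ P t w → Inside w
  inside (init {w} w∈) = let (p , q) = proj₂ (radius B₀) w∈ in abs-inside (φu w) p (b<a W) (b<a E) , abs-inside (φv w) q (b<a S) (b<a N)
  inside (stay burns) = inside burns
  inside (spread {t} {u} {w} burns adj free) with inside burns
  ... | iu , iv = result (inside-step (φu u) (φu w) (1≤a W) (1≤a E) (proj₁ (local adj)) iu) (inside-step (φv u) (φv w) (1≤a S) (1≤a N) (proj₂ (local adj)) iv)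
    where
    near : Within (b + suc t) w
    near = subst (λ r → Within r w) (sym (+-suc b t)) (within-step adj (fire-within burns))
    protected : ∀ d c → In (a (lf d)) (suc (a (rt d))) c → w ∈ at d (a d) c points → ⊥
    protected d c c-in w∈ = free (on-time d c c-in w∈ near)
    there′ : ∀ {u v} → φu w ≡ u → φv w ≡ v → w ∈ points u v
    there′ refl refl = complete w
    range : ∀ {L R z} → InsideZ L R z ⊎ (z ≡ + R ⊎ z ≡ neg L) → In L (suc R) z
    range {z = z} (inj₁ i) = inside-In z i
    range (inj₂ (inj₁ refl)) = ≤-refl
    range {L} (inj₂ (inj₂ refl)) = neg-In L
    result : InsideZ aW aE (φu w) ⊎ (φu w ≡ + aE ⊎ φu w ≡ neg aW) → InsideZ aS aN (φv w) ⊎ (φv w ≡ + aN ⊎ φv w ≡ neg aS) → Inside w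
    result (inj₁ i) (inj₁ j) = i , j
    result (inj₂ (inj₁ e)) y = ⊥-elim (protected E (φv w) (range y) (there′ e refl))
    result (inj₂ (inj₂ e)) y = ⊥-elim (protected W (φv w) (range y) (there′ e refl))
    result x@(inj₁ _) (inj₂ (inj₁ e)) = ⊥-elim (protected N (φu w) (range x) (there′ refl e))
    result x@(inj₁ _) (inj₂ (inj₂ e)) = ⊥-elim (protected S (φu w) (range x) (there′ refl e))

  cells-list : List (Vtx h)
  cells-list = pool (ΣD a)

  inside-listed : ∀ w → Inside w → w ∈ cells-list
  inside-listed w (i , j) = pooled w (inside-abs (φu w) (m≤n+m aW _) (≤-trans (m≤n+m aE aN) (≤-trans (m≤m+n _ aS) (m≤m+n _ aW))) i)
    (inside-abs (φv w) (≤-trans (m≤n+m aS _) (m≤m+n _ aW)) (≤-trans (m≤m+n aN aE) (≤-trans (m≤m+n _ aS) (m≤m+n _ aW))) j)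

  member? : ∀ (w : Vtx h) L → Dec (w ∈ L)
  member? w = Any.any? (w ≟V_)

  protected? : ∀ t w → Dec (ProtectedBy P t w)
  protected? zero w = no λ { (s , 1≤s , s≤0 , _) → <-irrefl refl (≤-trans 1≤s s≤0) }
  protected? (suc t) w = map′
    [ (λ { (s , 1≤s , s≤t , w∈) → s , 1≤s , m≤n⇒m≤1+n s≤t , w∈ }) , (λ w∈ → suc t , s≤s z≤n , ≤-refl , w∈) ]′
    (λ { (s , 1≤s , s≤t , w∈) → [ (λ lt → inj₁ (s , 1≤s , s≤s⁻¹ lt , w∈)) , (λ { refl → inj₂ w∈ }) ]′ (m≤n⇒m<n∨m≡n s≤t) })
    (protected? t w ⊎-dec member? w (P (suc t)))

  opaque
    -- Decidable because any neighbour that spreads the fire lies in the finite list of vertices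
    -- inside the rectangle.
    burning? : ∀ t w → Dec (Burning B₀ P t w)
    burning? zero w = map′ init (λ { (init w∈) → w∈ }) (member? w B₀)
    burning? (suc t) w = map′
      [ stay , (λ { ((u , _ , burns , adj) , free) → spread burns adj free }) ]′
      (λ { (stay burns) → inj₁ burns ; (spread {u = u} burns adj free) → inj₂ ((u , inside-listed u (inside burns) , burns , adj) , free) })
      (burning? t w ⊎-dec (any? (λ u → burning? t u ×-dec adj? u w) cells-list ×-dec ¬? (protected? (suc t) w)))


  Stable : ℕ → Set
  Stable t = ∀ w → Burning B₀ P (suc t) w → Burning B₀ P t w

  -- Protection only increases, so a vertex catching fire from an old fire would have caught it one
  -- turn before.
  stable-next : ∀ t → Stable t → Stable (suc t)
  stable-next t st w (stay burns) = burns
  stable-next t st w (spread burns adj free) = spread (st _ burns) adj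
    λ { (s , 1≤s , s≤t , w∈) → free (s , 1≤s , m≤n⇒m≤1+n s≤t , w∈) }

  burnt-in : ℕ → List (Vtx h) → ℕ
  burnt-in t [] = 0
  burnt-in t (w ∷ L) = ⟦ does (burning? t w) ⟧ + burnt-in t L

  burnt-in-≤ : ∀ t L → burnt-in t L ≤ length L
  burnt-in-≤ t [] = z≤n
  burnt-in-≤ t (w ∷ L) = +-mono-≤ (bit (does (burning? t w))) (burnt-in-≤ t L)
    where bit : ∀ b → ⟦ b ⟧ ≤ 1
          bit true = ≤-refl
          bit false = z≤n

  burnt-in-mono : ∀ t L → burnt-in t L ≤ burnt-in (suc t) L
  burnt-in-mono t [] = z≤n
  burnt-in-mono t (w ∷ L) = +-mono-≤ one (burnt-in-mono t L)
    where one : ⟦ does (burning? t w) ⟧ ≤ ⟦ does (burning? (suc t) w) ⟧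
          one with burning? t w | burning? (suc t) w
          ... | yes burns | yes _ = ≤-refl
          ... | yes burns | no ¬burns = ⊥-elim (¬burns (stay burns))
          ... | no _ | _ = z≤n

  stable-or-grows : ∀ t L → (∀ w → w ∈ L → Burning B₀ P (suc t) w → Burning B₀ P t w) ⊎ suc (burnt-in t L) ≤ burnt-in (suc t) L
  stable-or-grows t [] = inj₁ λ { _ () }
  stable-or-grows t (w ∷ L) with burning? t w | burning? (suc t) w | stable-or-grows t L
  ... | yes burns | no ¬burns | _ = ⊥-elim (¬burns (stay burns))
  ... | no _ | yes _ | _ = inj₂ (s≤s (burnt-in-mono t L))
  ... | yes burns | yes _ | inj₁ st = inj₁ λ { _ (here refl) _ → burns ; x (there x∈) bx → st x x∈ bx }
  ... | no _ | no ¬burns | inj₁ st = inj₁ λ { _ (here refl) bx → ⊥-elim (¬burns bx) ; x (there x∈) bx → st x x∈ bx }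
  ... | yes _ | yes _ | inj₂ more = inj₂ (s≤s more)
  ... | no _ | no _ | inj₂ more = inj₂ more

  stops-or-burns : ∀ t → (∃ λ T → Stable T) ⊎ t ≤ burnt-in t cells-list
  stops-or-burns zero = inj₂ z≤n
  stops-or-burns (suc t) with stops-or-burns t
  ... | inj₁ stops = inj₁ stops
  ... | inj₂ many with stable-or-grows t cells-list
  ...   | inj₁ st = inj₁ (t , λ w burns → st w (inside-listed w (inside burns)) burns)
  ...   | inj₂ more = inj₂ (≤-trans (s≤s many) more)

  contains : Contains B₀ P
  contains with stops-or-burns (suc (length cells-list))
  ... | inj₂ many = ⊥-elim (<-irrefl refl (≤-trans many (burnt-in-≤ _ cells-list)))
  ... | inj₁ (T , st) = T , λ t T≤t w → subst Stable (m∸n+n≡m T≤t) (later (t ∸ T)) w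
    where later : ∀ k → Stable (k + T)
          later zero = st
          later (suc k) = stable-next (k + T) (later k)

  carried : Dir → ℕ → ℕ
  carried d ρ = rng (a (lf d)) (suc (a (rt d))) (λ c → ⟦ a d ⊔ ∣ c ∣ ≤ᵇ ρ ⟧ * length (at d (a d) c points))

  count-carried : ∀ t → count P t ≤ ΣD (λ d → carried d (b + t))
  count-carried t = ≤-trans (≤-reflexive (counts t)) (≤-trans (≤-reflexive (spreads t)) (+-mono-≤ (+-mono-≤ (+-mono-≤ (each N) (each E)) (each S)) (each W)))
    where
    len : Dir → ℕ → ℕ
    len d s = length (side d (suc s))
    lengths : ∀ s → length (P (suc s)) ≡ ΣD (λ d → len d s)
    lengths s = trans (length-++ (side N (suc s))) (trans (cong (_+_ (len N s)) (trans (length-++ (side E (suc s))) (cong (_+_ (len E s)) (length-++ (side S (suc s))))))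
      (o (len N s) (len E s) (len S s) (len W s)))
      where o : ∀ n e s w → n + (e + (s + w)) ≡ n + e + s + w
            o n e s w = solve (n ∷ e ∷ s ∷ w ∷ [])
    counts : ∀ t → count P t ≡ Sum t (λ s → ΣD (λ d → len d s))
    counts zero = refl
    counts (suc t) = cong₂ _+_ (counts t) (lengths t)
    spreads : ∀ t → Sum t (λ s → ΣD (λ d → len d s)) ≡ ΣD (λ d → Sum t (len d))
    spreads t = trans (Sum-+ t _ _) (cong (_+ Sum t (len W)) (trans (Sum-+ t _ _) (cong (_+ Sum t (len S)) (Sum-+ t _ _))))
    ring-length : ∀ d s c → length (ring d s c) ≡ length (at d (a d) c points) * ⟦ a d ⊔ ∣ c ∣ ≡ᵇ b + s ⟧
    ring-length d s c with a d ⊔ ∣ c ∣ ≡ᵇ b + s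
    ... | true = sym (*-identityʳ _)
    ... | false = sym (*-zeroʳ (length (at d (a d) c points)))
    each : ∀ d → Sum t (len d) ≤ carried d (b + t)
    each d = ≤-trans (≤-reflexive (trans (Sum-cong t λ s → along-length (a (lf d)) (suc (a (rt d))) (ring d (suc s))) (rng-Sum t _ _ (λ s c → length (ring d (suc s) c)))))
      (rng-mono′ _ _ λ c → ≤-trans (≤-reflexive (trans (Sum-cong t λ s → ring-length d (suc s) c) (Sum-* t (length (at d (a d) c points)) _)))
        (≤-trans (*-monoʳ-≤ (length (at d (a d) c points)) (once b t (a d ⊔ ∣ c ∣))) (≤-reflexive (*-comm (length (at d (a d) c points)) _))))

  absent : ∀ d ρ → ρ < a d → 2 * carried d ρ ≤ 0
  absent d ρ lt = ≤-trans (scale 2 (≤-trans (rng-mono′ _ _ λ c → ≤-reflexive (cong (λ z → ⟦ z ⟧ * length (at d (a d) c points)) (≤ᵇ-false {a d ⊔ ∣ c ∣} (≤-trans lt (m≤m⊔n (a d) ∣ c ∣)))))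
    (≤-reflexive (rng-zero _ _)))) z≤n

  pairs : ∀ d c → length (at d (a d) c points) + length (at d (a d) (sc c) points) ≤ q
  pairs N c = pairH c (+ aN)
  pairs E c = pairV (+ aE) c
  pairs S c = pairH c (neg aS)
  pairs W c = pairV (neg aW) c

  present : ∀ d ρ x y → a (lf d) ≤ x ⊎ ρ ≤ x → a (rt d) ≤ y ⊎ ρ ≤ y → 2 * carried d ρ ≤ q * (x + y + 3)
  present d ρ x y hx hy = segment (a (lf d)) (a (rt d)) ρ x y (a d) q (λ c → length (at d (a d) c points)) (pairs d) hx hy

  enough : ∀ t → M * (2 * count P t) ≤ (3 * q * M + 2) * t
  enough t = ≤-trans (scale M (≤-trans (scale 2 (count-carried t)) (≤-reflexive (twice (carried N ρ) (carried E ρ) (carried S ρ) (carried W ρ))))) bound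
    where
    ρ = b + t
    twice : ∀ n e s w → 2 * (n + e + s + w) ≡ 2 * s + 2 * e + 2 * w + 2 * n
    twice n e s w = solve (n ∷ e ∷ s ∷ w ∷ [])
    waits : ∀ {x} → b + x ≤ ρ → x ≤ t
    waits {x} le = +-cancelˡ-≤ b x t le
    bound : M * (2 * carried S ρ + 2 * carried E ρ + 2 * carried W ρ + 2 * carried N ρ) ≤ (3 * q * M + 2) * t
    bound with ρ <? aS | ρ <? aE | ρ <? aW | ρ <? aN
    ... | yes s | _ | _ | _ = ≤-trans (scale M (+-mono-≤ (+-mono-≤ (+-mono-≤ (absent S ρ s) (absent E ρ (≤-trans s aS≤aE)))
            (absent W ρ (≤-trans s (≤-trans aS≤aE aE≤aW)))) (absent N ρ (≤-trans s (≤-trans aS≤aE (≤-trans aE≤aW aW≤aN)))))) (≤-trans (≤-reflexive (*-zeroʳ M)) z≤n)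
    ... | no s | yes e | _ | _ = ≤-trans (scale M (+-mono-≤ (+-mono-≤ (+-mono-≤ (present S ρ ρ ρ (inj₂ ≤-refl) (inj₂ ≤-refl)) (absent E ρ e))
            (absent W ρ (≤-trans e aE≤aW))) (absent N ρ (≤-trans e (≤-trans aE≤aW aW≤aN)))))
            (≤-trans (≤-reflexive (cong (M *_) (trans (+-identityʳ _) (trans (+-identityʳ _) (+-identityʳ _))))) (phase₁ M q b t ρ refl (waits (≤-trans (≤-reflexive (sym aS-def)) (≮⇒≥ s)))))
    ... | no s | no e | yes w | _ = ≤-trans (scale M (+-mono-≤ (+-mono-≤ (+-mono-≤ (present S ρ ρ aE (inj₂ ≤-refl) (inj₁ ≤-refl)) (present E ρ aS ρ (inj₁ ≤-refl) (inj₂ ≤-refl)))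
            (absent W ρ w)) (absent N ρ (≤-trans w aW≤aN))))
            (≤-trans (≤-reflexive (cong (M *_) (trans (+-identityʳ _) (+-identityʳ _)))) (phase₂ M q b t ρ aS aE refl (waits (≤-trans (≤-trans (m≤m+n _ aS) (≤-reflexive (sym aE-def))) (≮⇒≥ e))) (≮⇒≥ e)))
    ... | no s | no e | no w | yes n = ≤-trans (scale M (+-mono-≤ (+-mono-≤ (+-mono-≤ (present S ρ aW aE (inj₁ ≤-refl) (inj₁ ≤-refl)) (present E ρ aS ρ (inj₁ ≤-refl) (inj₂ ≤-refl)))
            (present W ρ aS ρ (inj₁ ≤-refl) (inj₂ ≤-refl))) (absent N ρ n)))
            (≤-trans (≤-reflexive (cong (M *_) (+-identityʳ _))) (phase₃ M q b t ρ aS aE aW refl (waits (≤-trans (≤-trans (m≤m+n _ aE) (≤-reflexive (sym aW-def))) (≮⇒≥ w))) (≮⇒≥ w)))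
    ... | no s | no e | no w | no n = ≤-trans (scale M (+-mono-≤ (+-mono-≤ (+-mono-≤ (present S ρ aW aE (inj₁ ≤-refl) (inj₁ ≤-refl)) (present E ρ aS aN (inj₁ ≤-refl) (inj₁ ≤-refl)))
            (present W ρ aS aN (inj₁ ≤-refl) (inj₁ ≤-refl))) (present N ρ aW aE (inj₁ ≤-refl) (inj₁ ≤-refl))))
            (phase₄ M q b t ρ aS aE aW aN refl aN-def (≮⇒≥ n))

-- The two graphs in their coordinates

∣∣-twice : ∀ z → ∣ z ∣ ≤ ∣ z ℤ.+ z ∣
∣∣-twice (+ n) = m≤m+n n n
∣∣-twice -[1+ n ] = s≤s (≤-trans (m≤m+n n n) (n≤1+n _))

twice-injective : ∀ x y → x ℤ.+ x ≡ y ℤ.+ y → x ≡ y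
twice-injective x y e = ℤ.*-cancelˡ-≡ (+ 2) x y (trans (d x) (trans e (sym (d y))))
  where d : ∀ z → + 2 ℤ.* z ≡ z ℤ.+ z
        d = ℤ-Solver.solve-∀

path? : ∀ {h} (i j : Fin h) → Dec (PathAdj i j)
path? i j = (suc (toℕ i) ≟ toℕ j) ⊎-dec (suc (toℕ j) ≟ toℕ i)

module _ (h : ℕ) where

  column-of : ℤ → ℤ → List (Vtx h)
  column-of x y = map (λ i → x , y , i) (allFin h)

  column-length : ∀ x y → length (column-of x y) ≡ h
  column-length x y = trans (length-map (λ i → x , y , i) (allFin h)) (length-tabulate {n = h} (λ i → i))

  column-∈ : ∀ x y i → (x , y , i) ∈ column-of x y
  column-∈ x y i = ∈-map⁺ (λ i → x , y , i) (∈-allFin i)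

  -- The equations x + y = u and x - y = v force 2 x = u + v = z, so an odd z leaves no vertex. The
  -- halving of z is an argument in order to be matched on.
  fill : ∀ u z → (∃ λ k → (z ≡ k ℤ.+ k ⊎ z ≡ sc (k ℤ.+ k)) × ∣ k ∣ ≤ ∣ z ∣) → List (Vtx h)
  fill u z (k , inj₁ _ , _) = column-of k (u ℤ.- k)
  fill u z (k , inj₂ _ , _) = []

  fill-length : ∀ u z r → length (fill u z r) ≡ on (even ∣ z ∣) h
  fill-length u .(k ℤ.+ k) (k , inj₁ refl , _) rewrite even-twice k = column-length k (u ℤ.- k)
  fill-length u .(sc (k ℤ.+ k)) (k , inj₂ refl , _) rewrite even-sc (k ℤ.+ k) | even-twice k = refl

  fill-sound : ∀ u v z r {x y i} → z ≡ u ℤ.+ v → (x , y , i) ∈ fill u z r → x ℤ.+ y ≡ u × x ℤ.- y ≡ v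
  fill-sound u v z (k , inj₁ e , _) e′ w∈ with ∈-map⁻ (λ i → k , u ℤ.- k , i) w∈
  ... | _ , _ , refl = e₁ u k , trans (e₂ u k) (trans (cong (ℤ._- u) (trans (sym e) e′)) (e₃ u v))
    where e₁ : ∀ u k → k ℤ.+ (u ℤ.- k) ≡ u
          e₁ = ℤ-Solver.solve-∀
          e₂ : ∀ u k → k ℤ.- (u ℤ.- k) ≡ k ℤ.+ k ℤ.- u
          e₂ = ℤ-Solver.solve-∀
          e₃ : ∀ u v → u ℤ.+ v ℤ.- u ≡ v
          e₃ = ℤ-Solver.solve-∀

  fill-complete : ∀ x y i z r → z ≡ x ℤ.+ x → (x , y , i) ∈ fill (x ℤ.+ y) z r
  fill-complete x y i z (k , inj₁ e , _) e′ with twice-injective k x (trans (sym e) e′)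
  ... | refl = subst (λ t → (x , y , i) ∈ column-of x t) (e₁ x y) (column-∈ x y i)
    where e₁ : ∀ x y → y ≡ x ℤ.+ y ℤ.- x
          e₁ = ℤ-Solver.solve-∀
  fill-complete x y i z (k , inj₂ e , _) e′ with trans (sym (even-twice x)) (trans (cong (λ t → even ∣ t ∣) (trans (sym e′) e)) (trans (even-sc (k ℤ.+ k)) (cong not (even-twice k))))
  ... | ()

  fill-pair : ∀ u u′ z z′ r r′ → z′ ≡ sc z → length (fill u z r) + length (fill u′ z′ r′) ≤ 1 * h
  fill-pair u u′ z z′ r r′ refl = ≤-trans (≤-reflexive (cong₂ _+_ (fill-length u z r)
      (trans (fill-length u′ (sc z) r′) (cong (λ b → on b h) (even-sc z))))) (one (even ∣ z ∣))
    where one : ∀ b → on b h + on (not b) h ≤ 1 * h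
          one true = ≤-refl
          one false = ≤-reflexive (sym (+-identityʳ h))

  layout₁ : 1 ≤ h → Layout (Graph.Adj (G₁ h)) (1 * h)
  layout₁ 1≤h = record
    { φu = φu ; φv = φv
    ; local = λ {w} {w′} → local₁ {w} {w′}
    ; adj? = λ { (x , y , i) (x′ , y′ , j) → ((i Fin.≟ j) ×-dec (∣ x ℤ.- x′ ∣ + ∣ y ℤ.- y′ ∣ ≟ 1))
        ⊎-dec ((x ℤ.≟ x′) ×-dec ((y ℤ.≟ y′) ×-dec path? i j)) }
    ; points = λ u v → fill u (u ℤ.+ v) (half (u ℤ.+ v))
    ; complete = λ { (x , y , i) → fill-complete x y i _ (half (x ℤ.+ y ℤ.+ (x ℤ.- y))) (sum x y) }
    ; sound = λ { {u} {v} {x , y , i} w∈ → fill-sound u v _ (half (u ℤ.+ v)) refl w∈ }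
    ; pairH = λ u v → fill-pair u (sc u) _ _ (half (u ℤ.+ v)) (half (sc u ℤ.+ v)) (left u v)
    ; pairV = λ u v → fill-pair u u _ _ (half (u ℤ.+ v)) (half (u ℤ.+ sc v)) (right u v)
    ; pool = λ r → grid h (r + r)
    ; pooled = λ { {r} (x , y , i) p q → ∈-grid (r + r) x y i
        (≤-trans (∣∣-twice x) (≤-trans (≤-reflexive (cong ∣_∣ (sym (sum x y)))) (≤-trans (ℤ.∣i+j∣≤∣i∣+∣j∣ (x ℤ.+ y) (x ℤ.- y)) (+-mono-≤ p q))))
        (≤-trans (∣∣-twice y) (≤-trans (≤-reflexive (cong ∣_∣ (sym (difference x y)))) (≤-trans (ℤ.∣i-j∣≤∣i∣+∣j∣ (x ℤ.+ y) (x ℤ.- y)) (+-mono-≤ p q)))) } }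
    where
    open Cartesian h 1≤h
    sum : ∀ x y → x ℤ.+ y ℤ.+ (x ℤ.- y) ≡ x ℤ.+ x
    sum = ℤ-Solver.solve-∀
    difference : ∀ x y → x ℤ.+ y ℤ.- (x ℤ.- y) ≡ y ℤ.+ y
    difference = ℤ-Solver.solve-∀
    left : ∀ u v → sc u ℤ.+ v ≡ sc (u ℤ.+ v)
    left u v = trans (cong (ℤ._+ v) (sc-suc u)) (trans (e u v) (sc≡ (u ℤ.+ v)))
      where e : ∀ u v → u ℤ.+ ℤ.1ℤ ℤ.+ v ≡ u ℤ.+ v ℤ.+ ℤ.1ℤ
            e = ℤ-Solver.solve-∀
    right : ∀ u v → u ℤ.+ sc v ≡ sc (u ℤ.+ v)
    right u v = trans (cong (ℤ._+_ u) (sc-suc v)) (trans (e u v) (sc≡ (u ℤ.+ v)))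
      where e : ∀ u v → u ℤ.+ (v ℤ.+ ℤ.1ℤ) ≡ u ℤ.+ v ℤ.+ ℤ.1ℤ
            e = ℤ-Solver.solve-∀

  layout₂ : 1 ≤ h → Layout (Graph.Adj (G₂ h)) (2 * h)
  layout₂ 1≤h = record
    { φu = column ; φv = row
    ; local = λ {w} {w′} → local₂ {w} {w′}
    ; adj? = λ { (x , y , i) (x′ , y′ , j) → ((i Fin.≟ j) ×-dec (∣ x ℤ.- x′ ∣ ⊔ ∣ y ℤ.- y′ ∣ ≟ 1))
        ⊎-dec ((x ℤ.≟ x′) ×-dec ((y ℤ.≟ y′) ×-dec path? i j)) }
    ; points = column-of
    ; complete = λ { (x , y , i) → column-∈ x y i }
    ; sound = λ { {u} {v} {w} w∈ → located u v w∈ }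
    ; pairH = λ u v → two u v (sc u) v
    ; pairV = λ u v → two u v u (sc v)
    ; pool = grid h
    ; pooled = λ { {r} (x , y , i) p q → ∈-grid r x y i p q } }
    where
    open Strong h 1≤h
    located : ∀ u v {w} → w ∈ column-of u v → column w ≡ u × row w ≡ v
    located u v w∈ with ∈-map⁻ (λ i → u , v , i) w∈
    ... | _ , _ , refl = refl , refl
    two : ∀ u v u′ v′ → length (column-of u v) + length (column-of u′ v′) ≤ 2 * h
    two u v u′ v′ = ≤-reflexive (cong₂ _+_ (column-length u v) (trans (column-length u′ v′) (sym (+-identityʳ h))))

containable : ∀ {h q} {Adj : Vtx h → Vtx h → Set} → Layout Adj (q * h) → let open Game (layers Adj) in
  ∀ ε → ℚ.0ℚ ℚ.< ε → ∀ B₀ → Σ Strategy λ P → Legal (linear (((+ (3 * q * h)) / 2) ℚ.+ ε)) B₀ P × Contains B₀ P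
containable {h} {q} layout ε 0<ε B₀ = P , (not-yet , λ t → spend (3 * q * h) (count P t) t (within-budget t)) , contains
  where
  d : ℕ
  d = proj₁ (rate-reached ε 0<ε)
  spend = proj₂ (rate-reached ε 0<ε)
  -- With M = 1 + d the bound `enough` is a rate of 3 q h / 2 + 1 / M, and ε is at least 1 / M.
  open Contain layout B₀ (suc d)
  open Game (layers _) using (count)
  within-budget : ∀ t → count P t * (2 * suc d) ≤ (3 * q * h * suc d + 2) * t
  within-budget t = ≤-trans (≤-reflexive (l (count P t) (suc d))) (≤-trans (enough t) (≤-reflexive (cong (λ z → (z * suc d + 2) * t) (sym (*-assoc 3 q h)))))
    where l : ∀ c m → c * (2 * m) ≡ m * (2 * c)
          l c m = solve (c ∷ m ∷ [])

theorem1 : (h : ℕ) → .{{_ : NonZero h}} → (q : ℕ) → (q ≡ 1 ⊎ q ≡ 2) →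
    Game.IsCriticalRate (Gq q h) ((+ (3 * q * h)) / 2)
theorem1 h .1 (inj₁ refl) = Cartesian.uncontainable h (>-nonZero⁻¹ h) , containable {h} {1} (layout₁ h (>-nonZero⁻¹ h))
theorem1 h .2 (inj₂ refl) = Strong.uncontainable h (>-nonZero⁻¹ h) , containable {h} {2} (layout₂ h (>-nonZero⁻¹ h))
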